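{- Let $(V,d)$ be a finite rational metric space with $n=|V|\ge2$ and let $k$ be an even integer with $2\le k\le 2n/3$. The centered all-cut algorithm with parameter $m=3k/2$ is a factor-$7/2$ approximation for exact-$k$ remote matching: the set $T_m$ it returns satisfies $|T_m|=k$ and \[ \mu(T_m)\ \ge\ \frac27\,\mathrm{OPT}_k . \]
   Context: For $T\subseteq V$ with $|T|$ even, $\mu(T)$ denotes the minimum total $d$-cost of a perfect matching on $T$ ($\mu(\varnothing)=0$). For even $k$ with $0\le k\le n$, the exact-$k$ remote matching problem asks for $T\subseteq V$, $|T|=k$, maximizing $\mu(T)$; $\mathrm{OPT}_k:=\max\{\mu(T):T\subseteq V,\ |T|=k\}$. Cut packings. For nonempty $X\subseteq V$ let $d_X$ be the restriction of $d$, $E_X=\binom X2$, and for nonempty proper $S\subsetneq X$ let $\delta_X(S)=\{uv\in E_X:|\{u,v\}\cap S|=1\}$. Fix a root $r\in X$ and let $\mathcal A(X)=\{S:\varnothing\ne S\subseteq X\setminus\{r\}\}$ (one representative per nontrivial cut of $X$). A feasible all-cut packing on $(X,d_X)$ is a vector $y\ge0$ indexed by $\mathcal A(X)$ with $\sum_{S\in\mathcal A(X):\,e\in\delta_X(S)}y_S\le d_X(e)$ for all $e\in E_X$; it is optimal if it maximizes $\sum_S y_S$. It is laminar if any two sets $S$ with $y_S>0$ are disjoint or nested. Laminar tree. For a laminar packing $y$ with support $\mathcal L=\{S:y_S>0\}$, $\mathcal T_y$ is the inclusion tree of $\mathcal L\cup\{X\}\cup\{\{v\}:v\in X\}$, rooted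 at $X$, in which each proper set is joined to its smallest strict superset in the family; the edge from $S\in\mathcal L$ to its parent has weight $y_S$, all other edges have weight $0$; the singleton $\{v\}$ is the leaf labelled $v$. Nodes with more than two children are then refined by zero-weight edges into a rooted binary tree (every internal node having exactly two children) with the same labelled leaves. For even $T\subseteq X$, $J_{\mathcal T_y}(T)$ is the set of tree edges $e$ such that the number of leaves labelled by elements of $T$ below $e$ is odd, and $w(F)$ is the total weight of an edge set $F$. Farthest-first. For $1\le\ell\le|X|$, $\mathrm{FarthestFirst}(X,\ell)$ starts with an arbitrary point of $X$ (fixed by the input order) and repeatedly adds a not yet selected point whose distance from the set of points chosen so far is maximum (ties broken by input order), until $\ell$ points are selected. Centered all-cut algorithm (for even $k$ with $2\le k<n$ and integer parameter $m\in\{k,\dots,n\}$): set $C:=\mathrm{FarthestFirst}(V,m)$; compute an optimal laminar all-cut packing $y^C$ on $(C,d_C)$; construct $\mathcal T_C:=\mathcal T_{y^C}$; return a set $T_m\in\arg\max\{w(J_{\mathcal T_C}(T)):T\subseteq C,\ |T|=k\}$. This is implemented as a deterministic polynomial-time algorithm. -}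

module Defs where

open import Data.Bool.Base using (if_then_else_)
open import Data.Fin.Base using (Fin; _<_)
open import Data.Fin.Properties using (_<?_; all?)
open import Data.Fin.Subset using
  (Subset; inside; outside; ⊤; ⊥; ⁅_⁆; _∈_; _⊆_; _⊂_; _∩_; _∪_; _─_; _-_; ∣_∣; Nonempty; Empty)
open import Data.Fin.Subset.Properties using (_∈?_; _⊆?_; nonempty?)
open import Data.List.Base using
  (List; []; _∷_; _++_; map; foldr; filter; length; allFin; cartesianProduct)
open import Data.List.Membership.Propositional using () renaming (_∈_ to _∈ₗ_)
open import Data.List.Relation.Binary.Permutation.Propositional using (_↭_)
open import Data.List.Relation.Binary.Pointwise.Base using (Pointwise)
open import Data.List.Relation.Unary.Unique.Propositional using (Unique)
open import Data.Nat.Base using (ℕ; zero; suc)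
import Data.Nat.Base as ℕ
import Data.Nat.Properties as ℕ
open import Data.Nat.Divisibility using (_∣_; _∣?_)
open import Data.Product.Base using (Σ; ∃; _×_; _,_; proj₁; proj₂; uncurry)
open import Data.Rational.Base using (ℚ; 0ℚ; _+_; _≤_) renaming (_<_ to _<ℚ_)
open import Data.Rational.Properties using (≤-decTotalOrder) renaming (_<?_ to _<ℚ?_)
open import Relation.Binary.Bundles using (DecTotalOrder)
open import Data.List.Extrema (DecTotalOrder.totalOrder ≤-decTotalOrder) using (min; max)
open import Data.Sum.Base using (_⊎_)
open import Data.Vec.Base using ([]; _∷_)
open import Function.Bundles using (_⇔_)
open import Function.Metric.Rational.Core using (DistanceFunction)
open import Relation.Binary.Construct.Closure.ReflexiveTransitive using (Star)
open import Relation.Binary.PropositionalEquality.Core using (_≡_; _≢_)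
open import Relation.Nullary.Decidable using (Dec; does; ¬?; _×-dec_; _→-dec_)
open import Relation.Nullary.Negation using (¬_)

private
  variable
    n : ℕ
    A : Set

-- The ground set V is Fin n; its numerical order is the input order.

------------------------------------------------------------------------
-- Finite sums, extrema and enumerations

sum : (A → ℚ) → List A → ℚ
sum f xs = foldr _+_ 0ℚ (map f xs)

-- The value 0 on the empty list is a dummy.
minimum : List ℚ → ℚ
minimum []       = 0ℚ
minimum (x ∷ xs) = min x xs

maximum : List ℚ → ℚ
maximum []       = 0ℚ
maximum (x ∷ xs) = max x xs

-- Earliest maximiser of f in x ∷ xs.
firstArgmax : (A → ℚ) → A → List A → A
firstArgmax f x []       = x
firstArgmax f x (y ∷ ys) =
  if does (f x <ℚ? f y) then firstArgmax f y ys else firstArgmax f x ys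

allSubsets : ∀ n → List (Subset n)
allSubsets zero    = [] ∷ []
allSubsets (suc n) =
  map (outside ∷_) (allSubsets n) ++ map (inside ∷_) (allSubsets n)

sublists : List A → List (List A)
sublists []       = [] ∷ []
sublists (x ∷ xs) = sublists xs ++ map (x ∷_) (sublists xs)

elements : Subset n → List (Fin n)
elements X = filter (_∈? X) (allFin _)

------------------------------------------------------------------------
-- Edges and matchings

-- The unordered pair {u , v} is represented by (u , v) with u < v.
Edge : ℕ → Set
Edge n = Fin n × Fin n

ends : Edge n → Subset n
ends (u , v) = ⁅ u ⁆ ∪ ⁅ v ⁆

E : Subset n → List (Edge n)
E X = filter (λ (u , v) → u <? v) (cartesianProduct (elements X) (elements X))

IsPerfectMatching : Subset n → List (Edge n) → Set
IsPerfectMatching T M =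
  ∀ v → v ∈ T → length (filter (λ e → v ∈? ends e) M) ≡ 1

isPerfectMatching? : (T : Subset n) (M : List (Edge n)) →
                     Dec (IsPerfectMatching T M)
isPerfectMatching? T M = all? λ v →
  (v ∈? T) →-dec (length (filter (λ e → v ∈? ends e) M) ℕ.≟ 1)

perfectMatchings : Subset n → List (List (Edge n))
perfectMatchings T = filter (isPerfectMatching? T) (sublists (E T))

cost : DistanceFunction (Fin n) → List (Edge n) → ℚ
cost d = sum (uncurry d)

-- Meaningful for ∣ T ∣ even; an odd T has no perfect matching.
μ : DistanceFunction (Fin n) → Subset n → ℚ
μ d T = minimum (map (cost d) (perfectMatchings T))

-- Meaningful for k ≤ n, so that some T has size k.
OPT : DistanceFunction (Fin n) → ℕ → ℚ
OPT {n} d k = maximum (map (μ d) (filter (λ T → ∣ T ∣ ℕ.≟ k) (allSubsets n)))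

------------------------------------------------------------------------
-- Farthest-first traversal

dist : DistanceFunction (Fin n) → Fin n → Subset n → ℚ
dist d v C = minimum (map (d v) (elements C))

addFarthest : DistanceFunction (Fin n) → Subset n → Subset n → Subset n
addFarthest d X C with elements (X ─ C)
... | []     = C
... | v ∷ vs = C ∪ ⁅ firstArgmax (λ u → dist d u C) v vs ⁆

-- Since dist d v ⊥ is constantly 0, the first point selected is the
-- first point of X in the input order.
farthestFirst : DistanceFunction (Fin n) → Subset n → ℕ → Subset n
farthestFirst d X zero    = ⊥
farthestFirst d X (suc ℓ) = addFarthest d X (farthestFirst d X ℓ)

------------------------------------------------------------------------
-- All-cut packings on X with root r

_∈𝒜⟨_,_⟩ : Subset n → Subset n → Fin n → Set
S ∈𝒜⟨ X , r ⟩ = Nonempty S × S ⊆ X - r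

_∈𝒜?⟨_,_⟩ : (S X : Subset n) (r : Fin n) → Dec (S ∈𝒜⟨ X , r ⟩)
S ∈𝒜?⟨ X , r ⟩ = nonempty? S ×-dec (S ⊆? X - r)

𝒜 : Subset n → Fin n → List (Subset n)
𝒜 X r = filter (_∈𝒜?⟨ X , r ⟩) (allSubsets _)

-- For e ∈ E X this says e ∈ δ_X(S).
Crosses : Subset n → Edge n → Set
Crosses S e = ∣ ends e ∩ S ∣ ≡ 1

crosses? : (S : Subset n) (e : Edge n) → Dec (Crosses S e)
crosses? S e = ∣ ends e ∩ S ∣ ℕ.≟ 1

-- A vector indexed by 𝒜 X r is given as a function on all subsets, of
-- which only the values on 𝒜 X r are ever used.
Weights : ℕ → Set
Weights n = Subset n → ℚ

record IsPacking (d : DistanceFunction (Fin n)) (X : Subset n) (r : Fin n)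
                 (y : Weights n) : Set where
  field
    nonNegative : ∀ S → S ∈𝒜⟨ X , r ⟩ → 0ℚ ≤ y S
    feasible    : ∀ e → e ∈ₗ E X →
                  sum y (filter (λ S → crosses? S e) (𝒜 X r)) ≤ uncurry d e

record IsOptimalPacking (d : DistanceFunction (Fin n)) (X : Subset n)
                        (r : Fin n) (y : Weights n) : Set where
  field
    isPacking : IsPacking d X r y
    maximal   : ∀ z → IsPacking d X r z → sum z (𝒜 X r) ≤ sum y (𝒜 X r)

InSupport : Subset n → Fin n → Weights n → Subset n → Set
InSupport X r y S = S ∈𝒜⟨ X , r ⟩ × 0ℚ <ℚ y S

inSupport? : (X : Subset n) (r : Fin n) (y : Weights n) (S : Subset n) →
             Dec (InSupport X r y S)
inSupport? X r y S = (S ∈𝒜?⟨ X , r ⟩) ×-dec (0ℚ <ℚ? y S)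

IsLaminar : Subset n → Fin n → Weights n → Set
IsLaminar X r y = ∀ S S′ → InSupport X r y S → InSupport X r y S′ →
                  Empty (S ∩ S′) ⊎ S ⊆ S′ ⊎ S′ ⊆ S

------------------------------------------------------------------------
-- Rooted edge-weighted trees with labelled leaves

-- Each child comes with the weight of the edge joining it to its parent.
data Tree (n : ℕ) : Set where
  leaf : Fin n → Tree n
  node : List (ℚ × Tree n) → Tree n

mutual

  leaves : Tree n → List (Fin n)
  leaves (leaf v)  = v ∷ []
  leaves (node cs) = leaves* cs

  leaves* : List (ℚ × Tree n) → List (Fin n)
  leaves* []             = []
  leaves* ((_ , t) ∷ cs) = leaves t ++ leaves* cs

-- All edges of a tree, each listed as its weight and the subtree below it.
mutual

  edges : Tree n → List (ℚ × Tree n)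
  edges (leaf _)  = []
  edges (node cs) = edges* cs

  edges* : List (ℚ × Tree n) → List (ℚ × Tree n)
  edges* []             = []
  edges* ((w , t) ∷ cs) = (w , t) ∷ edges t ++ edges* cs

J : Tree n → Subset n → List (ℚ × Tree n)
J t T = filter (λ (_ , s) → ¬? (2 ∣? length (filter (_∈? T) (leaves s))))
               (edges t)

weight : List (ℚ × Tree n) → ℚ
weight = sum proj₁

data Binary {n} : Tree n → Set where
  leaf : ∀ v → Binary (leaf v)
  node : ∀ {u w s t} → Binary s → Binary t →
         Binary (node ((u , s) ∷ (w , t) ∷ []))

-- One refinement step: at a node with more than two children, at least
-- two but not all of them are moved below a new child attached by a
-- zero-weight edge.
data _⟶_ {n} : Tree n → Tree n → Set where
  group : ∀ {cs as bs} → cs ↭ as ++ bs →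
          2 ℕ.≤ length as → 1 ℕ.≤ length bs →
          node cs ⟶ node ((0ℚ , node as) ∷ bs)
  below : ∀ {ls rs w t t′} → t ⟶ t′ →
          node (ls ++ (w , t) ∷ rs) ⟶ node (ls ++ (w , t′) ∷ rs)

------------------------------------------------------------------------
-- The tree of a laminar packing

Family : Subset n → Fin n → Weights n → Subset n → Set
Family X r y S = InSupport X r y S ⊎ S ≡ X ⊎ ∃ λ v → v ∈ X × S ≡ ⁅ v ⁆

edgeWeight : Subset n → Fin n → Weights n → Subset n → ℚ
edgeWeight X r y S = if does (inSupport? X r y S) then y S else 0ℚ

IsParent : Subset n → Fin n → Weights n → Subset n → Subset n → Set
IsParent X r y R S = Family X r y S × R ⊂ S ×
                     (∀ S′ → Family X r y S′ → R ⊂ S′ → S ⊆ S′)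

-- InclusionTree X r y S t: t is the subtree at S of the inclusion tree
-- of the family (the order in which children are listed is arbitrary).
data InclusionTree (X : Subset n) (r : Fin n) (y : Weights n) :
                   Subset n → Tree n → Set where
  leaf : ∀ v → InclusionTree X r y ⁅ v ⁆ (leaf v)
  node : ∀ {S cs} (Rs : List (Subset n)) →
         (∀ v → S ≢ ⁅ v ⁆) →
         Unique Rs →
         (∀ R → (R ∈ₗ Rs) ⇔ (Family X r y R × IsParent X r y R S)) →
         Pointwise (λ R (w , t) → w ≡ edgeWeight X r y R ×
                                  InclusionTree X r y R t) Rs cs →
         InclusionTree X r y S (node cs)

IsLaminarTree : Subset n → Fin n → Weights n → Tree n → Set
IsLaminarTree X r y t =
  Binary t × ∃ λ t₀ → InclusionTree X r y X t₀ × Star _⟶_ t₀ t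

------------------------------------------------------------------------
-- The centered all-cut algorithm

-- Tₘ is a possible output on input (Fin n , d), k, m.  Left open are the
-- choice of root, optimal laminar packing, binary refinement and maximiser.
record IsCenteredAllCutOutput (d : DistanceFunction (Fin n)) (k m : ℕ)
                              (Tₘ : Subset n) : Set where
  C : Subset n
  C = farthestFirst d ⊤ m

  field
    root          : Fin n
    root∈C        : root ∈ C
    y             : Weights n
    y-optimal     : IsOptimalPacking d C root y
    y-laminar     : IsLaminar C root y
    tree          : Tree n
    isLaminarTree : IsLaminarTree C root y tree
    Tₘ⊆C          : Tₘ ⊆ C
    ∣Tₘ∣≡k        : ∣ Tₘ ∣ ≡ k
    maximal       : ∀ T → T ⊆ C → ∣ T ∣ ≡ k →
                    weight (J tree T) ≤ weight (J tree Tₘ)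

{-# OPTIONS --safe #-}

-- Let Y be the value of the optimal packing, ρ the covering radius of the centres C, and T optimal
-- for exact-k remote matching.
--
-- Lower bound.  A perfect matching of T′ crosses every cut that is odd for T′, so w(J(T′)) ≤ μ(T′).
-- The edges of a binary tree can be labelled by nonzero elements of 𝔽₂², each one the sum of the
-- labels of the leaves below it, with every label on a third of the leaves.  Omitting the leaves
-- with a given label leaves k of the m = 3k/2 centres, and every edge is odd for two of the three
-- resulting sets.  Hence the output has w(J(Tₘ)) ≥ 2Y/3.
--
-- Upper bound.  After moving each point to its nearest centre, at a cost of kρ in total, the cost
-- of a minimum T-join is the value of a cut packing (Seymour), hence at most Y.  Moats of width ρ/2
-- around the centres give mρ/2 ≤ Y.  So OPT ≤ Y + kρ ≤ 7Y/3.
--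
-- Seymour's theorem is proved by Sebő's induction: if u minimises the cost of a minimum
-- (T + x₀ + u)-join, contracting the unit ball around u lowers the cost of a minimum T-join by at
-- most one.

module Submission where

open import Defs
open import Algebra.Bundles using (module CommutativeMonoid)
open import Data.Bool.Base using (Bool; true; false; not; _∧_; _xor_; if_then_else_)
import Data.Bool.Properties as Bool
open import Data.Bool.Properties using
  (xor-assoc; xor-comm; xor-same; xor-identityʳ; ∧-identityʳ; ∧-zeroʳ; not-involutive)
open import Data.Bool.Solver using (module xor-∧-Solver)
open import Data.Empty using (⊥-elim)
open import Data.Fin.Base using (Fin; zero; suc; _<_)
open import Data.Fin.Patterns using (0F; 1F; 2F)
import Data.Fin.Properties as Fin
open import Data.Fin.Properties using (_≟_; _<?_; <-cmp; <⇒≢; any?)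
open import Data.Fin.Subset using
  (Subset; inside; outside; ⊤; ⁅_⁆; _∈_; _∉_; _⊆_; _⊂_; _∩_; _∪_; _─_; _-_; ∣_∣; Nonempty; Empty)
open import Data.Fin.Subset.Properties using
  ( _∈?_; _⊆?_; _⊂?_; drop-there; ∈⊤; ∉⊥; ∣⊤∣≡n; ∣⊥∣≡0; x∈⁅x⁆; x∈⁅y⁆⇒x≡y; ∣⁅x⁆∣≡1
  ; ⊆-antisym; ⊂-irref; ⊂-⊆-trans; ⊆-⊂-trans; p⊆q⇒∣p∣≤∣q∣; p⊂q⇒∣p∣<∣q∣
  ; p⊆p∪q; x∈p∪q⁻; x∈p∪q⁺; x∈p∩q⁻; x∈p∩q⁺; p─q⊆p; x∈p∧x∉q⇒x∈p─q; x∈p∧x≢y⇒x∈p-y)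
import Data.Integer.Base as ℤ
import Data.Integer.Properties as ℤ
open import Data.List.Base using (List; []; _∷_; _++_; map; length; filter; allFin; cartesianProduct)
import Data.List.Extrema
open import Data.List.Membership.Propositional using () renaming (_∈_ to _∈ₗ_; _∉_ to _∉ₗ_)
open import Data.List.Membership.Propositional.Properties using
  ( ∈-∃++; ∈-filter⁺; ∈-filter⁻; ∈-allFin; ∈-cartesianProduct⁺; ∈-cartesianProduct⁻
  ; ∈-++⁺ˡ; ∈-++⁺ʳ; ∈-++⁻; ∈-map⁺; ∈-map⁻)
open import Data.List.Membership.Propositional.Properties.WithK using (unique∧set⇒bag)
import Data.List.Membership.DecPropositional as DecMembership
open import Data.List.Properties using (length-map; filter-none; ++-assoc)
open import Data.List.Relation.Binary.BagAndSetEquality using (∼bag⇒↭)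
open import Data.List.Relation.Binary.Permutation.Propositional using
  (_↭_; refl; prep; swap; trans; ↭-sym; ↭-refl; ↭-trans; ↭-reflexive; ↭⇒↭ₛ)
open import Data.List.Relation.Binary.Permutation.Propositional.Properties using
  (shift; shifts; ++-comm; ++⁺ˡ; ++⁺ʳ; ↭-length; filter-↭; ∈-resp-↭)
open import Data.List.Relation.Binary.Permutation.Setoid.Properties using (Unique-resp-↭)
open import Data.List.Relation.Binary.Pointwise.Base using (Pointwise; []; _∷_)
open import Data.List.Relation.Unary.All using (All; []; _∷_)
import Data.List.Relation.Unary.All as All
import Data.List.Relation.Unary.All.Properties as All
open import Data.List.Relation.Unary.AllPairs using ([]; _∷_)
open import Data.List.Relation.Unary.Any using (here; there)
open import Data.List.Relation.Unary.Unique.Propositional using (Unique)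
import Data.List.Relation.Unary.Unique.Propositional.Properties as Unique
open import Data.Nat.Base using (ℕ; zero; suc)
import Data.Nat.Base as ℕ
import Data.Nat.Coprimality as Coprime
open import Data.Nat.Divisibility using (_∣_; _∣?_; divides)
open import Data.Nat.DivMod using (_%_; [m+kn]%n≡m%n; m*n%n≡0)
import Data.Nat.DivMod as ℕ
import Data.Nat.Properties as ℕ
open import Data.Nat.Tactic.RingSolver using (solve-∀)
open import Data.Product.Base using (_×_; _,_; proj₁; proj₂; ∃; ∃₂; uncurry)
open import Data.Product.Properties using (≡-dec)
open import Data.Rational.Base using (ℚ; 0ℚ; 1ℚ; ½; _/_; _+_; _*_; _≤_)
import Data.Rational.Base as ℚ
import Data.Rational.Properties as ℚ
open import Data.Rational.Solver using (module +-*-Solver)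
import Data.Rational.Unnormalised.Base as ℚᵘ
import Data.Rational.Unnormalised.Properties as ℚᵘ
open import Data.Sum.Base using (_⊎_; inj₁; inj₂; [_,_]′)
open import Data.Vec.Base using ([]; _∷_; lookup; tabulate; here; there)
import Data.Vec.Properties as Vec
open import Data.Vec.Properties using
  (tabulate-cong; lookup∘tabulate; tabulate∘lookup; []=⇒lookup; lookup⇒[]=)
open import Function.Base using (_∘_; flip; id)
open import Function.Bundles using (Equivalence; mk⇔)
open import Function.Metric.Rational.Core using (DistanceFunction)
open import Function.Metric.Rational.Structures using (IsMetric)
open import Relation.Binary.Bundles using (module DecTotalOrder)
open import Relation.Binary.Construct.Closure.ReflexiveTransitive using (Star; ε; _◅_)
open import Relation.Binary.Definitions using (tri<; tri≈; tri>)
open import Relation.Binary.PropositionalEquality using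
  (_≡_; _≢_; refl; sym; cong; cong₂; subst; _≗_; setoid; module ≡-Reasoning)
  renaming (trans to ≡-trans)
open import Relation.Nullary.Decidable using
  (Dec; yes; no; does; dec-true; dec-false; ¬?; _×-dec_; _⊎-dec_; True; toWitness)
open import Relation.Nullary.Negation using (¬_)

open import Algebra.Properties.CommutativeMonoid.Mult ℚ.+-0-commutativeMonoid
  using (×-homo-+; ×-distrib-+; ×-assocˡ) renaming (_×_ to _⋆_)
open import Algebra.Properties.CommutativeSemigroup
  (CommutativeMonoid.commutativeSemigroup ℚ.+-0-commutativeMonoid) using (interchange; x∙yz≈y∙xz)
open Data.List.Extrema ℕ.≤-totalOrder using
  (argmin; argmin-sel; f[argmin]≤f[xs]; argmax; argmax-sel; f[xs]≤f[argmax])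
module ℚ-Extrema = Data.List.Extrema (DecTotalOrder.totalOrder ℚ.≤-decTotalOrder)
open xor-∧-Solver using (solve; _:+_; _:*_; _:=_; con)

-- Joins live in a complete graph with integral lengths, so the bipartiteness behind Seymour's
-- theorem has to be expressed for metrics. `EvenMetric` does this, and halving a common unit makes
-- every distance even. The obstacle in the induction is that a join of the contracted metric may
-- run through the ball around u many times, saving up to two units at each passage, whereas only
-- one unit may be lost in all. The choice of u repairs this: when b and c are at positive distance
-- from u, completing a (T + b + c)-join by the edges from u to b and c never gives a shortest
-- T-join, and parity turns this strict inequality into a difference of two, the price of one
-- passage. Replacing the points of T by their centres would produce a multiset. Instead the metric
-- of the centres is pulled back to all points, so that distinct points may be at distance 0. In the
-- colouring, equal counts of the three labels have sum zero in 𝔽₂², while every edge needs a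
-- nonzero label. Hence proper subtrees are only nearly balanced, and exact balance is reached at
-- the root.

private
  variable
    A B : Set
    n : ℕ

-- Parities of lists

xor-interchange : ∀ a b c d → (a xor b) xor (c xor d) ≡ (a xor c) xor (b xor d)
xor-interchange = solve 4 (λ a b c d → (a :+ b) :+ (c :+ d) := (a :+ c) :+ (b :+ d)) refl

xor-cancelʳ : ∀ a b c → (a xor c) xor (b xor c) ≡ a xor b
xor-cancelʳ = solve 3 (λ a b c → (a :+ c) :+ (b :+ c) := a :+ b) refl

odd : ℕ → Bool
odd zero    = false
odd (suc n) = not (odd n)

odd-+ : ∀ m n → odd (m ℕ.+ n) ≡ odd m xor odd n
odd-+ zero    n = refl
odd-+ (suc m) n with odd m | odd-+ m n
... | true  | eq = ≡-trans (cong not eq) (not-involutive _)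
... | false | eq = cong not eq

parity : (A → Bool) → List A → Bool
parity f []       = false
parity f (x ∷ xs) = f x xor parity f xs

parity-cong-∈ : ∀ {f g : A → Bool} xs → (∀ {x} → x ∈ₗ xs → f x ≡ g x) → parity f xs ≡ parity g xs
parity-cong-∈ []       eq = refl
parity-cong-∈ (x ∷ xs) eq = cong₂ _xor_ (eq (here refl)) (parity-cong-∈ xs (eq ∘ there))

parity-cong : ∀ {f g : A → Bool} → f ≗ g → parity f ≗ parity g
parity-cong eq xs = parity-cong-∈ xs (λ {x} _ → eq x)

parity-++ : ∀ (f : A → Bool) xs ys → parity f (xs ++ ys) ≡ parity f xs xor parity f ys
parity-++ f []       ys = refl
parity-++ f (x ∷ xs) ys =
  ≡-trans (cong (f x xor_) (parity-++ f xs ys)) (sym (xor-assoc (f x) _ _))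

parity-map : ∀ (f : B → Bool) (g : A → B) xs → parity f (map g xs) ≡ parity (f ∘ g) xs
parity-map f g []       = refl
parity-map f g (x ∷ xs) = cong (f (g x) xor_) (parity-map f g xs)

parity-↭ : ∀ (f : A → Bool) {xs ys} → xs ↭ ys → parity f xs ≡ parity f ys
parity-↭ f refl          = refl
parity-↭ f (prep x p)    = cong (f x xor_) (parity-↭ f p)
parity-↭ f (swap {xs} x y p) = ≡-trans
  (solve 3 (λ a b c → a :+ (b :+ c) := b :+ (a :+ c)) refl (f x) (f y) (parity f xs))
  (cong (λ z → f y xor (f x xor z)) (parity-↭ f p))
parity-↭ f (trans p q)   = ≡-trans (parity-↭ f p) (parity-↭ f q)

parity-false : ∀ (f : A → Bool) xs → (∀ {x} → x ∈ₗ xs → f x ≡ false) → parity f xs ≡ false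
parity-false f []       eq = refl
parity-false f (x ∷ xs) eq = cong₂ _xor_ (eq (here refl)) (parity-false f xs (eq ∘ there))

parity-xor : ∀ (f g : A → Bool) xs → parity (λ x → f x xor g x) xs ≡ parity f xs xor parity g xs
parity-xor f g []       = refl
parity-xor f g (x ∷ xs) =
  ≡-trans (cong ((f x xor g x) xor_) (parity-xor f g xs)) (xor-interchange (f x) (g x) _ _)

parity-∧ : ∀ b (f : A → Bool) xs → b ∧ parity f xs ≡ parity (λ x → b ∧ f x) xs
parity-∧ true  f xs = refl
parity-∧ false f xs = sym (parity-false _ xs (λ _ → refl))

parity-swap : ∀ (f : A → B → Bool) xs ys →
              parity (λ x → parity (f x) ys) xs ≡ parity (λ y → parity (flip f y) xs) ys
parity-swap f []       ys = sym (parity-false _ ys (λ _ → refl))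
parity-swap f (x ∷ xs) ys = ≡-trans (cong (parity (f x) ys xor_) (parity-swap f xs ys))
                                    (sym (parity-xor (f x) _ ys))

parity-const-true : ∀ (xs : List A) → parity (λ _ → true) xs ≡ odd (length xs)
parity-const-true []       = refl
parity-const-true (x ∷ xs) = cong not (parity-const-true xs)

δ : Fin n → Fin n → Bool
δ a v = does (v ≟ a)

δ-refl : ∀ (a : Fin n) → δ a a ≡ true
δ-refl a = dec-true (a ≟ a) refl

δ-≢ : ∀ {a v : Fin n} → v ≢ a → δ a v ≡ false
δ-≢ {a = a} {v} = dec-false (v ≟ a)

parity-δ-∉ : ∀ (p : Fin n → Bool) {a} xs → a ∉ₗ xs → parity (λ v → p v ∧ δ a v) xs ≡ false
parity-δ-∉ p xs a∉ = parity-false _ xs λ {v} v∈ →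
  ≡-trans (cong (p v ∧_) (δ-≢ {v = v} λ { refl → a∉ v∈ })) (∧-zeroʳ (p v))

parity-δ-∈ : ∀ (p : Fin n → Bool) {a xs} → Unique xs → a ∈ₗ xs →
             parity (λ v → p v ∧ δ a v) xs ≡ p a
parity-δ-∈ p {a} {xs = _ ∷ xs} (x≢ ∷ u) (here refl) = ≡-trans
  (cong₂ _xor_ (≡-trans (cong (p a ∧_) (δ-refl a)) (∧-identityʳ (p a)))
               (parity-δ-∉ p xs (All.All¬⇒¬Any x≢)))
  (xor-identityʳ (p a))
parity-δ-∈ p {a} {xs = x ∷ xs} (x≢ ∷ u) (there a∈) = cong₂ _xor_
  (≡-trans (cong (p x ∧_) (δ-≢ {v = x} λ { refl → All.All¬⇒¬Any x≢ a∈ })) (∧-zeroʳ (p x)))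
  (parity-δ-∈ p u a∈)

-- Boundaries and exchange

∂ₑ : Edge n → Fin n → Bool
∂ₑ (a , b) v = δ a v xor δ b v

-- Chains over 𝔽₂: loops and repeated edges cancel in the boundary but stay in the list and in its
-- length. A T-join is a list whose boundary is the indicator of T.
∂ : List (Edge n) → Fin n → Bool
∂ L v = parity (λ e → ∂ₑ e v) L

∂ᵥ : List (Fin n) → Fin n → Bool
∂ᵥ A v = parity (λ a → δ a v) A

abstract

  -- Double counting: once the two sums are exchanged, each edge contributes `p` at both of its
  -- ends. With `p` the side of a metric, this shows that the boundary determines the parity of a
  -- length; with `p` the indicator of a set, it counts crossing edges modulo 2.
  parity-∂ : ∀ (p : Fin n → Bool) {xs} → Unique xs → ∀ L →
             (∀ {e} → e ∈ₗ L → proj₁ e ∈ₗ xs × proj₂ e ∈ₗ xs) →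
             parity (λ v → p v ∧ ∂ L v) xs ≡ parity (λ (a , b) → p a xor p b) L
  parity-∂ p {xs} u L L⊆ = begin
    parity (λ v → p v ∧ ∂ L v) xs
      ≡⟨ parity-cong (λ v → parity-∧ (p v) _ L) xs ⟩
    parity (λ v → parity (λ e → p v ∧ ∂ₑ e v) L) xs
      ≡⟨ parity-swap _ xs L ⟩
    parity (λ e → parity (λ v → p v ∧ ∂ₑ e v) xs) L
      ≡⟨ parity-cong-∈ L (λ {e} e∈ → jump e (L⊆ e∈)) ⟩
    parity (λ (a , b) → p a xor p b) L ∎
    where
    open ≡-Reasoning
    jump : ∀ e → proj₁ e ∈ₗ xs × proj₂ e ∈ₗ xs →
           parity (λ v → p v ∧ ∂ₑ e v) xs ≡ p (proj₁ e) xor p (proj₂ e)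
    jump (a , b) (a∈ , b∈) = begin
      parity (λ v → p v ∧ (δ a v xor δ b v)) xs
        ≡⟨ parity-cong (λ v → solve 3 (λ x y z → x :* (y :+ z) := (x :* y) :+ (x :* z)) refl
                                (p v) (δ a v) (δ b v)) xs ⟩
      parity (λ v → (p v ∧ δ a v) xor (p v ∧ δ b v)) xs
        ≡⟨ parity-xor _ _ xs ⟩
      parity (λ v → p v ∧ δ a v) xs xor parity (λ v → p v ∧ δ b v) xs
        ≡⟨ cong₂ _xor_ (parity-δ-∈ p u a∈) (parity-δ-∈ p u b∈) ⟩
      p a xor p b ∎

true≢false : true ≢ false
true≢false ()

swap-middle : ∀ p q r → p ℕ.+ (q ℕ.+ r) ≡ q ℕ.+ (p ℕ.+ r)
swap-middle = solve-∀

total : (A → ℕ) → List A → ℕ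
total f []       = 0
total f (x ∷ xs) = f x ℕ.+ total f xs

total-++ : ∀ (f : A → ℕ) xs ys → total f (xs ++ ys) ≡ total f xs ℕ.+ total f ys
total-++ f []       ys = refl
total-++ f (x ∷ xs) ys = ≡-trans (cong (f x ℕ.+_) (total-++ f xs ys)) (sym (ℕ.+-assoc (f x) _ _))

total-↭ : ∀ (f : A → ℕ) {xs ys} → xs ↭ ys → total f xs ≡ total f ys
total-↭ f refl              = refl
total-↭ f (prep x p)        = cong (f x ℕ.+_) (total-↭ f p)
total-↭ f (swap {xs} x y p) = ≡-trans
  (swap-middle (f x) (f y) (total f xs))
  (cong (λ z → f y ℕ.+ (f x ℕ.+ z)) (total-↭ f p))
total-↭ f (trans p q)       = ≡-trans (total-↭ f p) (total-↭ f q)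

∈⇒↭ : ∀ {x : A} {xs} → x ∈ₗ xs → ∃ λ ys → xs ↭ x ∷ ys
∈⇒↭ {x = x} x∈ with ys , zs , refl ← ∈-∃++ x∈ = ys ++ zs , shift x ys zs

via : ∀ x y z w → (y xor z) xor ((x xor y) xor w) ≡ (x xor z) xor w
via = solve 4 (λ x y z w → (y :+ z) :+ ((x :+ y) :+ w) := (x :+ z) :+ w) refl

via′ : ∀ x y z w → (x xor y) xor ((y xor z) xor w) ≡ (x xor z) xor w
via′ = solve 4 (λ x y z w → (x :+ y) :+ ((y :+ z) :+ w) := (x :+ z) :+ w) refl

record Incident (M : List (Edge n)) (i : Fin n) : Set where
  constructor incident
  field
    e      : Edge n
    p      : Fin n
    M′     : List (Edge n)
    M↭     : M ↭ e ∷ M′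
    p≢i    : p ≢ i
    joins  : ∂ₑ e ≗ ∂ₑ (i , p)

skip : ∀ {M} {f : Edge n} {i} → Incident M i → Incident (f ∷ M) i
skip (incident e p M′ M↭ p≢i joins) =
  incident e p (_ ∷ M′) (↭-trans (prep _ M↭) (swap _ _ ↭-refl)) p≢i joins

-- A loop has no boundary, so an odd value of `∂ M` at i forces an edge to some other vertex. The
-- field `joins` hides the orientation in which that edge is stored.
incidentEdge : ∀ (M : List (Edge n)) i → ∂ M i ≡ true → Incident M i
incidentEdge ((a , b) ∷ M) i odd-i with i ≟ a | i ≟ b
... | yes refl | no i≢b   = incident _ b M ↭-refl (i≢b ∘ sym) (λ _ → refl)
... | no i≢a   | yes refl = incident _ a M ↭-refl (i≢a ∘ sym) (λ v → xor-comm (δ a v) (δ i v))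
... | yes _    | yes _    = skip (incidentEdge M i odd-i)
... | no _     | no _     = skip (incidentEdge M i odd-i)

-- The edges of a trail from i to j in the disjoint union of the two lists change sides. Both
-- boundaries are toggled at i and j, while `moved` keeps the multiset of edges and therefore the
-- sum of the two lengths.
record Exchange (M₁ M₂ : List (Edge n)) (i j : Fin n) : Set where
  constructor exchange
  field
    N₁ N₂ : List (Edge n)
    ∂N₁   : ∀ v → ∂ N₁ v ≡ ∂ₑ (i , j) v xor ∂ M₁ v
    ∂N₂   : ∀ v → ∂ N₂ v ≡ ∂ₑ (i , j) v xor ∂ M₂ v
    moved : N₁ ++ N₂ ↭ M₁ ++ M₂

exchange-sym : ∀ {M₁ M₂ : List (Edge n)} {i j} → Exchange M₁ M₂ i j → Exchange M₂ M₁ i j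
exchange-sym {M₁ = M₁} {M₂} (exchange N₁ N₂ ∂N₁ ∂N₂ moved) =
  exchange N₂ N₁ ∂N₂ ∂N₁ (↭-trans (++-comm N₂ N₁) (↭-trans moved (++-comm M₁ M₂)))

Exchangeable : (M₁ M₂ : List (Edge n)) (i : Fin n) → Set
Exchangeable M₁ M₂ i = ∃ λ j → j ≢ i × ∂ M₁ j xor ∂ M₂ j ≡ true × Exchange M₁ M₂ i j

-- A vertex of odd degree in the union of both lists shares its component with another one, and a
-- trail between them can be switched. The number k of edges is the measure for the recursion, which
-- removes the edges of the trail.
exchangeable : ∀ k (M₁ M₂ : List (Edge n)) i → length (M₁ ++ M₂) ≡ k →
               ∂ M₁ i xor ∂ M₂ i ≡ true → Exchangeable M₁ M₂ i

-- Walk from i along the edge ip of M₁, which passes to the other side.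
exchangeAlong : ∀ k (M₁ M₂ : List (Edge n)) i → length (M₁ ++ M₂) ≡ k →
                ∂ M₁ i xor ∂ M₂ i ≡ true → ∂ M₁ i ≡ true → Exchangeable M₁ M₂ i
exchangeAlong k M₁ M₂ i len odd-i in-M₁ with incidentEdge M₁ i in-M₁
... | incident e p M₁′ M₁↭ p≢i joins = end-or-continue k len (∂ M₁ p xor ∂ M₂ p) refl
  where
  step : ∀ v → ∂ M₁ v ≡ ∂ₑ (i , p) v xor ∂ M₁′ v
  step v = ≡-trans (parity-↭ _ M₁↭) (cong (_xor ∂ M₁′ v) (joins v))

  step⁻ : ∀ v → ∂ M₁′ v ≡ ∂ₑ (i , p) v xor ∂ M₁ v
  step⁻ v = ≡-trans
    (solve 3 (λ x y z → z := (x :+ y) :+ ((x :+ y) :+ z)) refl (δ i v) (δ p v) (∂ M₁′ v))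
    (cong (∂ₑ (i , p) v xor_) (sym (step v)))

  end-or-continue : ∀ k → length (M₁ ++ M₂) ≡ k → ∀ b → ∂ M₁ p xor ∂ M₂ p ≡ b → Exchangeable M₁ M₂ i
  end-or-continue k len true odd-p = p , p≢i , odd-p , exchange M₁′ (e ∷ M₂) step⁻
    (λ v → cong (_xor ∂ M₂ v) (joins v))
    (↭-trans (shift e M₁′ M₂) (++⁺ʳ M₂ (↭-sym M₁↭)))
  end-or-continue zero len false even-p with () ← ≡-trans (sym (↭-length (++⁺ʳ M₂ M₁↭))) len
  -- Without `e` the parities at i and p are both flipped: p becomes odd and can start the rest of
  -- the trail, and i becomes even, so the rest cannot end at i.
  end-or-continue (suc k) len false even-p =
    continue (exchangeable k M₁′ M₂ p
      (ℕ.suc-injective (≡-trans (sym (↭-length (++⁺ʳ M₂ M₁↭))) len)) odd-p′)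
    where
    flip-end : ∀ a → δ i a xor δ p a ≡ true → ∂ M₁′ a xor ∂ M₂ a ≡ not (∂ M₁ a xor ∂ M₂ a)
    flip-end a end = ≡-trans
      (cong (_xor ∂ M₂ a) (≡-trans (step⁻ a) (cong (_xor ∂ M₁ a) end)))
      (sym (Bool.not-distribˡ-xor (∂ M₁ a) (∂ M₂ a)))

    odd-p′ : ∂ M₁′ p xor ∂ M₂ p ≡ true
    odd-p′ = ≡-trans (flip-end p (cong₂ _xor_ (δ-≢ p≢i) (δ-refl p))) (cong not even-p)

    even-i : ∂ M₁′ i xor ∂ M₂ i ≡ false
    even-i = ≡-trans (flip-end i (cong₂ _xor_ (δ-refl i) (δ-≢ (p≢i ∘ sym)))) (cong not odd-i)

    continue : Exchangeable M₁′ M₂ p → Exchangeable M₁ M₂ i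
    continue (j , j≢p , odd-j , exchange N₁ N₂ ∂N₁ ∂N₂ moved) =
      j , j≢i , odd-j′ , exchange N₁ (e ∷ N₂)
        (λ v → ≡-trans (∂N₁ v) (≡-trans (cong (∂ₑ (p , j) v xor_) (step⁻ v))
                                        (via (δ i v) (δ p v) (δ j v) (∂ M₁ v))))
        (λ v → ≡-trans (cong₂ _xor_ (joins v) (∂N₂ v))
                       (via′ (δ i v) (δ p v) (δ j v) (∂ M₂ v)))
        (↭-trans (shift e N₁ N₂) (↭-trans (prep e moved) (++⁺ʳ M₂ (↭-sym M₁↭))))
      where
      j≢i : j ≢ i
      j≢i refl = true≢false (≡-trans (sym odd-j) even-i)

      odd-j′ : ∂ M₁ j xor ∂ M₂ j ≡ true
      odd-j′ = ≡-trans (cong (_xor ∂ M₂ j) (≡-trans (step j)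
                 (cong (_xor ∂ M₁′ j) (cong₂ _xor_ (δ-≢ j≢i) (δ-≢ j≢p))))) odd-j

exchangeable k M₁ M₂ i len odd-i with ∂ M₁ i in in-M₁
... | true  = exchangeAlong k M₁ M₂ i len (≡-trans (cong (_xor ∂ M₂ i) in-M₁) odd-i) in-M₁
... | false with exchangeAlong k M₂ M₁ i (≡-trans (↭-length (++-comm M₂ M₁)) len)
                   (cong₂ _xor_ odd-i in-M₁) odd-i
...   | j , j≢i , odd-j , ex =
  j , j≢i , ≡-trans (xor-comm (∂ M₁ j) (∂ M₂ j)) odd-j , exchange-sym ex

abstract

  -- If i itself occurs in A, the exchange is trivial.
  exchangeWith : ∀ (M₁ M₂ : List (Edge n)) i A →
                 (∀ v → ∂ M₁ v xor ∂ M₂ v ≡ ∂ᵥ (i ∷ A) v) →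
                 ∃ λ j → j ∈ₗ A × Exchange M₁ M₂ i j
  exchangeWith M₁ M₂ i A eq with DecMembership._∈?_ _≟_ i A
  ... | yes i∈A = i , i∈A , exchange M₁ M₂ (trivial M₁) (trivial M₂) ↭-refl
    where
    trivial : ∀ M v → ∂ M v ≡ ∂ₑ (i , i) v xor ∂ M v
    trivial M v = cong (_xor ∂ M v) (sym (xor-same (δ i v)))
  ... | no  i∉A with exchangeable _ M₁ M₂ i refl odd-i
    where
    odd-i : ∂ M₁ i xor ∂ M₂ i ≡ true
    odd-i rewrite eq i | δ-refl i =
      cong not (parity-false _ A λ {a} a∈ → δ-≢ {a = a} {i} λ { refl → i∉A a∈ })
  ...   | j , j≢i , odd-j , ex with DecMembership._∈?_ _≟_ j A
  ...     | yes j∈A = j , j∈A , ex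
  ...     | no  j∉A = ⊥-elim (true≢false (≡-trans (sym odd-j) (≡-trans (eq j) even-j)))
    where
    even-j : ∂ᵥ (i ∷ A) j ≡ false
    even-j rewrite δ-≢ {a = i} j≢i = parity-false _ A λ {a} a∈ → δ-≢ {a = a} {j} λ { refl → j∉A a∈ }

-- Lists and subsets

unique-↭ : ∀ {xs ys : List A} → Unique xs → Unique ys →
           (∀ {x} → x ∈ₗ xs → x ∈ₗ ys) → (∀ {x} → x ∈ₗ ys → x ∈ₗ xs) → xs ↭ ys
unique-↭ u v xs⊆ys ys⊆xs = ∼bag⇒↭ (unique∧set⇒bag u v (mk⇔ xs⊆ys ys⊆xs))

unique-length-≤ : ∀ {xs ys : List A} → Unique xs → (∀ {x} → x ∈ₗ xs → x ∈ₗ ys) →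
                  length xs ℕ.≤ length ys
unique-length-≤ {xs = []}     _        xs⊆ys = ℕ.z≤n
unique-length-≤ {xs = x ∷ xs} (x≢ ∷ u) xs⊆ys with ys′ , ys↭ ← ∈⇒↭ (xs⊆ys (here refl)) =
  subst (suc (length xs) ℕ.≤_) (sym (↭-length ys↭)) (ℕ.s≤s (unique-length-≤ u xs⊆ys′))
  where
  xs⊆ys′ : ∀ {z} → z ∈ₗ xs → z ∈ₗ ys′
  xs⊆ys′ z∈ with ∈-resp-↭ ys↭ (xs⊆ys (there z∈))
  ... | here refl = ⊥-elim (All.All¬⇒¬Any x≢ z∈)
  ... | there z∈′ = z∈′

∈-elements⁺ : ∀ {X : Subset n} {v} → v ∈ X → v ∈ₗ elements X
∈-elements⁺ {X = X} {v} = ∈-filter⁺ (_∈? X) (∈-allFin v)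

∈-elements⁻ : ∀ {X : Subset n} {v} → v ∈ₗ elements X → v ∈ X
∈-elements⁻ {X = X} v∈ = proj₂ (∈-filter⁻ (_∈? X) {xs = allFin _} v∈)

elements-unique : ∀ (X : Subset n) → Unique (elements X)
elements-unique X = Unique.filter⁺ (_∈? X) (Unique.allFin⁺ _)

-- Recursion on the vector makes the length of this enumeration visibly `∣ X ∣`; `length-unique`
-- transports this to all other duplicate-free enumerations, in particular to `elements`.
indices : Subset n → List (Fin n)
indices []            = []
indices (outside ∷ X) = map suc (indices X)
indices (inside  ∷ X) = zero ∷ map suc (indices X)

length-indices : ∀ (X : Subset n) → length (indices X) ≡ ∣ X ∣
length-indices []            = refl
length-indices (outside ∷ X) = ≡-trans (length-map suc (indices X)) (length-indices X)
length-indices (inside  ∷ X) = cong suc (≡-trans (length-map suc (indices X)) (length-indices X))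

∈-indices⁺ : ∀ {X : Subset n} {v} → v ∈ X → v ∈ₗ indices X
∈-indices⁺ {X = inside  ∷ X} {zero}  v∈ = here refl
∈-indices⁺ {X = inside  ∷ X} {suc v} v∈ = there (∈-map⁺ suc (∈-indices⁺ (drop-there v∈)))
∈-indices⁺ {X = outside ∷ X} {suc v} v∈ = ∈-map⁺ suc (∈-indices⁺ (drop-there v∈))

∈-indices⁻ : ∀ {X : Subset n} {v} → v ∈ₗ indices X → v ∈ X
∈-indices⁻ {X = outside ∷ X} v∈ with _ , i∈ , refl ← ∈-map⁻ suc v∈ = there (∈-indices⁻ i∈)
∈-indices⁻ {X = inside  ∷ X} (here refl) = here
∈-indices⁻ {X = inside  ∷ X} (there v∈) with _ , i∈ , refl ← ∈-map⁻ suc v∈ = there (∈-indices⁻ i∈)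

indices-unique : ∀ (X : Subset n) → Unique (indices X)
indices-unique []            = []
indices-unique (outside ∷ X) = Unique.map⁺ Fin.suc-injective (indices-unique X)
indices-unique (inside  ∷ X) =
  All.¬Any⇒All¬ _ (λ 0∈ → Fin.0≢1+n (proj₂ (proj₂ (∈-map⁻ suc 0∈)))) ∷
  Unique.map⁺ Fin.suc-injective (indices-unique X)

length-unique : ∀ {xs} {X : Subset n} → Unique xs →
                (∀ {v} → v ∈ₗ xs → v ∈ X) → (∀ {v} → v ∈ X → v ∈ₗ xs) → length xs ≡ ∣ X ∣
length-unique {X = X} u xs⊆X X⊆xs = ≡-trans
  (↭-length (unique-↭ u (indices-unique X) (∈-indices⁺ ∘ xs⊆X) (X⊆xs ∘ ∈-indices⁻)))
  (length-indices X)

length-elements : ∀ (X : Subset n) → length (elements X) ≡ ∣ X ∣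
length-elements X = length-unique (elements-unique X) ∈-elements⁻ ∈-elements⁺

∈⇒lookup : ∀ {X : Subset n} {v} → v ∈ X → lookup X v ≡ true
∈⇒lookup = []=⇒lookup

lookup⇒∈ : ∀ {X : Subset n} {v} → lookup X v ≡ true → v ∈ X
lookup⇒∈ {X = X} {v} = lookup⇒[]= v X

∉⇒lookup : ∀ {X : Subset n} {v} → v ∉ X → lookup X v ≡ false
∉⇒lookup {X = X} {v} v∉ with lookup X v in eq
... | true  = ⊥-elim (v∉ (lookup⇒∈ eq))
... | false = refl

∈-tabulate⁺ : ∀ {f : Fin n → Bool} {v} → f v ≡ true → v ∈ tabulate f
∈-tabulate⁺ {f = f} {v} fv = lookup⇒∈ (≡-trans (lookup∘tabulate f v) fv)

∈-tabulate⁻ : ∀ {f : Fin n → Bool} {v} → v ∈ tabulate f → f v ≡ true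
∈-tabulate⁻ {f = f} {v} v∈ = ≡-trans (sym (lookup∘tabulate f v)) (∈⇒lookup v∈)

filter-∈-sublists : ∀ {P : A → Set} (P? : ∀ x → Dec (P x)) xs → filter P? xs ∈ₗ sublists xs
filter-∈-sublists P? []       = here refl
filter-∈-sublists P? (x ∷ xs) with P? x
... | yes px =
  ∈-++⁺ʳ (sublists xs) (∈-map⁺ (x ∷_) (filter-∈-sublists P? xs))
... | no ¬px = ∈-++⁺ˡ (filter-∈-sublists P? xs)

sublists-⊆ : ∀ {xs ys : List A} → ys ∈ₗ sublists xs → ∀ {x} → x ∈ₗ ys → x ∈ₗ xs
sublists-⊆ {xs = []}     (here refl) ()
sublists-⊆ {xs = z ∷ xs} ys∈ x∈ with ∈-++⁻ (sublists xs) ys∈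
... | inj₁ ys∈′ = there (sublists-⊆ ys∈′ x∈)
... | inj₂ ys∈′ with zs , zs∈ , refl ← ∈-map⁻ (z ∷_) ys∈′ with x∈
...   | here refl = here refl
...   | there x∈′ = there (sublists-⊆ zs∈ x∈′)

-- Edges

∈-E⁺ : ∀ {X : Subset n} {a b} → a ∈ X → b ∈ X → a < b → (a , b) ∈ₗ E X
∈-E⁺ a∈ b∈ = ∈-filter⁺ (λ (u , v) → u <? v) (∈-cartesianProduct⁺ (∈-elements⁺ a∈) (∈-elements⁺ b∈))

∈-E⁻ : ∀ {X : Subset n} {e} → e ∈ₗ E X → proj₁ e ∈ X × proj₂ e ∈ X × proj₁ e < proj₂ e
∈-E⁻ {X = X} e∈
  with e∈′ , a<b ← ∈-filter⁻ (λ (u , v) → u <? v) {xs = cartesianProduct (elements X) (elements X)} e∈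
  with a∈ , b∈ ← ∈-cartesianProduct⁻ (elements X) (elements X) e∈′ =
  ∈-elements⁻ a∈ , ∈-elements⁻ b∈ , a<b

E-unique : ∀ (X : Subset n) → Unique (E X)
E-unique X = Unique.filter⁺ (λ (u , v) → u <? v)
  (Unique.cartesianProduct⁺ (elements-unique X) (elements-unique X))

∈-ends⁻ : ∀ {v : Fin n} (e : Edge n) → v ∈ ends e → v ≡ proj₁ e ⊎ v ≡ proj₂ e
∈-ends⁻ (a , b) v∈ with x∈p∪q⁻ ⁅ a ⁆ ⁅ b ⁆ v∈
... | inj₁ v∈a = inj₁ (x∈⁅y⁆⇒x≡y a v∈a)
... | inj₂ v∈b = inj₂ (x∈⁅y⁆⇒x≡y b v∈b)

fst∈ends : ∀ (e : Edge n) → proj₁ e ∈ ends e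
fst∈ends (a , b) = x∈p∪q⁺ (inj₁ (x∈⁅x⁆ a))

snd∈ends : ∀ (e : Edge n) → proj₂ e ∈ ends e
snd∈ends (a , b) = x∈p∪q⁺ (inj₂ (x∈⁅x⁆ b))

-- Reducing joins to perfect matchings

vertices : List (Edge n) → List (Fin n)
vertices []            = []
vertices ((a , b) ∷ M) = a ∷ b ∷ vertices M

length-vertices : ∀ (M : List (Edge n)) → length (vertices M) ≡ 2 ℕ.* length M
length-vertices []      = refl
length-vertices (e ∷ M) = ≡-trans (cong (λ k → suc (suc k)) (length-vertices M)) (sym (ℕ.*-suc 2 (length M)))

∈-vertices : ∀ {M : List (Edge n)} {e} → e ∈ₗ M → proj₁ e ∈ₗ vertices M × proj₂ e ∈ₗ vertices M
∈-vertices (here refl) = here refl , there (here refl)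
∈-vertices (there e∈)  with p , q ← ∈-vertices e∈ = there (there p) , there (there q)

∂-vertices : ∀ (M : List (Edge n)) v → ∂ M v ≡ ∂ᵥ (vertices M) v
∂-vertices []            v = refl
∂-vertices ((a , b) ∷ M) v =
  ≡-trans (xor-assoc (δ a v) _ _) (cong (λ z → δ a v xor (δ b v xor z)) (∂-vertices M v))

∂ᵥ-∉ : ∀ {xs} {v : Fin n} → v ∉ₗ xs → ∂ᵥ xs v ≡ false
∂ᵥ-∉ {xs = xs} {v} v∉ = parity-false _ xs λ {a} a∈ → δ-≢ {a = a} {v} λ { refl → v∉ a∈ }

∂ᵥ-∈ : ∀ {xs} {v : Fin n} → Unique xs → v ∈ₗ xs → ∂ᵥ xs v ≡ true
∂ᵥ-∈ {xs = x ∷ xs} {v} (x≢ ∷ u) (here refl) =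
  cong₂ _xor_ (δ-refl v) (∂ᵥ-∉ (All.All¬⇒¬Any x≢))
∂ᵥ-∈ {xs = x ∷ xs} {v} (x≢ ∷ u) (there v∈) =
  cong₂ _xor_ (δ-≢ {a = x} {v} λ { refl → All.All¬⇒¬Any x≢ v∈ }) (∂ᵥ-∈ u v∈)

∂ᵥ-true : ∀ {xs} {v : Fin n} → ∂ᵥ xs v ≡ true → v ∈ₗ xs
∂ᵥ-true {xs = xs} {v} odd-v with DecMembership._∈?_ _≟_ v xs
... | yes v∈ = v∈
... | no  v∉ = ⊥-elim (true≢false (≡-trans (sym odd-v) (∂ᵥ-∉ v∉)))

record IsMatching (M : List (Edge n)) : Set where
  constructor isMatching
  field
    disjoint : Unique (vertices M)
    ordered  : All (uncurry _<_) M

matching-unique : ∀ {M : List (Edge n)} → Unique (vertices M) → Unique M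
matching-unique {M = []}    []                   = []
matching-unique {M = e ∷ M} ((_ ∷ a≢) ∷ b≢ ∷ u) =
  All.¬Any⇒All¬ _ (λ e∈ → All.All¬⇒¬Any a≢ (proj₁ (∈-vertices e∈))) ∷ matching-unique u

degree-0 : ∀ {M : List (Edge n)} {v} → v ∉ₗ vertices M → length (filter (λ e → v ∈? ends e) M) ≡ 0
degree-0 {M = M} {v} v∉ = cong length (filter-none (λ e → v ∈? ends e) (All.tabulate λ {e} e∈ v∈ →
  [ (λ { refl → v∉ (proj₁ (∈-vertices e∈)) }) , (λ { refl → v∉ (proj₂ (∈-vertices e∈)) }) ]′
  (∈-ends⁻ e v∈)))

degree-1 : ∀ {M : List (Edge n)} {v} → Unique (vertices M) → v ∈ₗ vertices M →
           length (filter (λ e → v ∈? ends e) M) ≡ 1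
degree-1 {M = e@(a , b) ∷ M} {v} ((a≢b ∷ a≢) ∷ b≢ ∷ u) v∈ with v ∈? ends e
... | yes v∈e = cong suc (degree-0 v∉M)
  where
  v∉M : v ∉ₗ vertices M
  v∉M v∈M with ∈-ends⁻ e v∈e
  ... | inj₁ refl = All.All¬⇒¬Any a≢ v∈M
  ... | inj₂ refl = All.All¬⇒¬Any b≢ v∈M
... | no v∉e with v∈
...   | here refl         = ⊥-elim (v∉e (fst∈ends e))
...   | there (here refl) = ⊥-elim (v∉e (snd∈ends e))
...   | there (there v∈M) = degree-1 u v∈M

-- The degree condition concerns only vertices of `T`. Elsewhere the boundary vanishes because M is
-- a sublist of `E T` and so has no end outside `T`.
∂-perfectMatching : ∀ {T : Subset n} {M} → M ∈ₗ perfectMatchings T → ∀ v → ∂ M v ≡ lookup T v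
∂-perfectMatching {n} {T} {M} M∈ v with ∈-filter⁻ (isPerfectMatching? T) {xs = sublists (E T)} M∈
... | M∈sub , perfect with v ∈? T
...   | yes v∈T = ≡-trans (∂-degree (λ e∈ → proj₂ (proj₂ (∈-E⁻ {X = T} (sublists-⊆ M∈sub e∈)))))
                   (≡-trans (cong odd (perfect v v∈T)) (sym (∈⇒lookup v∈T)))
  where
  ∂ₑ-ends : ∀ (e : Edge n) → proj₁ e < proj₂ e → ∂ₑ e v ≡ does (v ∈? ends e)
  ∂ₑ-ends e@(a , b) a<b with v ∈? ends e
  ... | no v∉ = cong₂ _xor_ (δ-≢ {a = a} {v} λ { refl → v∉ (fst∈ends e) })
                            (δ-≢ {a = b} {v} λ { refl → v∉ (snd∈ends e) })
  ... | yes v∈ with ∈-ends⁻ e v∈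
  ...   | inj₁ refl = cong₂ _xor_ (δ-refl a) (δ-≢ {a = b} {a} (<⇒≢ a<b))
  ...   | inj₂ refl = cong₂ _xor_ (δ-≢ {a = a} {b} (<⇒≢ a<b ∘ sym)) (δ-refl b)
  ∂-degree : ∀ {M : List (Edge n)} → (∀ {e} → e ∈ₗ M → proj₁ e < proj₂ e) →
             ∂ M v ≡ odd (length (filter (λ e → v ∈? ends e) M))
  ∂-degree {[]}    ord = refl
  ∂-degree {e ∷ M} ord with v ∈? ends e | ∂ₑ-ends e (ord (here refl))
  ... | yes v∈ | eq =
    cong₂ _xor_ eq (∂-degree (ord ∘ there))
  ... | no v∉  | eq =
    cong₂ _xor_ eq (∂-degree (ord ∘ there))
...   | no v∉T = ≡-trans (∂-vertices M v) (≡-trans (∂ᵥ-∉ (v∉T ∘ inT M (sublists-⊆ M∈sub))) (sym (∉⇒lookup v∉T)))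
  where
  inT : ∀ M → (∀ {e} → e ∈ₗ M → e ∈ₗ E T) → v ∈ₗ vertices M → v ∈ T
  inT (e ∷ M) M⊆ (here refl)         = proj₁ (∈-E⁻ {X = T} (M⊆ (here refl)))
  inT (e ∷ M) M⊆ (there (here refl)) = proj₁ (proj₂ (∈-E⁻ {X = T} (M⊆ (here refl))))
  inT (e ∷ M) M⊆ (there (there v∈))  = inT M (M⊆ ∘ there) v∈

-- `perfectMatchings` contains only sublists of `E T`, so the edges of a matching must follow the
-- order of that list in order to occur there.
sorted : List (Edge n) → List (Edge n)
sorted M = filter (λ e → DecMembership._∈?_ (≡-dec _≟_ _≟_) e M) (E (tabulate (∂ M)))

sorted-↭ : ∀ {M : List (Edge n)} → IsMatching M → sorted M ↭ M
sorted-↭ {M = M} (isMatching disjoint ordered) = unique-↭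
  (Unique.filter⁺ _∈M? (E-unique T)) (matching-unique disjoint)
  (λ e∈ → proj₂ (∈-filter⁻ _∈M? {xs = E T} e∈))
  (λ e∈ → ∈-filter⁺ _∈M? (∈-E⁺ (covered (proj₁ (∈-vertices e∈))) (covered (proj₂ (∈-vertices e∈)))
                                (All.lookup ordered e∈)) e∈)
  where
  _∈M? = λ e → DecMembership._∈?_ (≡-dec _≟_ _≟_) e M
  T = tabulate (∂ M)
  covered : ∀ {v} → v ∈ₗ vertices M → v ∈ T
  covered {v} v∈ = ∈-tabulate⁺ (≡-trans (∂-vertices M v) (∂ᵥ-∈ disjoint v∈))

sorted-perfect : ∀ {M : List (Edge n)} → IsMatching M → sorted M ∈ₗ perfectMatchings (tabulate (∂ M))
sorted-perfect {M = M} m@(isMatching disjoint _) =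
  ∈-filter⁺ (isPerfectMatching? (tabulate (∂ M)))
    (filter-∈-sublists (λ e → DecMembership._∈?_ (≡-dec _≟_ _≟_) e M) (E (tabulate (∂ M))))
    (λ v v∈ → ≡-trans (↭-length (filter-↭ (λ e → v ∈? ends e) (sorted-↭ m)))
      (degree-1 disjoint (∂ᵥ-true (≡-trans (sym (∂-vertices M v)) (∈-tabulate⁻ v∈)))))

length-matching : ∀ {M : List (Edge n)} → IsMatching M → 2 ℕ.* length M ≡ ∣ tabulate (∂ M) ∣
length-matching {M = M} (isMatching disjoint _) = ≡-trans (sym (length-vertices M))
  (length-unique disjoint
    (λ {v} v∈ → ∈-tabulate⁺ (≡-trans (∂-vertices M v) (∂ᵥ-∈ disjoint v∈)))
    (λ {v} v∈ → ∂ᵥ-true (≡-trans (sym (∂-vertices M v)) (∈-tabulate⁻ v∈))))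

-- Even metrics and minimum joins

-- By the existence of sides, joins with the same boundary have costs of the same parity.
record EvenMetric (n : ℕ) : Set where
  field
    gap     : Fin n → Fin n → ℕ
    side     : Fin n → Bool
    diagonal : ∀ a → gap a a ≡ 0
    gap-sym : ∀ a b → gap a b ≡ gap b a
    triangle : ∀ a b c → gap a c ℕ.≤ gap a b ℕ.+ gap b c
    odd-gap : ∀ a b → odd (gap a b) ≡ side a xor side b

  len : List (Edge n) → ℕ
  len = total (uncurry gap)

  IsMinimal : List (Edge n) → Set
  IsMinimal L = ∀ K → ∂ K ≗ ∂ L → len L ℕ.≤ len K

odd-total : ∀ (f : A → ℕ) xs → odd (total f xs) ≡ parity (odd ∘ f) xs
odd-total f []       = refl
odd-total f (x ∷ xs) = ≡-trans (odd-+ (f x) (total f xs)) (cong (odd (f x) xor_) (odd-total f xs))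

bypass : ∀ x y b l → (y xor b) xor l ≡ (x xor b) xor ((x xor y) xor l)
bypass = solve 4 (λ x y b l → (y :+ b) :+ l := (x :+ b) :+ ((x :+ y) :+ l)) refl

bypass′ : ∀ x y a l → (a xor x) xor l ≡ (a xor y) xor ((x xor y) xor l)
bypass′ = solve 4 (λ x y a l → (a :+ x) :+ l := (a :+ y) :+ ((x :+ y) :+ l)) refl

regroup : ∀ p q r → p ℕ.+ q ℕ.+ r ≡ q ℕ.+ (p ℕ.+ r)
regroup = solve-∀

module _ {n} (D : EvenMetric n) where
  open EvenMetric D

  odd-len : ∀ {K L} → ∂ K ≗ ∂ L → odd (len K) ≡ odd (len L)
  odd-len {K} {L} eq = ≡-trans (via-∂ K) (≡-trans
    (parity-cong (λ v → cong (side v ∧_) (eq v)) (allFin n)) (sym (via-∂ L)))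
    where
    via-∂ : ∀ K → odd (len K) ≡ parity (λ v → side v ∧ ∂ K v) (allFin n)
    via-∂ K = ≡-trans (odd-total (uncurry gap) K)
      (≡-trans (parity-cong (λ (a , b) → odd-gap a b) K)
        (sym (parity-∂ side (Unique.allFin⁺ n) K λ {e} _ → ∈-allFin (proj₁ e) , ∈-allFin (proj₂ e))))

  record Inserted (e : Edge n) (M : List (Edge n)) : Set where
    constructor inserted
    field
      N       : List (Edge n)
      match   : IsMatching N
      ∂N      : ∂ N ≗ ∂ (e ∷ M)
      shorter : len N ℕ.≤ len (e ∷ M)
      support : ∀ {v} → v ∈ₗ vertices N → v ∈ₗ vertices (e ∷ M)

  -- If the new edge meets the head of M, the triangle inequality merges the two into one edge,
  -- which is inserted into the tail; the common end drops out of the boundary. If it does not, the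
  -- head is kept, and the `support` of the recursive result shows that its ends stay unmatched
  -- there.
  insertEdge : ∀ e M → IsMatching M → Inserted e M
  insertEdge (a , b) [] m with <-cmp a b
  ... | tri< a<b a≢b _ = inserted ((a , b) ∷ [])
    (isMatching ((a≢b ∷ []) ∷ [] ∷ []) (a<b ∷ [])) (λ _ → refl) ℕ.≤-refl id
  ... | tri≈ _ refl _ = inserted [] m
    (λ v → sym (cong (_xor false) (xor-same (δ a v)))) ℕ.z≤n (λ ())
  ... | tri> _ a≢b b<a = inserted ((b , a) ∷ [])
    (isMatching (((a≢b ∘ sym) ∷ []) ∷ [] ∷ []) (b<a ∷ []))
    (λ v → cong (_xor false) (xor-comm (δ b v) (δ a v)))
    (ℕ.≤-reflexive (cong (ℕ._+ 0) (gap-sym b a)))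
    (λ { (here refl) → there (here refl) ; (there (here refl)) → here refl })
  insertEdge (a , b) M′@((x , y) ∷ M) m@(isMatching ((x≢y ∷ x≢) ∷ y≢ ∷ u) (x<y ∷ o))
    with a ≟ b | a ≟ x | a ≟ y | b ≟ x | b ≟ y
  ... | yes refl | _ | _ | _ | _ = inserted M′ m
    (λ v → sym (cong (_xor ∂ M′ v) (xor-same (δ a v)))) (ℕ.m≤n+m _ (gap a a)) (λ v∈ → there (there v∈))
  ... | _ | yes refl | _ | _ | _ with insertEdge (y , b) M (isMatching u o)
  ...   | inserted N match ∂N shorter support = inserted N match
    (λ v → ≡-trans (∂N v) (bypass (δ x v) (δ y v) (δ b v) (∂ M v)))
    (ℕ.≤-trans shorter (ℕ.≤-trans (ℕ.+-monoˡ-≤ (len M) (triangle y x b))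
      (ℕ.≤-reflexive (≡-trans (cong (λ z → z ℕ.+ gap x b ℕ.+ len M) (gap-sym y x))
                              (regroup (gap x y) (gap x b) (len M))))))
    λ v∈ → relocate (support v∈)
    where
    relocate : ∀ {v} → v ∈ₗ y ∷ b ∷ vertices M → v ∈ₗ x ∷ b ∷ x ∷ y ∷ vertices M
    relocate (here p)         = there (there (there (here p)))
    relocate (there (here p)) = there (here p)
    relocate (there (there p)) = there (there (there (there p)))
  insertEdge (a , b) M′@((x , y) ∷ M) m@(isMatching ((x≢y ∷ x≢) ∷ y≢ ∷ u) (x<y ∷ o))
      | _ | _ | yes refl | _ | _ with insertEdge (x , b) M (isMatching u o)
  ...   | inserted N match ∂N shorter support = inserted N match
    (λ v → ≡-trans (∂N v) (≡-trans (bypass (δ y v) (δ x v) (δ b v) (∂ M v))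
      (cong (λ z → (δ y v xor δ b v) xor (z xor ∂ M v)) (xor-comm (δ y v) (δ x v)))))
    (ℕ.≤-trans shorter (ℕ.≤-trans (ℕ.+-monoˡ-≤ (len M) (triangle x y b))
      (ℕ.≤-reflexive (regroup (gap x y) (gap y b) (len M)))))
    λ v∈ → relocate (support v∈)
    where
    relocate : ∀ {v} → v ∈ₗ x ∷ b ∷ vertices M → v ∈ₗ y ∷ b ∷ x ∷ y ∷ vertices M
    relocate (here p)         = there (there (here p))
    relocate (there (here p)) = there (here p)
    relocate (there (there p)) = there (there (there (there p)))
  insertEdge (a , b) M′@((x , y) ∷ M) m@(isMatching ((x≢y ∷ x≢) ∷ y≢ ∷ u) (x<y ∷ o))
      | _ | _ | _ | yes refl | _ with insertEdge (a , y) M (isMatching u o)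
  ...   | inserted N match ∂N shorter support = inserted N match
    (λ v → ≡-trans (∂N v) (≡-trans (bypass′ (δ y v) (δ x v) (δ a v) (∂ M v))
      (cong (λ z → (δ a v xor δ x v) xor (z xor ∂ M v)) (xor-comm (δ y v) (δ x v)))))
    (ℕ.≤-trans shorter (ℕ.≤-trans (ℕ.+-monoˡ-≤ (len M) (triangle a x y))
      (ℕ.≤-reflexive (ℕ.+-assoc (gap a x) (gap x y) (len M)))))
    λ v∈ → relocate (support v∈)
    where
    relocate : ∀ {v} → v ∈ₗ a ∷ y ∷ vertices M → v ∈ₗ a ∷ x ∷ x ∷ y ∷ vertices M
    relocate (here p)         = here p
    relocate (there (here p)) = there (there (there (here p)))
    relocate (there (there p)) = there (there (there (there p)))
  insertEdge (a , b) M′@((x , y) ∷ M) m@(isMatching ((x≢y ∷ x≢) ∷ y≢ ∷ u) (x<y ∷ o))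
      | _ | _ | _ | _ | yes refl with insertEdge (a , x) M (isMatching u o)
  ...   | inserted N match ∂N shorter support = inserted N match
    (λ v → ≡-trans (∂N v) (bypass′ (δ x v) (δ y v) (δ a v) (∂ M v)))
    (ℕ.≤-trans shorter (ℕ.≤-trans (ℕ.+-monoˡ-≤ (len M) (triangle a y x))
      (ℕ.≤-reflexive (≡-trans (ℕ.+-assoc (gap a y) (gap y x) (len M))
                              (cong (λ z → gap a y ℕ.+ (z ℕ.+ len M)) (gap-sym y x))))))
    λ v∈ → relocate (support v∈)
    where
    relocate : ∀ {v} → v ∈ₗ a ∷ x ∷ vertices M → v ∈ₗ a ∷ y ∷ x ∷ y ∷ vertices M
    relocate (here p)         = here p
    relocate (there (here p)) = there (there (here p))
    relocate (there (there p)) = there (there (there (there p)))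
  insertEdge (a , b) M′@((x , y) ∷ M) m@(isMatching ((x≢y ∷ x≢) ∷ y≢ ∷ u) (x<y ∷ o))
      | no a≢b | no a≢x | no a≢y | no b≢x | no b≢y with insertEdge (a , b) M (isMatching u o)
  ...   | inserted N (isMatching uN oN) ∂N shorter support = inserted ((x , y) ∷ N)
    (isMatching ((x≢y ∷ fresh a≢x b≢x x≢) ∷ fresh a≢y b≢y y≢ ∷ uN) (x<y ∷ oN))
    (λ v → ≡-trans (cong (∂ₑ (x , y) v xor_) (∂N v))
      (solve 3 (λ e f l → e :+ (f :+ l) := f :+ (e :+ l)) refl (∂ₑ (x , y) v) (∂ₑ (a , b) v) (∂ M v)))
    (ℕ.≤-trans (ℕ.+-monoʳ-≤ (gap x y) shorter)
      (ℕ.≤-reflexive (≡-trans (sym (ℕ.+-assoc (gap x y) (gap a b) (len M))) (regroup (gap x y) (gap a b) (len M)))))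
    λ { (here p) → there (there (here p)) ; (there (here p)) → there (there (there (here p)))
      ; (there (there p)) → relocate (support p) }
    where
    fresh : ∀ {z} → a ≢ z → b ≢ z → All (z ≢_) (vertices M) → All (z ≢_) (vertices N)
    fresh {z} a≢z b≢z z≢ = All.¬Any⇒All¬ _ λ z∈ → case (support z∈)
      where
      case : z ∉ₗ a ∷ b ∷ vertices M
      case (here refl)         = a≢z refl
      case (there (here refl)) = b≢z refl
      case (there (there z∈))  = All.All¬⇒¬Any z≢ z∈
    relocate : ∀ {v} → v ∈ₗ a ∷ b ∷ vertices M → v ∈ₗ a ∷ b ∷ x ∷ y ∷ vertices M
    relocate (here p)         = here p
    relocate (there (here p)) = there (here p)
    relocate (there (there p)) = there (there (there (there p)))

  toMatching : ∀ L → ∃ λ M → IsMatching M × ∂ M ≗ ∂ L × len M ℕ.≤ len L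
  toMatching [] = [] , isMatching [] [] , (λ _ → refl) , ℕ.z≤n
  toMatching (e ∷ L) with M , m , ∂M , M≤L ← toMatching L
                     with inserted N match ∂N shorter _ ← insertEdge e M m =
    N , match , (λ v → ≡-trans (∂N v) (cong (∂ₑ e v xor_) (∂M v))) ,
    ℕ.≤-trans shorter (ℕ.+-monoʳ-≤ (uncurry gap e) M≤L)

  toPerfectMatching : ∀ L → let T = tabulate (∂ L) in
    ∃ λ M → M ∈ₗ perfectMatchings T × 2 ℕ.* length M ≡ ∣ T ∣ × len M ℕ.≤ len L
  toPerfectMatching L with M , m , ∂M , M≤L ← toMatching L rewrite sym (tabulate-cong ∂M) =
    sorted M , sorted-perfect m ,
    ≡-trans (cong (2 ℕ.*_) (↭-length (sorted-↭ m))) (length-matching m) ,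
    ℕ.≤-trans (ℕ.≤-reflexive (total-↭ _ (sorted-↭ m))) M≤L

  abstract

    -- Minimality is over the infinitely many lists with the boundary of L. Since each of them
    -- shortens to a perfect matching, a minimum over the finite list of perfect matchings suffices.
    minimumMatching : ∀ L → let T = tabulate (∂ L) in
      ∃ λ M → M ∈ₗ perfectMatchings T × 2 ℕ.* length M ≡ ∣ T ∣ × ∂ M ≗ ∂ L × IsMinimal M
    minimumMatching L
      with M₀ , M₀∈ , _ , _ ← toPerfectMatching L
      -- The minimiser is converted once more because the conversion also supplies the number of
      -- edges.
      with M , M∈ , size , M≤ ← toPerfectMatching (argmin len M₀ (perfectMatchings (tabulate (∂ L)))) =
      M , subst (λ T → M ∈ₗ perfectMatchings T) T≡ M∈ , ≡-trans size (cong ∣_∣ T≡) , ∂M ,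
      λ K ∂K → ℕ.≤-trans M≤ (minimal K (λ v → ≡-trans (∂K v) (∂M v)))
      where
      T : Subset n
      T = tabulate (∂ L)
      M₁ : List (Edge n)
      M₁ = argmin len M₀ (perfectMatchings T)
      M₁∈ : M₁ ∈ₗ perfectMatchings T
      M₁∈ with argmin-sel len M₀ (perfectMatchings T)
      ... | inj₁ eq = subst (_∈ₗ perfectMatchings T) (sym eq) M₀∈
      ... | inj₂ ∈  = ∈
      ∂M₁ : ∂ M₁ ≗ ∂ L
      ∂M₁ v = ≡-trans (∂-perfectMatching M₁∈ v) (lookup∘tabulate (∂ L) v)
      T≡ : tabulate (∂ M₁) ≡ T
      T≡ = tabulate-cong ∂M₁
      ∂M : ∂ M ≗ ∂ L
      ∂M v = ≡-trans (∂-perfectMatching M∈ v) (≡-trans (lookup∘tabulate (∂ M₁) v) (∂M₁ v))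
      minimal : ∀ K → ∂ K ≗ ∂ L → len M₁ ℕ.≤ len K
      minimal K ∂K with N , N∈ , _ , N≤K ← toPerfectMatching K =
        ℕ.≤-trans (All.lookup (f[argmin]≤f[xs] {f = len} M₀ (perfectMatchings T))
                              (subst (λ T → N ∈ₗ perfectMatchings T) (tabulate-cong ∂K) N∈)) N≤K

-- Packing cuts

-- Abstract, because with-abstraction would otherwise unfold the proofs produced by the solver.
abstract

  xor-id1 : ∀ x u b c l → ((x xor u) xor l) xor ((b xor c) xor l) ≡ u xor (x xor (b xor (c xor false)))
  xor-id1 = solve 5 (λ x u b c l → ((x :+ u) :+ l) :+ ((b :+ c) :+ l) := u :+ (x :+ (b :+ (c :+ con false)))) refl

  xor-id2 : ∀ x u l → (u xor x) xor ((x xor u) xor l) ≡ l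
  xor-id2 = solve 3 (λ x u l → (u :+ x) :+ ((x :+ u) :+ l) := l) refl

  xor-id3 : ∀ x u b c l → (u xor b) xor ((u xor x) xor ((b xor c) xor l)) ≡ (x xor c) xor l
  xor-id3 = solve 5 (λ x u b c l → (u :+ b) :+ ((u :+ x) :+ ((b :+ c) :+ l)) := (x :+ c) :+ l) refl

  xor-id4 : ∀ x u b l → (u xor b) xor ((x xor u) xor l) ≡ (x xor b) xor l
  xor-id4 = solve 4 (λ x u b l → (u :+ b) :+ ((x :+ u) :+ l) := (x :+ b) :+ l) refl

  xor-id5 : ∀ u b c l → (u xor c) xor ((u xor b) xor ((b xor c) xor l)) ≡ l
  xor-id5 = solve 4 (λ u b c l → (u :+ c) :+ ((u :+ b) :+ ((b :+ c) :+ l)) := l) refl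

  xor-id6 : ∀ u b c l → (u xor b) xor ((u xor c) xor ((b xor c) xor l)) ≡ l
  xor-id6 = solve 4 (λ u b c l → (u :+ b) :+ ((u :+ c) :+ ((b :+ c) :+ l)) := l) refl

  xor-id7 : ∀ u b c l → l ≡ (u xor b) xor ((u xor c) xor ((b xor c) xor l))
  xor-id7 = solve 4 (λ u b c l → l := (u :+ b) :+ ((u :+ c) :+ ((b :+ c) :+ l))) refl

  xor-id8 : ∀ k a → k xor (k xor a) ≡ a
  xor-id8 = solve 2 (λ k a → k :+ (k :+ a) := a) refl

  xor-id9 : ∀ i j k a → ((i xor j) xor k) xor a ≡ k xor (i xor (j xor a))
  xor-id9 = solve 4 (λ i j k a → ((i :+ j) :+ k) :+ a := k :+ (i :+ (j :+ a))) refl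

  xor-id10 : ∀ u i k a → ((u xor i) xor k) xor a ≡ k xor ((i xor a) xor u)
  xor-id10 = solve 4 (λ u i k a → ((u :+ i) :+ k) :+ a := k :+ ((i :+ a) :+ u)) refl

  xor-id11 : ∀ k a A p u → k xor ((a xor A) xor (u xor p)) ≡ (u xor a) xor (k xor (A xor p))
  xor-id11 = solve 5 (λ k a A p u → k :+ ((a :+ A) :+ (u :+ p)) := (u :+ a) :+ (k :+ (A :+ p))) refl

  xor-id12 : ∀ u a b k → (u xor a) xor ((u xor b) xor k) ≡ (a xor b) xor k
  xor-id12 = solve 4 (λ u a b k → (u :+ a) :+ ((u :+ b) :+ k) := (a :+ b) :+ k) refl

  xor-id13 : ∀ x y → y ≡ x xor (x xor y)
  xor-id13 = solve 2 (λ x y → y := x :+ (x :+ y)) refl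

  xor-id14 : ∀ x y → true xor (x xor y) ≡ (x xor true) xor (y xor false)
  xor-id14 = solve 2 (λ x y → con true :+ (x :+ y) := (x :+ con true) :+ (y :+ con false)) refl

  xor-id15 : ∀ x y → x xor y ≡ (x xor false) xor (y xor false)
  xor-id15 = solve 2 (λ x y → x :+ y := (x :+ con false) :+ (y :+ con false)) refl

  xor-id16 : ∀ u x y → (true xor (u xor x)) xor (true xor (u xor y)) ≡ (x xor false) xor (y xor false)
  xor-id16 = solve 3 (λ u x y → (con true :+ (u :+ x)) :+ (con true :+ (u :+ y)) := (x :+ con false) :+ (y :+ con false)) refl

≡-parity-gap : ∀ {a b} → odd a ≡ odd b → a ℕ.< b → 2 ℕ.+ a ℕ.≤ b
≡-parity-gap {a} {suc b} eq (ℕ.s≤s a≤b) with ℕ.m≤n⇒m<n∨m≡n a≤b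
... | inj₁ a<b  = ℕ.s≤s a<b
... | inj₂ refl = ⊥-elim (Bool.not-¬ refl eq)

pred-odd : ∀ m → 1 ℕ.≤ m → odd (ℕ.pred m) ≡ not (odd m)
pred-odd (suc m) _ = sym (not-involutive (odd m))

-- L is a minimum T-join and u minimises the cost of a minimum (T + x₀ + u)-join Lᵤ.  The ball of
-- radius 1 around u is contracted; gap′ is the resulting metric.
module Contraction {n} (D : EvenMetric n) (L : List (Edge n)) (L-min : EvenMetric.IsMinimal D L)
  (x₀ u : Fin n) (Lᵤ : List (Edge n)) (∂Lᵤ : ∂ Lᵤ ≗ ∂ ((x₀ , u) ∷ L))
  (Lᵤ-min : ∀ x K → ∂ K ≗ ∂ ((x₀ , x) ∷ L) → EvenMetric.len D Lᵤ ℕ.≤ EvenMetric.len D K)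
  where
  open EvenMetric D

  q : Fin n → ℕ
  q v = gap u v

  -- The distance to the unit ball around u. Truncation matters: it is 0 at distance 0 from u as
  -- well as at distance 1.
  g : Fin n → ℕ
  g v = ℕ.pred (q v)

  suc-g : ∀ {v} → 1 ℕ.≤ q v → suc (g v) ≡ q v
  suc-g {v} 1≤q = ℕ.suc-pred (q v) {{ℕ.>-nonZero 1≤q}}

  len-moved : ∀ N₁ N₂ {M₁ M₂ : List (Edge n)} → N₁ ++ N₂ ↭ M₁ ++ M₂ →
              len N₁ ℕ.+ len N₂ ≡ len M₁ ℕ.+ len M₂
  len-moved N₁ N₂ {M₁} {M₂} moved =
    ≡-trans (sym (total-++ _ N₁ N₂)) (≡-trans (total-↭ _ moved) (total-++ _ M₁ M₂))

  -- This is where the choice of u among all vertices enters. Exchanging `Lᵤ` with K at u leads to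
  -- x₀, b or c. In each case, after one edge from u to b or c is added, one of the two lists is a
  -- T-join and the other a (T + x₀ + x)-join, which is at least as long as `Lᵤ`. Cancelling `Lᵤ`
  -- leaves a single edge at u as the extra cost, where closing K up naively would take two.
  pairBound : ∀ K b c → ∂ K ≗ ∂ ((b , c) ∷ L) →
              len L ℕ.≤ q b ℕ.+ len K ⊎ len L ℕ.≤ q c ℕ.+ len K
  pairBound K b c ∂K with exchangeWith Lᵤ K u (x₀ ∷ b ∷ c ∷ []) differ
    where
    differ : ∀ v → ∂ Lᵤ v xor ∂ K v ≡ ∂ᵥ (u ∷ x₀ ∷ b ∷ c ∷ []) v
    differ v = ≡-trans (cong₂ _xor_ (∂Lᵤ v) (∂K v))
      (xor-id1 (δ x₀ v) (δ u v) (δ b v) (δ c v) (∂ L v))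
  ... | j , here refl , exchange N₁ N₂ ∂N₁ ∂N₂ moved = inj₁ (ℕ.+-cancelʳ-≤ (len Lᵤ) _ _ (begin
    len L ℕ.+ len Lᵤ               ≤⟨ ℕ.+-mono-≤ (L-min N₁ ∂N₁′) (Lᵤ-min c ((u , b) ∷ N₂) ∂N₂′) ⟩
    len N₁ ℕ.+ (q b ℕ.+ len N₂)    ≡⟨ swap-middle (len N₁) (q b) (len N₂) ⟩
    q b ℕ.+ (len N₁ ℕ.+ len N₂)    ≡⟨ cong (q b ℕ.+_) (len-moved N₁ N₂ {Lᵤ} {K} moved) ⟩
    q b ℕ.+ (len Lᵤ ℕ.+ len K)     ≡⟨ cong (q b ℕ.+_) (ℕ.+-comm (len Lᵤ) (len K)) ⟩
    q b ℕ.+ (len K ℕ.+ len Lᵤ)     ≡⟨ ℕ.+-assoc (q b) (len K) (len Lᵤ) ⟨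
    q b ℕ.+ len K ℕ.+ len Lᵤ       ∎))
    where
    open ℕ.≤-Reasoning
    ∂N₁′ : ∂ N₁ ≗ ∂ L
    ∂N₁′ v = ≡-trans (∂N₁ v) (≡-trans (cong (∂ₑ (u , x₀) v xor_) (∂Lᵤ v))
      (xor-id2 (δ x₀ v) (δ u v) (∂ L v)))
    ∂N₂′ : ∂ ((u , b) ∷ N₂) ≗ ∂ ((x₀ , c) ∷ L)
    ∂N₂′ v = ≡-trans (cong (∂ₑ (u , b) v xor_) (≡-trans (∂N₂ v) (cong (∂ₑ (u , x₀) v xor_) (∂K v))))
      (xor-id3 (δ x₀ v) (δ u v) (δ b v) (δ c v) (∂ L v))
  ... | j , there (here refl) , exchange N₁ N₂ ∂N₁ ∂N₂ moved = inj₂ (ℕ.+-cancelˡ-≤ (len Lᵤ) _ _ (begin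
    len Lᵤ ℕ.+ len L               ≤⟨ ℕ.+-mono-≤ (Lᵤ-min b N₁ ∂N₁′) (L-min ((u , c) ∷ N₂) ∂N₂′) ⟩
    len N₁ ℕ.+ (q c ℕ.+ len N₂)    ≡⟨ swap-middle (len N₁) (q c) (len N₂) ⟩
    q c ℕ.+ (len N₁ ℕ.+ len N₂)    ≡⟨ cong (q c ℕ.+_) (len-moved N₁ N₂ {Lᵤ} {K} moved) ⟩
    q c ℕ.+ (len Lᵤ ℕ.+ len K)     ≡⟨ swap-middle (q c) (len Lᵤ) (len K) ⟩
    len Lᵤ ℕ.+ (q c ℕ.+ len K)     ∎))
    where
    open ℕ.≤-Reasoning
    ∂N₁′ : ∂ N₁ ≗ ∂ ((x₀ , b) ∷ L)
    ∂N₁′ v = ≡-trans (∂N₁ v) (≡-trans (cong (∂ₑ (u , b) v xor_) (∂Lᵤ v))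
      (xor-id4 (δ x₀ v) (δ u v) (δ b v) (∂ L v)))
    ∂N₂′ : ∂ ((u , c) ∷ N₂) ≗ ∂ L
    ∂N₂′ v = ≡-trans (cong (∂ₑ (u , c) v xor_) (≡-trans (∂N₂ v) (cong (∂ₑ (u , b) v xor_) (∂K v))))
      (xor-id5 (δ u v) (δ b v) (δ c v) (∂ L v))
  ... | j , there (there (here refl)) , exchange N₁ N₂ ∂N₁ ∂N₂ moved = inj₁ (ℕ.+-cancelˡ-≤ (len Lᵤ) _ _ (begin
    len Lᵤ ℕ.+ len L               ≤⟨ ℕ.+-mono-≤ (Lᵤ-min c N₁ ∂N₁′) (L-min ((u , b) ∷ N₂) ∂N₂′) ⟩
    len N₁ ℕ.+ (q b ℕ.+ len N₂)    ≡⟨ swap-middle (len N₁) (q b) (len N₂) ⟩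
    q b ℕ.+ (len N₁ ℕ.+ len N₂)    ≡⟨ cong (q b ℕ.+_) (len-moved N₁ N₂ {Lᵤ} {K} moved) ⟩
    q b ℕ.+ (len Lᵤ ℕ.+ len K)     ≡⟨ swap-middle (q b) (len Lᵤ) (len K) ⟩
    len Lᵤ ℕ.+ (q b ℕ.+ len K)     ∎))
    where
    open ℕ.≤-Reasoning
    ∂N₁′ : ∂ N₁ ≗ ∂ ((x₀ , c) ∷ L)
    ∂N₁′ v = ≡-trans (∂N₁ v) (≡-trans (cong (∂ₑ (u , c) v xor_) (∂Lᵤ v))
      (xor-id4 (δ x₀ v) (δ u v) (δ c v) (∂ L v)))
    ∂N₂′ : ∂ ((u , b) ∷ N₂) ≗ ∂ L
    ∂N₂′ v = ≡-trans (cong (∂ₑ (u , b) v xor_) (≡-trans (∂N₂ v) (cong (∂ₑ (u , c) v xor_) (∂K v))))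
      (xor-id6 (δ u v) (δ b v) (δ c v) (∂ L v))

  -- Since both distances are positive, `pairBound` makes L strictly shorter than K with both edges
  -- to u added. The two have the same boundary, hence lengths of the same parity, so the difference
  -- is at least 2 and each distance can be lowered by one.
  pairBound⁺ : ∀ K b c → 1 ℕ.≤ q b → 1 ℕ.≤ q c → ∂ K ≗ ∂ ((b , c) ∷ L) →
               len L ℕ.≤ g b ℕ.+ (g c ℕ.+ len K)
  pairBound⁺ K b c 1≤qb 1≤qc ∂K = ℕ.+-cancelˡ-≤ 2 _ _ (begin
    2 ℕ.+ len L                               ≤⟨ ≡-parity-gap (odd-len D {L} {(u , b) ∷ (u , c) ∷ K} ∂L) closer ⟩
    q b ℕ.+ (q c ℕ.+ len K)                   ≡⟨ cong₂ (λ x y → x ℕ.+ (y ℕ.+ len K)) (suc-g 1≤qb) (suc-g 1≤qc) ⟨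
    suc (g b) ℕ.+ (suc (g c) ℕ.+ len K)       ≡⟨ ℕ.+-suc (suc (g b)) _ ⟩
    2 ℕ.+ (g b ℕ.+ (g c ℕ.+ len K))           ∎)
    where
    open ℕ.≤-Reasoning
    ∂L : ∂ L ≗ ∂ ((u , b) ∷ (u , c) ∷ K)
    ∂L v = ≡-trans
      (xor-id7 (δ u v) (δ b v) (δ c v) (∂ L v))
      (cong (λ z → ∂ₑ (u , b) v xor (∂ₑ (u , c) v xor z)) (sym (∂K v)))
    closer : len L ℕ.< q b ℕ.+ (q c ℕ.+ len K)
    closer with pairBound K b c ∂K
    ... | inj₁ ≤b = ℕ.≤-trans (ℕ.s≤s ≤b) (ℕ.≤-trans (ℕ.+-monoˡ-≤ _ 1≤qc)
                      (ℕ.≤-reflexive (swap-middle (q c) (q b) (len K))))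
    ... | inj₂ ≤c = ℕ.+-mono-≤ 1≤qb ≤c

  -- The vertices of A are paired off by exchanging K with L itself: the partner j of i lies in A,
  -- the list `N₁` no longer lacks i and j, and `N₂` is a (T + i + j)-join to which `pairBound⁺`
  -- applies. One copy of `len L` on either side cancels. The bound k on the length of A drives the
  -- recursion.
  evenBound : ∀ k A K → length A ℕ.≤ k → All (λ a → 1 ℕ.≤ q a) A →
              (∀ v → ∂ K v xor ∂ᵥ A v ≡ ∂ L v) → len L ℕ.≤ total g A ℕ.+ len K
  evenBound k [] K _ _ ∂K = L-min K (λ v → ≡-trans (sym (xor-identityʳ (∂ K v))) (∂K v))
  evenBound (suc k) (i ∷ A) K (ℕ.s≤s size) (1≤qi ∷ far) ∂K with exchangeWith K L i A differ
    where
    differ : ∀ v → ∂ K v xor ∂ L v ≡ ∂ᵥ (i ∷ A) v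
    differ v = ≡-trans (cong (∂ K v xor_) (sym (∂K v)))
      (xor-id8 (∂ K v) (∂ᵥ (i ∷ A) v))
  ... | j , j∈A , exchange N₁ N₂ ∂N₁ ∂N₂ moved with A′ , A↭ ← ∈⇒↭ j∈A =
    ℕ.+-cancelʳ-≤ (len L) _ _ (begin
    len L ℕ.+ len L
      ≤⟨ ℕ.+-mono-≤ (evenBound k A′ N₁ size′ far′ ∂N₁′)
                    (pairBound⁺ N₂ i j 1≤qi (All.lookup far j∈A) ∂N₂) ⟩
    (total g A′ ℕ.+ len N₁) ℕ.+ (g i ℕ.+ (g j ℕ.+ len N₂))
      ≡⟨ collect (total g A′) (len N₁) (g i) (g j) (len N₂) ⟩
    (g i ℕ.+ (g j ℕ.+ total g A′)) ℕ.+ (len N₁ ℕ.+ len N₂)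
      ≡⟨ cong₂ (λ x y → (g i ℕ.+ x) ℕ.+ y) (sym (total-↭ g A↭)) (len-moved N₁ N₂ {K} {L} moved) ⟩
    (g i ℕ.+ total g A) ℕ.+ (len K ℕ.+ len L)
      ≡⟨ ℕ.+-assoc _ (len K) (len L) ⟨
    (g i ℕ.+ total g A) ℕ.+ len K ℕ.+ len L ∎)
    where
    open ℕ.≤-Reasoning
    collect : ∀ a n₁ i j n₂ → (a ℕ.+ n₁) ℕ.+ (i ℕ.+ (j ℕ.+ n₂)) ≡ (i ℕ.+ (j ℕ.+ a)) ℕ.+ (n₁ ℕ.+ n₂)
    collect = solve-∀
    size′ : length A′ ℕ.≤ k
    size′ = ℕ.≤-trans (ℕ.n≤1+n _) (ℕ.≤-trans (ℕ.≤-reflexive (sym (↭-length A↭))) size)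
    far′ : All (λ a → 1 ℕ.≤ q a) A′
    far′ = All.tabulate λ a∈ → All.lookup far (∈-resp-↭ (↭-sym A↭) (there a∈))
    ∂N₁′ : ∀ v → ∂ N₁ v xor ∂ᵥ A′ v ≡ ∂ L v
    ∂N₁′ v = ≡-trans (cong (_xor ∂ᵥ A′ v) (∂N₁ v)) (≡-trans
      (xor-id9 (δ i v) (δ j v) (∂ K v) (∂ᵥ A′ v))
      (≡-trans (cong (λ z → ∂ K v xor (δ i v xor z)) (sym (parity-↭ _ A↭))) (∂K v)))

  -- In the contracted metric an edge may run through the ball around u.  Unrolling these edges
  -- leaves a list A of vertices, each of which is to be joined to u.
  Pending : List (Fin n) → Fin n → Bool
  Pending A v = ∂ᵥ A v xor (odd (length A) ∧ δ u v)

  -- For an even number of pending vertices the copies of u cancel and nothing is lost. For an odd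
  -- number, one vertex is really joined to u at the price `q i`, one more than `g i`; this is the
  -- single unit lost by the contraction.
  pendingBound : ∀ A K → All (λ a → 1 ℕ.≤ q a) A →
                 (∀ v → ∂ K v xor Pending A v ≡ ∂ L v) → len L ℕ.≤ suc (total g A ℕ.+ len K)
  pendingBound A K far ∂K with odd (length A) in odd-A
  ... | false = ℕ.m≤n⇒m≤1+n (evenBound _ A K ℕ.≤-refl far λ v →
                  ≡-trans (cong (∂ K v xor_) (sym (xor-identityʳ (∂ᵥ A v)))) (∂K v))
  pendingBound (i ∷ A) K (1≤qi ∷ far) ∂K | true = begin
    len L                                 ≤⟨ evenBound _ A ((u , i) ∷ K) ℕ.≤-refl far ∂K′ ⟩
    total g A ℕ.+ (q i ℕ.+ len K)         ≡⟨ cong (λ z → total g A ℕ.+ (z ℕ.+ len K)) (suc-g 1≤qi) ⟨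
    total g A ℕ.+ (suc (g i) ℕ.+ len K)   ≡⟨ collect (total g A) (g i) (len K) ⟩
    suc (g i ℕ.+ total g A ℕ.+ len K)     ∎
    where
    open ℕ.≤-Reasoning
    collect : ∀ a i k → a ℕ.+ (suc i ℕ.+ k) ≡ suc (i ℕ.+ a ℕ.+ k)
    collect = solve-∀
    ∂K′ : ∀ v → ∂ ((u , i) ∷ K) v xor ∂ᵥ A v ≡ ∂ L v
    ∂K′ v = ≡-trans
      (xor-id10 (δ u v) (δ i v) (∂ K v) (∂ᵥ A v))
      (∂K v)

  gap′ : Fin n → Fin n → ℕ
  gap′ a b = gap a b ℕ.⊓ (g a ℕ.+ g b)

  -- A list of contracted edges read in the original metric: `direct` consists of genuine edges,
  -- while each vertex of `pending` is charged only its distance to the ball.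
  record Unrolled (β : Fin n → Bool) (c : ℕ) : Set where
    constructor unrolled
    field
      pending  : List (Fin n)
      direct   : List (Edge n)
      far      : All (λ a → 1 ℕ.≤ q a) pending
      boundary : ∀ v → ∂ direct v xor Pending pending v ≡ β v
      price    : total g pending ℕ.+ len direct ≡ c

  reboundary : ∀ {β β′ c c′} → β ≗ β′ → c ≡ c′ → Unrolled β c → Unrolled β′ c′
  reboundary β≗ refl (unrolled A K far ∂K price) =
    unrolled A K far (λ v → ≡-trans (∂K v) (β≗ v)) price

  addVertex : ∀ {β c} a → Unrolled β c → Unrolled (λ v → ∂ₑ (u , a) v xor β v) (g a ℕ.+ c)
  addVertex {β} a (unrolled A K far ∂K price) with q a in qa
  -- At distance 0 from u the edge to u is free, so it is laid at once; keeping the vertex pending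
  -- would violate `far`.
  ... | zero = unrolled A ((u , a) ∷ K) far
    (λ v → ≡-trans (xor-assoc (∂ₑ (u , a) v) _ _) (cong (∂ₑ (u , a) v xor_) (∂K v)))
    (≡-trans (cong (λ z → total g A ℕ.+ (z ℕ.+ len K)) qa) price)
  ... | suc q′ = unrolled (a ∷ A) K (subst (1 ℕ.≤_) (sym qa) (ℕ.s≤s ℕ.z≤n) ∷ far)
    (λ v → ≡-trans
      (cong (λ z → ∂ K v xor ((δ a v xor ∂ᵥ A v) xor z)) (flip-∧ (odd (length A)) (δ u v)))
      (≡-trans (xor-id11 (∂ K v) (δ a v) (∂ᵥ A v) (odd (length A) ∧ δ u v) (δ u v))
               (cong (∂ₑ (u , a) v xor_) (∂K v))))
    (≡-trans (ℕ.+-assoc (g a) (total g A) (len K)) (cong₂ ℕ._+_ (cong ℕ.pred qa) price))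
    where
    flip-∧ : ∀ b c → not b ∧ c ≡ c xor (b ∧ c)
    flip-∧ true  true  = refl
    flip-∧ true  false = refl
    flip-∧ false true  = refl
    flip-∧ false false = refl

  addEdge : ∀ {β c} e → Unrolled β c → Unrolled (λ v → ∂ₑ e v xor β v) (uncurry gap e ℕ.+ c)
  addEdge e (unrolled A K far ∂K price) = unrolled A (e ∷ K) far
    (λ v → ≡-trans (xor-assoc (∂ₑ e v) _ _) (cong (∂ₑ e v xor_) (∂K v)))
    (≡-trans (swap-middle (total g A) (uncurry gap e) (len K)) (cong (uncurry gap e ℕ.+_) price))

  unroll : ∀ K → Unrolled (∂ K) (total (uncurry gap′) K)
  unroll [] = unrolled [] [] [] (λ _ → refl) refl
  unroll ((a , b) ∷ K) with ℕ.≤-total (gap a b) (g a ℕ.+ g b)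
  ... | inj₁ direct = reboundary (λ _ → refl)
    (cong (ℕ._+ total (uncurry gap′) K) (sym (ℕ.m≤n⇒m⊓n≡m direct))) (addEdge (a , b) (unroll K))
  ... | inj₂ through = reboundary
    (λ v → xor-id12 (δ u v) (δ a v) (δ b v) (∂ K v))
    (≡-trans (sym (ℕ.+-assoc (g a) (g b) _))
             (cong (ℕ._+ total (uncurry gap′) K) (sym (ℕ.m≥n⇒m⊓n≡n through))))
    (addVertex a (addVertex b (unroll K)))

  contractedBound : ∀ K → ∂ K ≗ ∂ L → len L ℕ.≤ suc (total (uncurry gap′) K)
  contractedBound K ∂K≗ with unrolled A K′ far ∂K′ price ← unroll K =
    subst (λ z → len L ℕ.≤ suc z) price (pendingBound A K′ far λ v → ≡-trans (∂K′ v) (∂K≗ v))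

  -- The cut is the class of points at distance 0 from u, not the unit ball. Merging this class with
  -- the points at distance 1 shortens every gap that leaves it by exactly one, which makes room for
  -- the cut, and no other gap grows.
  U : Fin n → Bool
  U v = does (q v ℕ.≟ 0)

  U-near : ∀ {v} → q v ≡ 0 → U v ≡ true
  U-near {v} = dec-true (q v ℕ.≟ 0)

  U-far : ∀ {v} → 1 ℕ.≤ q v → U v ≡ false
  U-far {v} 1≤q = dec-false (q v ℕ.≟ 0) (ℕ.>⇒≢ 1≤q)

  near-or-far : ∀ v → q v ≡ 0 ⊎ 1 ℕ.≤ q v
  near-or-far v with q v
  ... | zero  = inj₁ refl
  ... | suc _ = inj₂ (ℕ.s≤s ℕ.z≤n)

  g-lipschitz : ∀ a b → g a ℕ.≤ gap a b ℕ.+ g b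
  g-lipschitz a b with near-or-far b
  ... | inj₁ near rewrite near = ℕ.≤-trans ℕ.pred[n]≤n (ℕ.≤-trans (triangle u b a)
          (ℕ.≤-reflexive (≡-trans (cong (ℕ._+ gap b a) near) (≡-trans (gap-sym b a) (sym (ℕ.+-identityʳ _))))))
  ... | inj₂ far = ℕ.≤-trans (ℕ.pred-mono-≤ (triangle u b a)) (ℕ.≤-reflexive
          (≡-trans (cong (λ z → ℕ.pred (z ℕ.+ gap b a)) (sym (suc-g far)))
                   (≡-trans (ℕ.+-comm (g b) (gap b a)) (cong (ℕ._+ g b) (gap-sym b a)))))

  near-gap : ∀ {a} → q a ≡ 0 → ∀ b → gap a b ≡ q b
  near-gap {a} near b = ℕ.≤-antisym
    (ℕ.≤-trans (triangle a u b) (ℕ.≤-reflexive (cong (ℕ._+ q b) (≡-trans (gap-sym a u) near))))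
    (ℕ.≤-trans (triangle u a b) (ℕ.≤-reflexive (cong (ℕ._+ gap a b) near)))

  near-gap′ : ∀ {a} → q a ≡ 0 → ∀ b → gap′ a b ≡ g b
  near-gap′ {a} near b rewrite near-gap near b | near = ℕ.m≥n⇒m⊓n≡n ℕ.pred[n]≤n

  gap′-sym : ∀ a b → gap′ a b ≡ gap′ b a
  gap′-sym a b = cong₂ ℕ._⊓_ (gap-sym a b) (ℕ.+-comm (g a) (g b))

  gap′-triangle : ∀ a b c → gap′ a c ℕ.≤ gap′ a b ℕ.+ gap′ b c
  gap′-triangle a b c
    with ℕ.⊓-sel (gap a b) (g a ℕ.+ g b) | ℕ.⊓-sel (gap b c) (g b ℕ.+ g c)
  ... | inj₁ p | inj₁ r rewrite p | r = ℕ.≤-trans (ℕ.m⊓n≤m _ _) (triangle a b c)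
  ... | inj₁ p | inj₂ r rewrite p | r = ℕ.≤-trans (ℕ.m⊓n≤n _ _)
    (ℕ.≤-trans (ℕ.+-monoˡ-≤ (g c) (g-lipschitz a b)) (ℕ.≤-reflexive (ℕ.+-assoc (gap a b) (g b) (g c))))
  ... | inj₂ p | inj₁ r rewrite p | r = ℕ.≤-trans (ℕ.m⊓n≤n _ _)
    (ℕ.≤-trans (ℕ.+-monoʳ-≤ (g a) (g-lipschitz c b)) (ℕ.≤-reflexive
      (≡-trans (cong (λ z → g a ℕ.+ (z ℕ.+ g b)) (gap-sym c b)) (rotate (g a) (gap b c) (g b)))))
    where
    rotate : ∀ x y z → x ℕ.+ (y ℕ.+ z) ≡ (x ℕ.+ z) ℕ.+ y
    rotate = solve-∀
  ... | inj₂ p | inj₂ r rewrite p | r = ℕ.≤-trans (ℕ.m⊓n≤n _ _)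
    (ℕ.+-mono-≤ (ℕ.m≤m+n (g a) (g b)) (ℕ.m≤n+m (g c) (g b)))

  odd-q : ∀ v → odd (q v) ≡ side u xor side v
  odd-q = odd-gap u

  odd-g-far : ∀ {v} → 1 ℕ.≤ q v → odd (g v) ≡ not (side u xor side v)
  odd-g-far {v} far = ≡-trans (pred-odd (q v) far) (cong not (odd-q v))

  side-near : ∀ {v} → q v ≡ 0 → side v ≡ side u
  side-near {v} near = ≡-trans
    (xor-id13 (side u) (side v))
    (≡-trans (cong (side u xor_) (≡-trans (sym (odd-q v)) (cong odd near))) (xor-identityʳ (side u)))

  odd-near-far : ∀ {a b} → q a ≡ 0 → 1 ℕ.≤ q b →
                 odd (gap′ a b) ≡ (side a xor U a) xor (side b xor U b)
  odd-near-far {a} {b} near far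
    rewrite near-gap′ near b | odd-g-far far | U-near near | U-far far | side-near near =
    xor-id14 (side u) (side b)

  -- Points at distance 1 from u lie on the other side from u. Since the contraction merges them
  -- with `U`, the bipartition survives once the points of `U` change sides.
  odd-gap′ : ∀ a b → odd (gap′ a b) ≡ (side a xor U a) xor (side b xor U b)
  odd-gap′ a b with near-or-far a | near-or-far b
  ... | inj₁ na | inj₁ nb = ≡-trans (cong odd (≡-trans (near-gap′ na b) (cong ℕ.pred nb))) (sym
    (≡-trans (cong₂ _xor_ (cong₂ _xor_ (side-near na) (U-near na)) (cong₂ _xor_ (side-near nb) (U-near nb)))
             (xor-same (side u xor true))))
  ... | inj₁ na | inj₂ fb = odd-near-far na fb
  ... | inj₂ fa | inj₁ nb = ≡-trans (cong odd (gap′-sym a b))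
    (≡-trans (odd-near-far nb fa) (xor-comm (side b xor U b) (side a xor U a)))
  ... | inj₂ fa | inj₂ fb with ℕ.⊓-sel (gap a b) (g a ℕ.+ g b)
  ...   | inj₁ p rewrite p | odd-gap a b | U-far fa | U-far fb =
    xor-id15 (side a) (side b)
  ...   | inj₂ p rewrite p | odd-+ (g a) (g b) | odd-g-far fa | odd-g-far fb | U-far fa | U-far fb =
    xor-id16 (side u) (side a) (side b)

  contracted : EvenMetric n
  contracted = record
    { gap      = gap′
    ; side     = λ v → side v xor U v
    ; diagonal = λ a → ≡-trans (cong (ℕ._⊓ (g a ℕ.+ g a)) (diagonal a)) refl
    ; gap-sym  = gap′-sym
    ; triangle = gap′-triangle
    ; odd-gap  = odd-gap′
    }

  separated : ∀ a b → (if U a xor U b then 1 else 0) ℕ.+ gap′ a b ℕ.≤ gap a b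
  separated a b with near-or-far a | near-or-far b
  ... | inj₁ na | inj₁ nb rewrite U-near na | U-near nb = ℕ.m⊓n≤m _ _
  ... | inj₂ fa | inj₂ fb rewrite U-far fa | U-far fb = ℕ.m⊓n≤m _ _
  ... | inj₁ na | inj₂ fb rewrite U-near na | U-far fb | near-gap′ na b | near-gap na b =
    ℕ.≤-reflexive (suc-g fb)
  ... | inj₂ fa | inj₁ nb rewrite U-far fa | U-near nb | gap′-sym a b | near-gap′ nb a | gap-sym a b | near-gap nb a =
    ℕ.≤-reflexive (suc-g fa)

-- Integral cut packings by repeated contraction

crossings : List (Fin n → Bool) → Fin n → Fin n → ℕ
crossings Z a b = total (λ S → if S a xor S b then 1 else 0) Z

record CutPacking (D : EvenMetric n) (c : ℕ) : Set where
  constructor cutPacking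
  field
    cuts   : List (Fin n → Bool)
    size   : length cuts ≡ c
    proper : All (λ S → ∃₂ λ a b → S a xor S b ≡ true) cuts
    packs  : ∀ a b → crossings cuts a b ℕ.≤ EvenMetric.gap D a b

total-0 : ∀ (f : A → ℕ) xs → (∀ x → f x ≡ 0) → total f xs ≡ 0
total-0 f []       f0 = refl
total-0 f (x ∷ xs) f0 = cong₂ ℕ._+_ (f0 x) (total-0 f xs f0)

-- Induction on c: the contraction lowers a minimum join by at most one unit, and the cut `U` uses
-- the unit gained on the gaps it crosses. The hypothesis is only a lower bound on joins, so it
-- passes to the contracted metric without reference to a minimum join there.
packCuts : ∀ c (D : EvenMetric n) → Fin n → ∀ L → (∀ K → ∂ K ≗ ∂ L → c ℕ.≤ EvenMetric.len D K) →
           CutPacking D c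
packCuts zero    D x₀ L L-min = cutPacking [] refl [] (λ _ _ → ℕ.z≤n)
packCuts {n} (suc c) D x₀ L bound
  with M , _ , _ , ∂M , M-min ← minimumMatching D L = cutPacking (U ∷ cuts) (cong suc size)
    (U-proper ∷ proper)
    (λ a b → ℕ.≤-trans (ℕ.+-monoʳ-≤ (if U a xor U b then 1 else 0) (packs a b)) (separated a b))
  where
  open EvenMetric D using (len; gap)

  join : Fin n → List (Edge n)
  join x = proj₁ (minimumMatching D ((x₀ , x) ∷ M))

  u : Fin n
  u = argmin (len ∘ join) x₀ (allFin n)

  ∂-join : ∀ x → ∂ (join x) ≗ ∂ ((x₀ , x) ∷ M)
  ∂-join x = proj₁ (proj₂ (proj₂ (proj₂ (minimumMatching D ((x₀ , x) ∷ M)))))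

  join-min : ∀ x K → ∂ K ≗ ∂ ((x₀ , x) ∷ M) → len (join u) ℕ.≤ len K
  join-min x K ∂K = ℕ.≤-trans
    (All.lookup (f[argmin]≤f[xs] {f = len ∘ join} x₀ (allFin n)) (∈-allFin x))
    (proj₂ (proj₂ (proj₂ (proj₂ (minimumMatching D ((x₀ , x) ∷ M))))) K
      λ v → ≡-trans (∂K v) (sym (∂-join x v)))

  open Contraction D M M-min x₀ u (join u) (∂-join u) join-min

  open CutPacking (packCuts c contracted x₀ M λ K ∂K →
    ℕ.s≤s⁻¹ (ℕ.≤-trans (bound M ∂M) (contractedBound K ∂K)))

  U-proper : ∃₂ λ a b → U a xor U b ≡ true
  U-proper with any? (λ v → 1 ℕ.≤? q v)
  ... | yes (v , far) = u , v , cong₂ _xor_ (U-near (EvenMetric.diagonal D u)) (U-far far)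
  -- If all points were at distance 0 from u, all gaps would vanish and M would have length 0,
  -- against the bound `suc c`.
  ... | no  none = ⊥-elim (ℕ.<⇒≱ (bound M ∂M) (ℕ.≤-trans (ℕ.≤-reflexive
      (total-0 _ M λ (a , b) → ≡-trans (near-gap (near a) b) (near b))) ℕ.z≤n))
    where
    near : ∀ v → q v ≡ 0
    near v with near-or-far v
    ... | inj₁ q≡0 = q≡0
    ... | inj₂ far = ⊥-elim (none (v , far))

-- Finite sums and natural multiples of rationals

infix 7 _when_

_when_ : ℚ → Bool → ℚ
q when b = if b then q else 0ℚ

when-≥0 : ∀ {q} b → 0ℚ ≤ q → 0ℚ ≤ q when b
when-≥0 true  0≤q = 0≤q
when-≥0 false 0≤q = ℚ.≤-refl

sum-cong-∈ : ∀ {f g : A → ℚ} xs → (∀ {x} → x ∈ₗ xs → f x ≡ g x) → sum f xs ≡ sum g xs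
sum-cong-∈ []       eq = refl
sum-cong-∈ (x ∷ xs) eq = cong₂ _+_ (eq (here refl)) (sum-cong-∈ xs (eq ∘ there))

sum-mono-∈ : ∀ {f g : A → ℚ} xs → (∀ {x} → x ∈ₗ xs → f x ≤ g x) → sum f xs ≤ sum g xs
sum-mono-∈ []       le = ℚ.≤-refl
sum-mono-∈ (x ∷ xs) le = ℚ.+-mono-≤ (le (here refl)) (sum-mono-∈ xs (le ∘ there))

sum-0 : ∀ (f : A → ℚ) xs → (∀ {x} → x ∈ₗ xs → f x ≡ 0ℚ) → sum f xs ≡ 0ℚ
sum-0 f []       eq = refl
sum-0 f (x ∷ xs) eq = ≡-trans (cong₂ _+_ (eq (here refl)) (sum-0 f xs (eq ∘ there))) (ℚ.+-identityˡ 0ℚ)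

sum-≥0 : ∀ {f : A → ℚ} xs → (∀ {x} → x ∈ₗ xs → 0ℚ ≤ f x) → 0ℚ ≤ sum f xs
sum-≥0 []       le = ℚ.≤-refl
sum-≥0 (x ∷ xs) le = ℚ.+-mono-≤ (le (here refl)) (sum-≥0 xs (le ∘ there))

sum-+ : ∀ (f g : A → ℚ) xs → sum (λ x → f x + g x) xs ≡ sum f xs + sum g xs
sum-+ f g []       = refl
sum-+ f g (x ∷ xs) = ≡-trans (cong (f x + g x +_) (sum-+ f g xs)) (interchange (f x) (g x) _ _)

sum-++ : ∀ (f : A → ℚ) xs ys → sum f (xs ++ ys) ≡ sum f xs + sum f ys
sum-++ f []       ys = sym (ℚ.+-identityˡ _)
sum-++ f (x ∷ xs) ys = ≡-trans (cong (f x +_) (sum-++ f xs ys)) (sym (ℚ.+-assoc (f x) _ _))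

sum-swap : ∀ (f : A → B → ℚ) xs ys →
           sum (λ x → sum (f x) ys) xs ≡ sum (λ y → sum (flip f y) xs) ys
sum-swap f []       ys = sym (sum-0 _ ys (λ _ → refl))
sum-swap f (x ∷ xs) ys = ≡-trans (cong (sum (f x) ys +_) (sum-swap f xs ys))
                                 (sym (sum-+ (f x) _ ys))

sum-↭ : ∀ (f : A → ℚ) {xs ys} → xs ↭ ys → sum f xs ≡ sum f ys
sum-↭ f refl              = refl
sum-↭ f (prep x p)        = cong (f x +_) (sum-↭ f p)
sum-↭ f (swap {xs} x y p) = ≡-trans (x∙yz≈y∙xz (f x) (f y) (sum f xs))
                                    (cong (λ z → f y + (f x + z)) (sum-↭ f p))
sum-↭ f (trans p q)       = ≡-trans (sum-↭ f p) (sum-↭ f q)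

sum-filter : ∀ {P : A → Set} (P? : ∀ x → Dec (P x)) (f : A → ℚ) xs →
             sum f (filter P? xs) ≡ sum (λ x → f x when does (P? x)) xs
sum-filter P? f []       = refl
sum-filter P? f (x ∷ xs) with does (P? x)
... | true  = cong (f x +_) (sum-filter P? f xs)
... | false = ≡-trans (sum-filter P? f xs) (sym (ℚ.+-identityˡ _))

sum-const : ∀ c (xs : List A) → sum (λ _ → c) xs ≡ length xs ⋆ c
sum-const c []       = refl
sum-const c (x ∷ xs) = cong (c +_) (sum-const c xs)

-- It compares enumerations that agree up to terms without positive value: the tree has edges of
-- weight 0 for sets outside the support, and `𝒜` contains sets that have no edge in the tree.
sum-⊆-≤ : ∀ {f : A → ℚ} {xs ys} → Unique xs → (∀ {y} → y ∈ₗ ys → 0ℚ ≤ f y) →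
          (∀ {x} → x ∈ₗ xs → f x ≤ 0ℚ ⊎ x ∈ₗ ys) → sum f xs ≤ sum f ys
sum-⊆-≤ {xs = []} {ys} [] f≥0 xs⊆ys = sum-≥0 ys f≥0
sum-⊆-≤ {f = f} {xs = x ∷ xs} {ys} (x≢ ∷ u) f≥0 xs⊆ys with xs⊆ys (here refl)
... | inj₁ fx≤0 = begin
  f x + sum f xs   ≤⟨ ℚ.+-mono-≤ fx≤0 (sum-⊆-≤ u f≥0 (xs⊆ys ∘ there)) ⟩
  0ℚ + sum f ys    ≡⟨ ℚ.+-identityˡ _ ⟩
  sum f ys         ∎
  where open ℚ.≤-Reasoning
... | inj₂ x∈ with ys′ , ys↭ ← ∈⇒↭ x∈ = begin
  f x + sum f xs   ≤⟨ ℚ.+-monoʳ-≤ (f x) (sum-⊆-≤ u (λ y∈ → f≥0 (∈-resp-↭ (↭-sym ys↭) (there y∈))) xs⊆ys′) ⟩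
  f x + sum f ys′  ≡⟨ sum-↭ f ys↭ ⟨
  sum f ys         ∎
  where
  open ℚ.≤-Reasoning
  xs⊆ys′ : ∀ {z} → z ∈ₗ xs → f z ≤ 0ℚ ⊎ z ∈ₗ ys′
  xs⊆ys′ z∈ with xs⊆ys (there z∈)
  ... | inj₁ fz≤0 = inj₁ fz≤0
  ... | inj₂ z∈ys with ∈-resp-↭ ys↭ z∈ys
  ...   | here refl = ⊥-elim (All.All¬⇒¬Any x≢ z∈)
  ...   | there z∈′ = inj₂ z∈′

⋆-mono-≤ : ∀ n {p q} → p ≤ q → n ⋆ p ≤ n ⋆ q
⋆-mono-≤ zero    p≤q = ℚ.≤-refl
⋆-mono-≤ (suc n) p≤q = ℚ.+-mono-≤ p≤q (⋆-mono-≤ n p≤q)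

⋆-≥0 : ∀ n {q} → 0ℚ ≤ q → 0ℚ ≤ n ⋆ q
⋆-≥0 zero    0≤q = ℚ.≤-refl
⋆-≥0 (suc n) 0≤q = ℚ.+-mono-≤ 0≤q (⋆-≥0 n 0≤q)

⋆-monoˡ-≤ : ∀ {m n q} → 0ℚ ≤ q → m ℕ.≤ n → m ⋆ q ≤ n ⋆ q
⋆-monoˡ-≤ {n = n} 0≤q ℕ.z≤n       = ⋆-≥0 n 0≤q
⋆-monoˡ-≤ {q = q} 0≤q (ℕ.s≤s m≤n) = ℚ.+-monoʳ-≤ q (⋆-monoˡ-≤ 0≤q m≤n)

⋆-monoˡ-< : ∀ {m n q} → 0ℚ ℚ.< q → m ℕ.< n → m ⋆ q ℚ.< n ⋆ q
⋆-monoˡ-< {m} {suc n} {q} 0<q (ℕ.s≤s m≤n) = begin-strict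
  m ⋆ q         ≡⟨ ℚ.+-identityˡ _ ⟨
  0ℚ + m ⋆ q    <⟨ ℚ.+-mono-<-≤ 0<q (⋆-monoˡ-≤ (ℚ.<⇒≤ 0<q) m≤n) ⟩
  q + n ⋆ q     ∎
  where open ℚ.≤-Reasoning

⋆-cancel-≤ : ∀ {m n q} → 0ℚ ℚ.< q → m ⋆ q ≤ n ⋆ q → m ℕ.≤ n
⋆-cancel-≤ {m} {n} 0<q mq≤nq = ℕ.≮⇒≥ λ n<m → ℚ.<-irrefl refl (ℚ.<-≤-trans (⋆-monoˡ-< {n} {m} 0<q n<m) mq≤nq)

⋆-cancel-≡ : ∀ {m n q} → 0ℚ ℚ.< q → m ⋆ q ≡ n ⋆ q → m ≡ n
⋆-cancel-≡ 0<q eq = ℕ.≤-antisym (⋆-cancel-≤ 0<q (ℚ.≤-reflexive eq))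
                                (⋆-cancel-≤ 0<q (ℚ.≤-reflexive (sym eq)))

sum-total : ∀ (f : A → ℕ) w xs → sum (λ x → f x ⋆ w) xs ≡ total f xs ⋆ w
sum-total f w []       = refl
sum-total f w (x ∷ xs) = ≡-trans (cong (f x ⋆ w +_) (sum-total f w xs))
                                 (sym (×-homo-+ w (f x) (total f xs)))

⋆-* : ∀ n p q → n ⋆ (p * q) ≡ (n ⋆ p) * q
⋆-* zero    p q = sym (ℚ.*-zeroˡ q)
⋆-* (suc n) p q = ≡-trans (cong (p * q +_) (⋆-* n p q)) (sym (ℚ.*-distribʳ-+ q p (n ⋆ p)))

⋆-*′ : ∀ n p q → n ⋆ (p * q) ≡ p * (n ⋆ q)
⋆-*′ n p q = ≡-trans (cong (n ⋆_) (ℚ.*-comm p q)) (≡-trans (⋆-* n q p) (ℚ.*-comm (n ⋆ q) p))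

-- Common denominators

ι : ℕ → ℚ
ι n = ℚ.mkℚ (ℤ.+ n) 0 (Coprime.sym (Coprime.1-coprimeTo n))

⋆-1 : ∀ n → n ⋆ 1ℚ ≡ ι n
⋆-1 zero    = refl
⋆-1 (suc n) = ≡-trans (cong (1ℚ +_) (⋆-1 n)) (ℚ.toℚᵘ-injective
  (ℚᵘ.≃-trans (ℚ.toℚᵘ-homo-+ 1ℚ (ι n)) (ℚᵘ.*≡*
    (cong (λ z → (ℤ.+ 1 ℤ.+ z) ℤ.* ℤ.+ 1) (ℤ.*-identityʳ (ℤ.+ n))))))

-- So w is 1/N. Stated with `⋆`, refining a unit becomes a computation with natural multiples.
IsUnit : ℚ → Set
IsUnit w = ∃ λ N → N ⋆ w ≡ 1ℚ

unit-pos : ∀ {w} → IsUnit w → 0ℚ ℚ.< w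
unit-pos {w} (N , eq) = ℚ.≰⇒> λ w≤0 → ℚ.<-irrefl refl (begin-strict
  0ℚ        <⟨ ℚ.positive⁻¹ 1ℚ ⟩
  1ℚ        ≡⟨ eq ⟨
  N ⋆ w     ≤⟨ ⋆-mono-≤ N w≤0 ⟩
  N ⋆ 0ℚ    ≡⟨ ⋆-zeroʳ N ⟩
  0ℚ        ∎)
  where
  open ℚ.≤-Reasoning
  ⋆-zeroʳ : ∀ N → N ⋆ 0ℚ ≡ 0ℚ
  ⋆-zeroʳ zero    = refl
  ⋆-zeroʳ (suc N) = ≡-trans (ℚ.+-identityˡ _) (⋆-zeroʳ N)

fraction : ∀ q → 0ℚ ≤ q → ∃ λ r → IsUnit r × ∃ λ p → q ≡ p ⋆ r
fraction q@(ℚ.mkℚ (ℤ.+ p) D-1 _) _ = r , (suc D-1 , D⋆r) , p , q≡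
  where
  D = suc D-1
  r = ℚ.1/ ι D
  D⋆r : D ⋆ r ≡ 1ℚ
  D⋆r = begin
    D ⋆ r          ≡⟨ cong (D ⋆_) (ℚ.*-identityˡ r) ⟨
    D ⋆ (1ℚ * r)   ≡⟨ ⋆-* D 1ℚ r ⟩
    (D ⋆ 1ℚ) * r   ≡⟨ cong (_* r) (⋆-1 D) ⟩
    ι D * r        ≡⟨ ℚ.*-inverseʳ (ι D) ⟩
    1ℚ             ∎
    where open ≡-Reasoning
  qD : q * ι D ≡ ι p
  qD = ℚ.toℚᵘ-injective (ℚᵘ.≃-trans (ℚ.toℚᵘ-homo-* q (ι D)) (ℚᵘ.*≡* (ℤ.*-assoc (ℤ.+ p) (ℤ.+ D) (ℤ.+ 1))))
  q≡ : q ≡ p ⋆ r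
  q≡ = begin
    q                  ≡⟨ ℚ.*-identityʳ q ⟨
    q * 1ℚ             ≡⟨ cong (q *_) (ℚ.*-inverseʳ (ι D)) ⟨
    q * (ι D * r)      ≡⟨ ℚ.*-assoc q (ι D) r ⟨
    q * ι D * r        ≡⟨ cong (_* r) (≡-trans qD (sym (⋆-1 p))) ⟩
    (p ⋆ 1ℚ) * r       ≡⟨ ⋆-* p 1ℚ r ⟨
    p ⋆ (1ℚ * r)       ≡⟨ cong (p ⋆_) (ℚ.*-identityˡ r) ⟩
    p ⋆ r              ∎
    where open ≡-Reasoning
fraction (ℚ.mkℚ ℤ.-[1+ _ ] _ _) (ℚ.*≤* ())

_MultipleOf_ : ℚ → ℚ → Set
q MultipleOf w = ∃ λ m → q ≡ m ⋆ w

-- The product of the unit found for the tail and the unit of the head works: as D copies of r and N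
-- copies of w each make 1, both w and r are natural multiples of `w * r`.
commonUnit : ∀ {qs} → All (0ℚ ≤_) qs → ∃ λ w → IsUnit w × All (_MultipleOf w) qs
commonUnit []          = 1ℚ , (1 , ℚ.+-identityʳ 1ℚ) , []
commonUnit (0≤q ∷ 0≤qs)
  with w , (N , N⋆w) , ms ← commonUnit 0≤qs
  with r , (D , D⋆r) , p , refl ← fraction _ 0≤q =
  w * r , (N ℕ.* D , unit) , (p ℕ.* N , p⋆r) ∷ All.map refine ms
  where
  open ≡-Reasoning
  w≡ : w ≡ D ⋆ (w * r)
  w≡ = begin
    w              ≡⟨ ℚ.*-identityʳ w ⟨
    w * 1ℚ         ≡⟨ cong (w *_) D⋆r ⟨
    w * (D ⋆ r)    ≡⟨ ⋆-*′ D w r ⟨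
    D ⋆ (w * r)    ∎
  unit : (N ℕ.* D) ⋆ (w * r) ≡ 1ℚ
  unit = begin
    (N ℕ.* D) ⋆ (w * r)    ≡⟨ ×-assocˡ (w * r) N D ⟨
    N ⋆ (D ⋆ (w * r))      ≡⟨ cong (N ⋆_) w≡ ⟨
    N ⋆ w                  ≡⟨ N⋆w ⟩
    1ℚ                     ∎
  p⋆r : p ⋆ r ≡ (p ℕ.* N) ⋆ (w * r)
  p⋆r = begin
    p ⋆ r                  ≡⟨ cong (p ⋆_) (ℚ.*-identityˡ r) ⟨
    p ⋆ (1ℚ * r)           ≡⟨ cong (λ z → p ⋆ (z * r)) N⋆w ⟨
    p ⋆ ((N ⋆ w) * r)      ≡⟨ cong (p ⋆_) (⋆-* N w r) ⟨
    p ⋆ (N ⋆ (w * r))      ≡⟨ ×-assocˡ (w * r) p N ⟩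
    (p ℕ.* N) ⋆ (w * r)    ∎
  refine : ∀ {q} → q MultipleOf w → q MultipleOf (w * r)
  refine (m , refl) = m ℕ.* D , ≡-trans (cong (m ⋆_) w≡) (×-assocˡ (w * r) m D)

-- Farthest-first traversal

minimum-≤ : ∀ {x xs} → x ∈ₗ xs → minimum xs ≤ x
minimum-≤ {xs = x ∷ xs} (here refl) = ℚ-Extrema.min≤⊤ x xs
minimum-≤ {xs = x ∷ xs} (there x∈)  = All.lookup (ℚ-Extrema.min≤xs x xs) x∈

minimum-∈ : ∀ {x xs} → x ∈ₗ xs → minimum xs ∈ₗ xs
minimum-∈ {xs = x ∷ xs} _ with ℚ-Extrema.argmin-sel id x xs
... | inj₁ eq = here eq
... | inj₂ ∈  = there ∈

firstArgmax-∈ : ∀ (f : A → ℚ) x xs → firstArgmax f x xs ∈ₗ x ∷ xs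
firstArgmax-∈ f x []       = here refl
firstArgmax-∈ f x (y ∷ ys) with does (f x ℚ.<? f y)
... | true  = there (firstArgmax-∈ f y ys)
... | false with firstArgmax-∈ f x ys
...   | here eq = here eq
...   | there ∈ = there (there ∈)

does-true : ∀ {P : Set} (P? : Dec P) → does P? ≡ true → P
does-true (yes p) _ = p

does-false : ∀ {P : Set} (P? : Dec P) → does P? ≡ false → ¬ P
does-false (no ¬p) _ = ¬p

firstArgmax-max : ∀ (f : A → ℚ) x xs {z} → z ∈ₗ x ∷ xs → f z ≤ f (firstArgmax f x xs)
firstArgmax-max f x []       (here refl) = ℚ.≤-refl
firstArgmax-max f x (y ∷ ys) z∈ with does (f x ℚ.<? f y) in x<y | z∈
... | true  | here refl         =
  ℚ.≤-trans (ℚ.<⇒≤ (does-true (f x ℚ.<? f y) x<y)) (firstArgmax-max f y ys (here refl))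
... | true  | there z∈′         = firstArgmax-max f y ys z∈′
... | false | here refl         = firstArgmax-max f x ys (here refl)
... | false | there (here refl) =
  ℚ.≤-trans (ℚ.≮⇒≥ (does-false (f x ℚ.<? f y) x<y)) (firstArgmax-max f x ys (here refl))
... | false | there (there z∈′) = firstArgmax-max f x ys (there z∈′)

x∈p─q⇒x∉q : ∀ (p q : Subset n) {x} → x ∈ p ─ q → x ∉ q
x∈p─q⇒x∉q (_ ∷ p) (_ ∷ q) (there x∈) (there x∈q) = x∈p─q⇒x∉q p q x∈ x∈q

∣p∪⁅x⁆∣ : ∀ {p : Subset n} {x} → x ∉ p → ∣ p ∪ ⁅ x ⁆ ∣ ≡ suc ∣ p ∣
∣p∪⁅x⁆∣ {p = p} {x} x∉p = ≡-trans (sym (length-unique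
  (All.¬Any⇒All¬ _ (x∉p ∘ ∈-elements⁻) ∷ elements-unique p)
  (λ { (here refl) → x∈p∪q⁺ (inj₂ (x∈⁅x⁆ x)) ; (there v∈) → x∈p∪q⁺ (inj₁ (∈-elements⁻ v∈)) })
  (λ v∈ → [ there ∘ ∈-elements⁺ , here ∘ x∈⁅y⁆⇒x≡y x ]′ (x∈p∪q⁻ p ⁅ x ⁆ v∈))))
  (cong suc (length-elements p))

module Traversal {n} (d : DistanceFunction (Fin n)) (metric : IsMetric _≡_ d) where
  open IsMetric metric using (nonNegative; ≈⇒0; 0⇒≈) renaming (sym to d-sym)

  dist-≤ : ∀ v {c} {C : Subset n} → c ∈ C → dist d v C ≤ d v c
  dist-≤ v c∈ = minimum-≤ (∈-map⁺ (d v) (∈-elements⁺ c∈))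

  nearest : ∀ v {C : Subset n} → Nonempty C → ∃ λ c → c ∈ C × dist d v C ≡ d v c
  nearest v (c , c∈) with c′ , c′∈ , eq ← ∈-map⁻ (d v) (minimum-∈ (∈-map⁺ (d v) (∈-elements⁺ c∈))) =
    c′ , ∈-elements⁻ c′∈ , eq

  -- The covering radius is at most the least distance between two centres, stated without naming
  -- either quantity. This is the invariant of the traversal.
  IsNet : Subset n → Set
  IsNet C = ∀ v {a b} → a ∈ C → b ∈ C → a ≢ b → dist d v C ≤ d a b

  Farthest : Subset n → Fin n → Set
  Farthest C c = ∀ {v} → v ∉ C → dist d v C ≤ dist d c C

  data Added (C : Subset n) : Subset n → Set where
    added : ∀ c → c ∉ C → Farthest C c → Added C (C ∪ ⁅ c ⁆)

  dist-shrinks : ∀ v {C a} c → a ∈ C → dist d v (C ∪ ⁅ c ⁆) ≤ dist d v C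
  dist-shrinks v {C} c a∈C with x , x∈ , eq ← nearest v (_ , a∈C) =
    subst (dist d v (C ∪ ⁅ c ⁆) ≤_) (sym eq) (dist-≤ v (p⊆p∪q ⁅ c ⁆ x∈))

  -- As c is the farthest point, every point outside C is already within `dist d c C` of C, and this
  -- is at most the distance from c to any old centre. Points of C are at distance 0.
  farthest-far : ∀ v {C c a} → Farthest C c → a ∈ C → dist d v (C ∪ ⁅ c ⁆) ≤ d c a
  farthest-far v {C} {c} farthest a∈C with v ∈? C
  ... | yes v∈ = ℚ.≤-trans (ℚ.≤-trans (dist-≤ v (p⊆p∪q ⁅ c ⁆ v∈)) (ℚ.≤-reflexive (≈⇒0 refl))) nonNegative
  ... | no  v∉ = ℚ.≤-trans (dist-shrinks v c a∈C) (ℚ.≤-trans (farthest v∉) (dist-≤ c a∈C))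

  addFarthest-added : ∀ C → ∣ C ∣ ℕ.< n → Added C (addFarthest d ⊤ C)
  addFarthest-added C C<n with elements (⊤ ─ C) in eq
  ... | [] = ⊥-elim (ℕ.<⇒≱ C<n (ℕ.≤-trans (ℕ.≤-reflexive (sym (∣⊤∣≡n n))) (p⊆q⇒∣p∣≤∣q∣ full)))
    where
    full : ⊤ ⊆ C
    full {v} _ with v ∈? C
    ... | yes v∈ = v∈
    ... | no  v∉ with () ← subst (v ∈ₗ_) eq (∈-elements⁺ (x∈p∧x∉q⇒x∈p─q ∈⊤ v∉))
  ... | v ∷ vs = added c
    (x∈p─q⇒x∉q ⊤ C (∈-elements⁻ (subst (c ∈ₗ_) (sym eq) (firstArgmax-∈ f v vs))))
    (λ {u} u∉ → firstArgmax-max f v vs (subst (u ∈ₗ_) eq (∈-elements⁺ (x∈p∧x∉q⇒x∈p─q ∈⊤ u∉))))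
    where
    f = λ u → dist d u C
    c = firstArgmax f v vs

  added-net : ∀ {C C′} → Added C C′ → IsNet C → IsNet C′
  added-net {C} (added c c∉ farthest) net v {a} {b} a∈ b∈ a≢b
    with x∈p∪q⁻ C ⁅ c ⁆ a∈ | x∈p∪q⁻ C ⁅ c ⁆ b∈
  ... | inj₁ a∈C | inj₁ b∈C = ℚ.≤-trans (dist-shrinks v c a∈C) (net v a∈C b∈C a≢b)
  ... | inj₁ a∈C | inj₂ b∈c rewrite x∈⁅y⁆⇒x≡y c b∈c | d-sym a c = farthest-far v farthest a∈C
  ... | inj₂ a∈c | inj₁ b∈C rewrite x∈⁅y⁆⇒x≡y c a∈c = farthest-far v farthest b∈C
  ... | inj₂ a∈c | inj₂ b∈c = ⊥-elim (a≢b (≡-trans (x∈⁅y⁆⇒x≡y c a∈c) (sym (x∈⁅y⁆⇒x≡y c b∈c))))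

  traversal : ∀ ℓ → ℓ ℕ.≤ n → ∣ farthestFirst d ⊤ ℓ ∣ ≡ ℓ × IsNet (farthestFirst d ⊤ ℓ)
  traversal zero    _   = ∣⊥∣≡0 n , λ _ a∈ → ⊥-elim (∉⊥ a∈)
  traversal (suc ℓ) ℓ<n with size , net ← traversal ℓ (ℕ.<⇒≤ ℓ<n) =
    add (addFarthest-added _ (subst (ℕ._< n) (sym size) ℓ<n))
    where
    add : ∀ {C′} → Added (farthestFirst d ⊤ ℓ) C′ → ∣ C′ ∣ ≡ suc ℓ × IsNet C′
    add step@(added c c∉ _) = ≡-trans (∣p∪⁅x⁆∣ c∉) (cong suc size) , added-net step net

  record Net (C : Subset n) : Set where
    field
      ρ          : ℚ
      ρ≥0        : 0ℚ ≤ ρ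
      π          : Fin n → Fin n
      π∈C        : ∀ v → π v ∈ C
      fixed      : ∀ {c} → c ∈ C → π c ≡ c
      close      : ∀ v → d v (π v) ≤ ρ
      dispersed  : ∀ {a b} → a ∈ C → b ∈ C → a ≢ b → ρ ≤ d a b

  isNet⇒Net : ∀ {C} → Nonempty C → IsNet C → Net C
  isNet⇒Net {C} (c , c∈) net = record
    { ρ = radius w
    ; ρ≥0 = subst (0ℚ ≤_) (sym (proj₂ (proj₂ (near w)))) nonNegative
    ; π = λ v → proj₁ (near v)
    ; π∈C = λ v → proj₁ (proj₂ (near v))
    -- A centre is itself a candidate at distance 0, so its nearest centre is at distance 0 and
    -- therefore equal to it.
    ; fixed = λ {c} c∈ → let _ , _ , eq = near c in
        sym (0⇒≈ (ℚ.≤-antisym (subst (_≤ 0ℚ) eq (ℚ.≤-trans (dist-≤ c c∈) (ℚ.≤-reflexive (≈⇒0 refl))))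
                              nonNegative))
    ; close = λ v → subst (_≤ radius w) (proj₂ (proj₂ (near v)))
                      (firstArgmax-max radius c (allFin n) (there (∈-allFin v)))
    ; dispersed = net w
    }
    where
    radius : Fin n → ℚ
    radius v = dist d v C
    w = firstArgmax radius c (allFin n)
    near : ∀ v → ∃ λ c → c ∈ C × dist d v C ≡ d v c
    near v = nearest v (c , c∈)

-- Packings from lists of cuts

_≟ₛ_ : (X Y : Subset n) → Dec (X ≡ Y)
_≟ₛ_ = Vec.≡-dec Bool._≟_

∣ends∩∣ : ∀ {a b} {X : Subset n} → a ≢ b →
          ∣ ends (a , b) ∩ X ∣ ≡ length (filter (_∈? X) (a ∷ b ∷ []))
∣ends∩∣ {a = a} {b} {X} a≢b = sym (length-unique
  (Unique.filter⁺ (_∈? X) ((a≢b ∷ []) ∷ [] ∷ []))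
  (λ v∈ → to (∈-filter⁻ (_∈? X) {xs = a ∷ b ∷ []} v∈))
  (λ v∈ → from (x∈p∩q⁻ (ends (a , b)) X v∈)))
  where
  to : ∀ {v} → v ∈ₗ a ∷ b ∷ [] × v ∈ X → v ∈ ends (a , b) ∩ X
  to (here refl , v∈X)         = x∈p∩q⁺ (fst∈ends (a , b) , v∈X)
  to (there (here refl) , v∈X) = x∈p∩q⁺ (snd∈ends (a , b) , v∈X)
  from : ∀ {v} → v ∈ ends (a , b) × v ∈ X → v ∈ₗ filter (_∈? X) (a ∷ b ∷ [])
  from (v∈e , v∈X) with ∈-ends⁻ (a , b) v∈e
  ... | inj₁ refl = ∈-filter⁺ (_∈? X) {xs = a ∷ b ∷ []} (here refl) v∈X
  ... | inj₂ refl = ∈-filter⁺ (_∈? X) {xs = a ∷ b ∷ []} (there (here refl)) v∈X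

crosses-xor : ∀ {a b} {X : Subset n} → a ≢ b →
              (Crosses X (a , b) → lookup X a xor lookup X b ≡ true) ×
              (lookup X a xor lookup X b ≡ true → Crosses X (a , b))
crosses-xor {a = a} {b} {X} a≢b rewrite ∣ends∩∣ {X = X} a≢b with a ∈? X
crosses-xor {b = b} {X} _ | yes a∈ with b ∈? X
... | yes b∈ rewrite ∈⇒lookup a∈ | ∈⇒lookup b∈ = (λ ()) , (λ ())
... | no  b∉ rewrite ∈⇒lookup a∈ | ∉⇒lookup b∉ = (λ _ → refl) , (λ _ → refl)
crosses-xor {b = b} {X} _ | no a∉ with b ∈? X
... | yes b∈ rewrite ∉⇒lookup a∉ | ∈⇒lookup b∈ = (λ _ → refl) , (λ _ → refl)
... | no  b∉ rewrite ∉⇒lookup a∉ | ∉⇒lookup b∉ = (λ ()) , (λ ())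

allSubsets-unique : ∀ n → Unique (allSubsets n)
allSubsets-unique zero    = [] ∷ []
allSubsets-unique (suc n) = Unique.++⁺
  (Unique.map⁺ Vec.∷-injectiveʳ (allSubsets-unique n))
  (Unique.map⁺ Vec.∷-injectiveʳ (allSubsets-unique n))
  (λ (o∈ , i∈) → out≢in (∈-map⁻ (outside ∷_) o∈) (∈-map⁻ (inside ∷_) i∈))
  where
  out≢in : ∀ {X} → (∃ λ Y → Y ∈ₗ allSubsets n × X ≡ outside ∷ Y) →
           ¬ (∃ λ Y → Y ∈ₗ allSubsets n × X ≡ inside ∷ Y)
  out≢in (_ , _ , refl) (_ , _ , ())

∈-allSubsets : ∀ (X : Subset n) → X ∈ₗ allSubsets n
∈-allSubsets []            = here refl
∈-allSubsets (outside ∷ X) = ∈-++⁺ˡ (∈-map⁺ (outside ∷_) (∈-allSubsets X))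
∈-allSubsets {suc n} (inside ∷ X) =
  ∈-++⁺ʳ (map (outside ∷_) (allSubsets n)) (∈-map⁺ (inside ∷_) (∈-allSubsets X))

𝒜-unique : ∀ (X : Subset n) r → Unique (𝒜 X r)
𝒜-unique X r = Unique.filter⁺ (_∈𝒜?⟨ X , r ⟩) (allSubsets-unique _)

∈-𝒜⁺ : ∀ {X S : Subset n} {r} → S ∈𝒜⟨ X , r ⟩ → S ∈ₗ 𝒜 X r
∈-𝒜⁺ {X = X} {S} {r} = ∈-filter⁺ (_∈𝒜?⟨ X , r ⟩) (∈-allSubsets S)

∈-𝒜⁻ : ∀ {X S : Subset n} {r} → S ∈ₗ 𝒜 X r → S ∈𝒜⟨ X , r ⟩
∈-𝒜⁻ {n} {X} {r = r} S∈ = proj₂ (∈-filter⁻ (_∈𝒜?⟨ X , r ⟩) {xs = allSubsets n} S∈)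

module Point {w : ℚ} (0≤w : 0ℚ ≤ w) (Z : Subset n) where

  point : Subset n → ℚ
  point X = w when does (Z ≟ₛ X)

  point-≥0 : ∀ X → 0ℚ ≤ point X
  point-≥0 X = when-≥0 (does (Z ≟ₛ X)) 0≤w

  point-refl : point Z ≡ w
  point-refl = cong (w when_) (dec-true (Z ≟ₛ Z) refl)

  point-≢ : ∀ {X} → Z ≢ X → point X ≡ 0ℚ
  point-≢ {X} Z≢X = cong (w when_) (dec-false (Z ≟ₛ X) Z≢X)

  sum-point-≤ : ∀ {Xs} → Unique Xs → sum point Xs ≤ w
  sum-point-≤ u = ℚ.≤-trans (sum-⊆-≤ {ys = Z ∷ []} u (λ {X} _ → point-≥0 X) at)
    (ℚ.≤-reflexive (≡-trans (ℚ.+-identityʳ (point Z)) point-refl))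
    where
    at : ∀ {X} → X ∈ₗ _ → point X ≤ 0ℚ ⊎ X ∈ₗ Z ∷ []
    at {X} _ with Z ≟ₛ X
    ... | yes refl = inj₂ (here refl)
    ... | no  Z≢X  = inj₁ ℚ.≤-refl

  sum-point-∈ : ∀ {Xs} → Z ∈ₗ Xs → w ≤ sum point Xs
  sum-point-∈ Z∈ = ℚ.≤-trans
    (ℚ.≤-reflexive (sym (≡-trans (ℚ.+-identityʳ (point Z)) point-refl)))
    (sum-⊆-≤ {xs = Z ∷ []} ([] ∷ []) (λ {X} _ → point-≥0 X) λ { (here refl) → inj₂ Z∈ })

Proper : Subset n → (Fin n → Bool) → Set
Proper C S = ∃₂ λ a b → a ∈ C × b ∈ C × S a xor S b ≡ true

module FromCuts {n} (d : DistanceFunction (Fin n)) (C : Subset n) (r : Fin n)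
  {w : ℚ} (0≤w : 0ℚ ≤ w) (cuts : List (Fin n → Bool)) (proper : All (Proper C) cuts)
  (packs : ∀ {a b} → a ∈ C → b ∈ C → a ≢ b → crossings cuts a b ⋆ w ≤ d a b)
  (r∈C : r ∈ C)
  where

  -- The side of the cut S of C that does not contain the root.
  side : (Fin n → Bool) → Subset n
  side S = tabulate λ v → lookup C v ∧ (S v xor S r)

  lookup-side : ∀ S {v} → v ∈ C → lookup (side S) v ≡ S v xor S r
  lookup-side S {v} v∈ = ≡-trans (lookup∘tabulate _ v) (cong (_∧ (S v xor S r)) (∈⇒lookup v∈))

  side-∈ : ∀ {S v} → v ∈ C → S v xor S r ≡ true → v ∈ side S
  side-∈ {S} v∈ differs = lookup⇒∈ (≡-trans (lookup-side S v∈) differs)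

  side-∈𝒜 : ∀ {S} → Proper C S → side S ∈𝒜⟨ C , r ⟩
  side-∈𝒜 {S} (a , b , a∈ , b∈ , Sab) = nonempty , λ {v} v∈ → inside-C v (∈-tabulate⁻ v∈)
    where
    nonempty : Nonempty (side S)
    nonempty with S a xor S r in Sar | S b xor S r in Sbr
    ... | true  | _     = a , side-∈ {S} a∈ Sar
    ... | false | true  = b , side-∈ {S} b∈ Sbr
    ... | false | false = ⊥-elim (true≢false (≡-trans (sym Sab)
      (≡-trans (sym (xor-cancelʳ (S a) (S b) (S r))) (cong₂ _xor_ Sar Sbr))))
    inside-C : ∀ v → lookup C v ∧ (S v xor S r) ≡ true → v ∈ C - r
    inside-C v eq with lookup C v in v∈C
    ... | true = x∈p∧x≢y⇒x∈p-y (lookup⇒∈ v∈C) λ { refl → true≢false (≡-trans (sym eq) (xor-same (S v))) }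

  -- Several cuts of the list may have the same side, so their weights are added up.
  z : Weights n
  z X = sum (λ S → Point.point 0≤w (side S) X) cuts

  z-packing : IsPacking d C r z
  z-packing = record { nonNegative = λ X _ → sum-≥0 cuts λ {S} _ → Point.point-≥0 0≤w (side S) X
                     ; feasible    = feasible }
    where
    feasible : ∀ e → e ∈ₗ E C → sum z (filter (λ X → crosses? X e) (𝒜 C r)) ≤ uncurry d e
    feasible e@(a , b) e∈ with a∈ , b∈ , a<b ← ∈-E⁻ {X = C} e∈ = begin
      sum z Xs
        ≡⟨ sum-swap (λ X S → Point.point 0≤w (side S) X) Xs cuts ⟩
      sum (λ S → sum (Point.point 0≤w (side S)) Xs) cuts
        ≤⟨ sum-mono-∈ cuts (λ {S} _ → each S) ⟩
      sum (λ S → (if S a xor S b then 1 else 0) ⋆ w) cuts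
        ≡⟨ sum-total _ w cuts ⟩
      crossings cuts a b ⋆ w
        ≤⟨ packs a∈ b∈ (<⇒≢ a<b) ⟩
      d a b ∎
      where
      open ℚ.≤-Reasoning
      Xs = filter (λ X → crosses? X e) (𝒜 C r)
      side-xor : ∀ S → lookup (side S) a xor lookup (side S) b ≡ S a xor S b
      side-xor S rewrite lookup-side S a∈ | lookup-side S b∈ = xor-cancelʳ (S a) (S b) (S r)
      each : ∀ S → sum (Point.point 0≤w (side S)) Xs ≤ (if S a xor S b then 1 else 0) ⋆ w
      each S with S a xor S b in Sab
      ... | true  = ℚ.≤-trans (Point.sum-point-≤ 0≤w (side S) (Unique.filter⁺ (λ X → crosses? X e) (𝒜-unique C r)))
                              (ℚ.≤-reflexive (sym (ℚ.+-identityʳ w)))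
      ... | false = ℚ.≤-reflexive (sum-0 _ Xs λ {X} X∈ → Point.point-≢ 0≤w (side S) λ { refl →
        true≢false (≡-trans (sym (proj₁ (crosses-xor (<⇒≢ a<b))
          (proj₂ (∈-filter⁻ (λ X → crosses? X e) {xs = 𝒜 C r} X∈)))) (≡-trans (side-xor S) Sab)) })

  cuts-≤ : ∀ {y} → IsOptimalPacking d C r y → length cuts ⋆ w ≤ sum y (𝒜 C r)
  cuts-≤ {y} optimal = begin
    length cuts ⋆ w
      ≡⟨ sum-const w cuts ⟨
    sum (λ _ → w) cuts
      ≤⟨ sum-mono-∈ cuts (λ {S} S∈ → Point.sum-point-∈ 0≤w (side S) (∈-𝒜⁺ (side-∈𝒜 {S} (All.lookup proper S∈)))) ⟩
    sum (λ S → sum (Point.point 0≤w (side S)) (𝒜 C r)) cuts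
      ≡⟨ sum-swap (λ X S → Point.point 0≤w (side S) X) (𝒜 C r) cuts ⟨
    sum z (𝒜 C r)
      ≤⟨ IsOptimalPacking.maximal optimal z z-packing ⟩
    sum y (𝒜 C r) ∎
    where open ℚ.≤-Reasoning

-- Sums over the edges of a tree

-- Whether an edge is counted may depend only on the multiset of leaves below it, since inclusion
-- trees and refinements leave the order of children open.
Symmetric : (List (Fin n) → Bool) → Set
Symmetric f = ∀ {xs ys} → xs ↭ ys → f xs ≡ f ys

term : (List (Fin n) → Bool) → ℚ × Tree n → ℚ
term f (w , t) = w when f (leaves t)

edgeSum : (List (Fin n) → Bool) → Tree n → ℚ
edgeSum f t = sum (term f) (edges t)

edgeSum* : (List (Fin n) → Bool) → List (ℚ × Tree n) → ℚ
edgeSum* f cs = sum (term f) (edges* cs)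

edges*-++ : ∀ (as bs : List (ℚ × Tree n)) → edges* (as ++ bs) ≡ edges* as ++ edges* bs
edges*-++ []             bs = refl
edges*-++ ((w , t) ∷ as) bs = cong ((w , t) ∷_)
  (≡-trans (cong (edges t ++_) (edges*-++ as bs)) (sym (++-assoc (edges t) (edges* as) (edges* bs))))

leaves*-++ : ∀ (as bs : List (ℚ × Tree n)) → leaves* (as ++ bs) ≡ leaves* as ++ leaves* bs
leaves*-++ []             bs = refl
leaves*-++ ((w , t) ∷ as) bs =
  ≡-trans (cong (leaves t ++_) (leaves*-++ as bs)) (sym (++-assoc (leaves t) (leaves* as) (leaves* bs)))

edges*-↭ : ∀ {as bs : List (ℚ × Tree n)} → as ↭ bs → edges* as ↭ edges* bs
edges*-↭ refl                    = ↭-refl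
edges*-↭ (prep (w , t) p)        = prep (w , t) (++⁺ˡ (edges t) (edges*-↭ p))
edges*-↭ (swap (v , s) (w , t) p) =
  ↭-trans (shifts ((v , s) ∷ edges s) ((w , t) ∷ edges t))
          (++⁺ˡ ((w , t) ∷ edges t) (++⁺ˡ ((v , s) ∷ edges s) (edges*-↭ p)))
edges*-↭ (trans p q)             = ↭-trans (edges*-↭ p) (edges*-↭ q)

leaves*-↭ : ∀ {as bs : List (ℚ × Tree n)} → as ↭ bs → leaves* as ↭ leaves* bs
leaves*-↭ refl                     = ↭-refl
leaves*-↭ (prep (w , t) p)         = ++⁺ˡ (leaves t) (leaves*-↭ p)
leaves*-↭ (swap (v , s) (w , t) p) =
  ↭-trans (shifts (leaves s) (leaves t)) (++⁺ˡ (leaves t) (++⁺ˡ (leaves s) (leaves*-↭ p)))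
leaves*-↭ (trans p q)              = ↭-trans (leaves*-↭ p) (leaves*-↭ q)

record Equivalent (t t′ : Tree n) : Set where
  constructor equivalent
  field
    leaves↭  : leaves t ↭ leaves t′
    edgeSum≡ : ∀ {f} → Symmetric f → edgeSum f t ≡ edgeSum f t′

-- A `group` step creates one edge, of weight 0, and moves the other edges together with the
-- subtrees below them. Above a refined subtree the leaves are merely permuted.
refinement-equivalent : ∀ {t t′ : Tree n} → t ⟶ t′ → Equivalent t t′
refinement-equivalent (group {cs} {as} {bs} cs↭ _ _) = equivalent
  (↭-trans (leaves*-↭ cs↭) (↭-reflexive (leaves*-++ as bs)))
  (λ {f} f-sym → begin
    edgeSum* f cs
      ≡⟨ sum-↭ (term f) (↭-trans (edges*-↭ cs↭) (↭-reflexive (edges*-++ as bs))) ⟩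
    sum (term f) (edges* as ++ edges* bs)
      ≡⟨ ℚ.+-identityˡ _ ⟨
    0ℚ + sum (term f) (edges* as ++ edges* bs)
      ≡⟨ cong (_+ sum (term f) (edges* as ++ edges* bs)) (0-when (f (leaves* as))) ⟨
    edgeSum f (node ((0ℚ , node as) ∷ bs)) ∎)
  where
  open ≡-Reasoning
  0-when : ∀ b → 0ℚ when b ≡ 0ℚ
  0-when true  = refl
  0-when false = refl
refinement-equivalent (below {ls} {rs} {w} {t} {t′} step) with refinement-equivalent step
... | equivalent leaves↭ edgeSum≡ = equivalent
  (↭-trans (↭-reflexive (leaves*-++ ls ((w , t) ∷ rs)))
    (↭-trans (++⁺ˡ (leaves* ls) (++⁺ʳ (leaves* rs) leaves↭))
             (↭-reflexive (sym (leaves*-++ ls ((w , t′) ∷ rs))))))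
  (λ {f} f-sym → ≡-trans (split f t) (≡-trans
    (cong (sum (term f) (edges* ls) +_) (cong₂ _+_ (cong (w when_) (f-sym leaves↭))
      (cong (_+ edgeSum* f rs) (edgeSum≡ f-sym))))
    (sym (split f t′))))
  where
  split : ∀ f t → edgeSum f (node (ls ++ (w , t) ∷ rs)) ≡
                  edgeSum* f ls + (term f (w , t) + (edgeSum f t + edgeSum* f rs))
  split f t = ≡-trans (cong (sum (term f)) (edges*-++ ls ((w , t) ∷ rs)))
    (≡-trans (sum-++ (term f) (edges* ls) _)
      (cong (λ z → edgeSum* f ls + (term f (w , t) + z)) (sum-++ (term f) (edges t) (edges* rs))))

refined-equivalent : ∀ {t t′ : Tree n} → Star _⟶_ t t′ → Equivalent t t′
refined-equivalent ε = equivalent ↭-refl (λ _ → refl)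
refined-equivalent (step ◅ steps)
  with equivalent l e ← refinement-equivalent step | equivalent l′ e′ ← refined-equivalent steps =
  equivalent (↭-trans l l′) (λ f-sym → ≡-trans (e f-sym) (e′ f-sym))

-- Parity of leaf counts and the weight of `J`

odd-double : ∀ q → odd (q ℕ.* 2) ≡ false
odd-double zero    = refl
odd-double (suc q) = cong (λ b → not (not b)) (odd-double q)

even-2∣ : ∀ m → odd m ≡ false → 2 ∣ m
even-2∣ zero          _  = divides 0 refl
even-2∣ (suc (suc m)) eq with divides q refl ← even-2∣ m (≡-trans (sym (not-involutive (odd m))) eq) =
  divides (suc q) refl

does-¬2∣ : ∀ m → does (¬? (2 ∣? m)) ≡ odd m
does-¬2∣ m with odd m in eq
... | false = cong not (dec-true (2 ∣? m) (even-2∣ m eq))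
... | true  = cong not (dec-false (2 ∣? m) λ { (divides q refl) →
                true≢false (≡-trans (sym eq) (odd-double q)) })

count-parity : ∀ (T : Subset n) xs → odd (length (filter (_∈? T) xs)) ≡ parity (lookup T) xs
count-parity T []       = refl
count-parity T (x ∷ xs) with x ∈? T
... | yes x∈ rewrite ∈⇒lookup x∈ = cong not (count-parity T xs)
... | no  x∉ rewrite ∉⇒lookup x∉ = count-parity T xs

weight-J : ∀ (t : Tree n) T → weight (J t T) ≡ edgeSum (parity (lookup T)) t
weight-J t T = ≡-trans (sum-filter odd? proj₁ (edges t))
  (sum-cong-∈ (edges t) λ {(w , s)} _ → cong (w when_)
    (≡-trans (does-¬2∣ (length (filter (_∈? T) (leaves s)))) (count-parity T (leaves s))))
  where
  odd? = λ (e : ℚ × Tree _) → ¬? (2 ∣? length (filter (_∈? T) (leaves (proj₂ e))))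

-- The inclusion tree

⊆∧≢⇒⊂ : ∀ {p q : Subset n} → p ⊆ q → p ≢ q → p ⊂ q
⊆∧≢⇒⊂ {p = p} {q} p⊆q p≢q with any? (λ x → (x ∈? q) ×-dec ¬? (x ∈? p))
... | yes new = p⊆q , new
... | no none = ⊥-elim (p≢q (⊆-antisym p⊆q λ {x} x∈q → old x x∈q))
  where
  old : ∀ x → x ∈ q → x ∈ p
  old x x∈q with x ∈? p
  ... | yes x∈p = x∈p
  ... | no  x∉p = ⊥-elim (none (x , x∈q , x∉p))

⁅⁆⊆ : ∀ {v} {S : Subset n} → v ∈ S → ⁅ v ⁆ ⊆ S
⁅⁆⊆ {v = v} v∈ x∈ rewrite x∈⁅y⁆⇒x≡y v x∈ = v∈

module Inclusion {n} (X : Subset n) (r : Fin n) (r∈X : r ∈ X) (y : Weights n)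
  (laminar : IsLaminar X r y) where

  Fam : Subset n → Set
  Fam = Family X r y

  fam? : ∀ S → Dec (Fam S)
  fam? S = inSupport? X r y S ⊎-dec (S ≟ₛ X) ⊎-dec any? (λ v → (v ∈? X) ×-dec (S ≟ₛ ⁅ v ⁆))

  fam-nonempty : ∀ {S} → Fam S → Nonempty S
  fam-nonempty (inj₁ ((nonempty , _) , _))     = nonempty
  fam-nonempty (inj₂ (inj₁ refl))              = r , r∈X
  fam-nonempty (inj₂ (inj₂ (v , _ , refl)))    = v , x∈⁅x⁆ v

  fam-⊆ : ∀ {S} → Fam S → S ⊆ X
  fam-⊆ (inj₁ ((_ , S⊆) , _))       v∈ = p─q⊆p X ⁅ r ⁆ (S⊆ v∈)
  fam-⊆ (inj₂ (inj₁ refl))          v∈ = v∈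
  fam-⊆ (inj₂ (inj₂ (v , v∈X , refl))) = ⁅⁆⊆ v∈X

  Nested : Subset n → Subset n → Set
  Nested S S′ = Empty (S ∩ S′) ⊎ S ⊆ S′ ⊎ S′ ⊆ S

  singleton-nested : ∀ v S → Nested ⁅ v ⁆ S
  singleton-nested v S with v ∈? S
  ... | yes v∈ = inj₂ (inj₁ (⁅⁆⊆ v∈))
  ... | no  v∉ = inj₁ λ (x , x∈) → let x∈v , x∈S = x∈p∩q⁻ ⁅ v ⁆ S x∈
                                    in v∉ (subst (_∈ S) (x∈⁅y⁆⇒x≡y v x∈v) x∈S)

  nested-sym : ∀ {S S′} → Nested S S′ → Nested S′ S
  nested-sym {S} {S′} (inj₁ empty) = inj₁ λ (x , x∈) →
    let x∈S′ , x∈S = x∈p∩q⁻ S′ S x∈ in empty (x , x∈p∩q⁺ (x∈S , x∈S′))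
  nested-sym (inj₂ (inj₁ ⊆)) = inj₂ (inj₂ ⊆)
  nested-sym (inj₂ (inj₂ ⊇)) = inj₂ (inj₁ ⊇)

  fam-nested : ∀ {S S′} → Fam S → Fam S′ → Nested S S′
  fam-nested (inj₁ supp) (inj₁ supp′)                = laminar _ _ supp supp′
  fam-nested fam (inj₂ (inj₁ refl))                  = inj₂ (inj₁ (fam-⊆ fam))
  fam-nested (inj₂ (inj₁ refl)) fam′                 = inj₂ (inj₂ (fam-⊆ fam′))
  fam-nested (inj₂ (inj₂ (v , _ , refl))) fam′       = singleton-nested v _
  fam-nested {S} fam (inj₂ (inj₂ (v , _ , refl)))    = nested-sym {S = ⁅ v ⁆} (singleton-nested v S)

  Child : Subset n → Subset n → Set
  Child S R = Fam R × IsParent X r y R S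

  -- Among the members of the family that contain R and lie properly inside S, one of largest size
  -- has S as its parent: a strict superset of it is nested with S, and if it were smaller than S it
  -- would be a larger candidate.
  below-child : ∀ {S R} → Fam S → Fam R → R ⊂ S → ∃ λ R′ → Child S R′ × R ⊆ R′
  below-child {S} {R} famS famR R⊂S = M , (famM , famS , M⊂S , least) , R⊆M
    where
    Between : Subset n → Set
    Between Q = Fam Q × R ⊆ Q × Q ⊂ S
    between? : ∀ Q → Dec (Between Q)
    between? Q = fam? Q ×-dec (R ⊆? Q) ×-dec (Q ⊂? S)
    candidates : List (Subset n)
    candidates = filter between? (allSubsets n)
    M : Subset n
    M = argmax ∣_∣ R candidates
    between-M : Between M
    between-M with argmax-sel ∣_∣ R candidates
    ... | inj₁ eq = subst Between (sym eq) (famR , id , R⊂S)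
    ... | inj₂ M∈ = proj₂ (∈-filter⁻ between? {xs = allSubsets n} M∈)
    famM = proj₁ between-M
    R⊆M  = λ {v} → proj₁ (proj₂ between-M) {v}
    M⊂S  = proj₂ (proj₂ between-M)
    largest : ∀ {Q} → Between Q → ∣ Q ∣ ℕ.≤ ∣ M ∣
    largest {Q} bQ = All.lookup (f[xs]≤f[argmax] R candidates) (∈-filter⁺ between? (∈-allSubsets Q) bQ)
    least : ∀ S′ → Fam S′ → M ⊂ S′ → S ⊆ S′
    least S′ famS′ M⊂S′ with fam-nested famS famS′
    ... | inj₁ empty with v , v∈ ← fam-nonempty famM =
      ⊥-elim (empty (v , x∈p∩q⁺ (proj₁ M⊂S v∈ , proj₁ M⊂S′ v∈)))
    ... | inj₂ (inj₁ S⊆S′) = S⊆S′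
    ... | inj₂ (inj₂ S′⊆S) with S′ ≟ₛ S
    ...   | yes refl = id
    ...   | no  S′≢S = ⊥-elim (ℕ.<⇒≱ (p⊂q⇒∣p∣<∣q∣ M⊂S′)
      (largest (famS′ , (λ v∈ → proj₁ M⊂S′ (R⊆M v∈)) , ⊆∧≢⇒⊂ S′⊆S S′≢S)))

  -- If one child were properly contained in another, the parent S, being the least strict superset
  -- of the smaller one, would be contained in the larger one, which is properly inside S.
  children-disjoint : ∀ {S R R′} → Child S R → Child S R′ → R ≢ R′ → Empty (R ∩ R′)
  children-disjoint {S} {R} {R′} (famR , _ , R⊂S , leastR) (famR′ , _ , R′⊂S , leastR′) R≢R′
    with fam-nested famR famR′
  ... | inj₁ empty       = empty
  ... | inj₂ (inj₁ R⊆R′) = ⊥-elim (⊂-irref refl (⊂-⊆-trans R′⊂S (leastR R′ famR′ (⊆∧≢⇒⊂ R⊆R′ R≢R′))))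
  ... | inj₂ (inj₂ R′⊆R) =
    ⊥-elim (⊂-irref refl (⊂-⊆-trans R⊂S (leastR′ R famR (⊆∧≢⇒⊂ R′⊆R (R≢R′ ∘ sym)))))

  value : (List (Fin n) → Bool) → Subset n → ℚ
  value f R = edgeWeight X r y R when f (elements R)

  -- Each edge of t stands for one member of the family properly inside S. Sums over edges thus
  -- become sums over sets, which can be compared with sums over `𝒜`.
  record Described (S : Subset n) (t : Tree n) : Set where
    field
      sets     : List (Subset n)
      unique   : Unique sets
      sound    : ∀ {R} → R ∈ₗ sets → Fam R × R ⊂ S
      complete : ∀ {R} → Fam R → R ⊂ S → R ∈ₗ sets
      sums     : ∀ {f} → Symmetric f → edgeSum f t ≡ sum (value f) sets
      leaves↭  : leaves t ↭ elements S

  record Described* (Rs : List (Subset n)) (cs : List (ℚ × Tree n)) : Set where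
    field
      sets     : List (Subset n)
      unique   : Unique sets
      sound    : ∀ {Q} → Q ∈ₗ sets → Fam Q × ∃ λ R → R ∈ₗ Rs × Q ⊆ R
      complete : ∀ {Q R} → Fam Q → R ∈ₗ Rs → Q ⊆ R → Q ∈ₗ sets
      sums     : ∀ {f} → Symmetric f → edgeSum* f cs ≡ sum (value f) sets
      leaves-unique   : Unique (leaves* cs)
      leaves-sound    : ∀ {v} → v ∈ₗ leaves* cs → ∃ λ R → R ∈ₗ Rs × v ∈ R
      leaves-complete : ∀ {v R} → R ∈ₗ Rs → v ∈ R → v ∈ₗ leaves* cs

  Children : List (Subset n) → List (ℚ × Tree n) → Set
  Children = Pointwise (λ R (w , t) → w ≡ edgeWeight X r y R × InclusionTree X r y R t)

  describe  : ∀ {S t} → InclusionTree X r y S t → Fam S → Described S t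
  describe* : ∀ {Rs cs} → Children Rs cs → All Fam Rs → Unique Rs →
              (∀ {R R′} → R ∈ₗ Rs → R′ ∈ₗ Rs → R ≢ R′ → Empty (R ∩ R′)) → Described* Rs cs

  describe (leaf v) _ = record
    { sets     = []
    ; unique   = []
    ; sound    = λ ()
    ; complete = λ famR R⊂v → ⊥-elim (impossible famR R⊂v)
    ; sums     = λ _ → refl
    ; leaves↭  = unique-↭ ([] ∷ []) (elements-unique ⁅ v ⁆)
        (λ { (here refl) → ∈-elements⁺ (x∈⁅x⁆ v) })
        (λ x∈ → here (x∈⁅y⁆⇒x≡y v (∈-elements⁻ x∈)))
    }
    where
    impossible : ∀ {R} → Fam R → ¬ (R ⊂ ⁅ v ⁆)
    impossible famR (R⊆ , x , x∈ , x∉) with z , z∈ ← fam-nonempty famR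
      rewrite x∈⁅y⁆⇒x≡y v x∈ | sym (x∈⁅y⁆⇒x≡y v (R⊆ z∈)) = x∉ z∈
  describe {S} {node kids} (node Rs notLeaf uniqueRs children cs) famS = record
    { sets     = D.sets
    ; unique   = D.unique
    ; sound    = λ Q∈ → let famQ , R , R∈ , Q⊆R = D.sound Q∈
                        in famQ , ⊆-⊂-trans Q⊆R (proj₁ (proj₂ (proj₂ (child R∈))))
    ; complete = λ famQ Q⊂S → let R , childR , Q⊆R = below-child famS famQ Q⊂S
                              in D.complete famQ (Equivalence.from (children R) childR) Q⊆R
    ; sums     = D.sums
    ; leaves↭  = unique-↭ D.leaves-unique (elements-unique S)
        (λ v∈ → let R , R∈ , v∈R = D.leaves-sound v∈
                in ∈-elements⁺ (proj₁ (proj₁ (proj₂ (proj₂ (child R∈)))) v∈R))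
        (λ {v} v∈ → covered (∈-elements⁻ v∈))
    }
    where
    child : ∀ {R} → R ∈ₗ Rs → Child S R
    child {R} R∈ = Equivalence.to (children R) R∈
    module D = Described* (describe* cs (All.tabulate λ R∈ → proj₁ (child R∈)) uniqueRs
                             (λ R∈ R′∈ → children-disjoint (child R∈) (child R′∈)))
    covered : ∀ {v} → v ∈ S → v ∈ₗ leaves* kids
    covered {v} v∈
      -- S is not a singleton, so the singleton of v is a member of the family properly inside S and
      -- lies below some child.
      with R , childR , v⊆R ← below-child famS (inj₂ (inj₂ (v , fam-⊆ famS v∈ , refl)))
                                (⊆∧≢⇒⊂ (⁅⁆⊆ v∈) (notLeaf v ∘ sym)) =
      D.leaves-complete (Equivalence.from (children R) childR) (v⊆R (x∈⁅x⁆ v))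

  describe* [] _ _ _ = record
    { sets = [] ; unique = [] ; sound = λ () ; complete = λ _ () ; sums = λ _ → refl
    ; leaves-unique = [] ; leaves-sound = λ () ; leaves-complete = λ () }
  describe* {R ∷ Rs} {(w , t) ∷ cs} ((w≡ , tree) ∷ trees) (famR ∷ fams) (R≢ ∷ uniqueRs) disjoint = record
    { sets     = R ∷ D.sets ++ D*.sets
    ; unique   = All.¬Any⇒All¬ _ fresh ∷ Unique.++⁺ D.unique D*.unique apart
    ; sound    = λ { (here refl) → famR , R , here refl , id ; (there Q∈) → sound (∈-++⁻ D.sets Q∈) }
    ; complete = complete
    ; sums     = sums
    ; leaves-unique = Unique.++⁺ leaves-uniqueR D*.leaves-unique leaves-apart
    ; leaves-sound  = λ v∈ → leaves-sound (∈-++⁻ (leaves t) v∈)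
    ; leaves-complete = λ { (here refl) v∈ → ∈-++⁺ˡ (∈-resp-↭ (↭-sym D.leaves↭) (∈-elements⁺ v∈))
                          ; (there Q∈) v∈ → ∈-++⁺ʳ (leaves t) (D*.leaves-complete Q∈ v∈) }
    }
    where
    module D  = Described (describe tree famR)
    module D* = Described* (describe* trees fams uniqueRs (λ A∈ B∈ → disjoint (there A∈) (there B∈)))

    disjointR : ∀ {R′} → R′ ∈ₗ Rs → Empty (R ∩ R′)
    disjointR R′∈ = disjoint (here refl) (there R′∈) λ { refl → All.All¬⇒¬Any R≢ R′∈ }

    outside-R : ∀ {Q} → Q ∈ₗ D*.sets → ¬ (Q ⊆ R)
    outside-R Q∈ Q⊆R with famQ , R′ , R′∈ , Q⊆R′ ← D*.sound Q∈ with v , v∈ ← fam-nonempty famQ =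
      disjointR R′∈ (v , x∈p∩q⁺ (Q⊆R v∈ , Q⊆R′ v∈))

    fresh : R ∉ₗ D.sets ++ D*.sets
    fresh R∈ with ∈-++⁻ D.sets R∈
    ... | inj₁ R∈D  = ⊂-irref refl (proj₂ (D.sound R∈D))
    ... | inj₂ R∈D* = outside-R R∈D* id

    apart : ∀ {Q} → ¬ (Q ∈ₗ D.sets × Q ∈ₗ D*.sets)
    apart (Q∈ , Q∈*) = outside-R Q∈* (proj₁ (proj₂ (D.sound Q∈)))

    sound : ∀ {Q} → Q ∈ₗ D.sets ⊎ Q ∈ₗ D*.sets → Fam Q × ∃ λ R′ → R′ ∈ₗ R ∷ Rs × Q ⊆ R′
    sound (inj₁ Q∈) with famQ , Q⊂R ← D.sound Q∈ = famQ , R , here refl , proj₁ Q⊂R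
    sound (inj₂ Q∈) with famQ , R′ , R′∈ , Q⊆R′ ← D*.sound Q∈ = famQ , R′ , there R′∈ , Q⊆R′

    complete : ∀ {Q R′} → Fam Q → R′ ∈ₗ R ∷ Rs → Q ⊆ R′ → Q ∈ₗ R ∷ D.sets ++ D*.sets
    complete {Q} famQ (here refl) Q⊆R with Q ≟ₛ R
    ... | yes refl = here refl
    ... | no  Q≢R  = there (∈-++⁺ˡ (D.complete famQ (⊆∧≢⇒⊂ Q⊆R Q≢R)))
    complete famQ (there R′∈) Q⊆R′ = there (∈-++⁺ʳ D.sets (D*.complete famQ R′∈ Q⊆R′))

    sums : ∀ {f} → Symmetric f → edgeSum* f ((w , t) ∷ cs) ≡ sum (value f) (R ∷ D.sets ++ D*.sets)
    sums {f} f-sym = cong₂ _+_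
      (cong₂ (λ w b → w when b) w≡ (f-sym D.leaves↭))
      (≡-trans (sum-++ (term f) (edges t) (edges* cs))
        (≡-trans (cong₂ _+_ (D.sums f-sym) (D*.sums f-sym)) (sym (sum-++ (value f) D.sets D*.sets))))

    leaves-uniqueR : Unique (leaves t)
    leaves-uniqueR = Unique-resp-↭ (setoid _) (↭⇒↭ₛ (↭-sym D.leaves↭)) (elements-unique R)

    leaves-sound : ∀ {v} → v ∈ₗ leaves t ⊎ v ∈ₗ leaves* cs → ∃ λ R′ → R′ ∈ₗ R ∷ Rs × v ∈ R′
    leaves-sound (inj₁ v∈) = R , here refl , ∈-elements⁻ (∈-resp-↭ D.leaves↭ v∈)
    leaves-sound (inj₂ v∈) with R′ , R′∈ , v∈R′ ← D*.leaves-sound v∈ = R′ , there R′∈ , v∈R′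

    leaves-apart : ∀ {v} → ¬ (v ∈ₗ leaves t × v ∈ₗ leaves* cs)
    leaves-apart {v} (v∈ , v∈*) with R′ , R′∈ , v∈R′ ← D*.leaves-sound v∈* =
      disjointR R′∈ (v , x∈p∩q⁺ (∈-elements⁻ (∈-resp-↭ D.leaves↭ v∈) , v∈R′))

-- Balanced colourings of binary trees

unique-++⁻ : ∀ xs {ys : List A} → Unique (xs ++ ys) →
             Unique xs × Unique ys × (∀ {x} → x ∈ₗ xs → x ∉ₗ ys)
unique-++⁻ []       u        = [] , u , λ ()
unique-++⁻ (x ∷ xs) (x≢ ∷ u) with uxs , uys , apart ← unique-++⁻ xs u =
  All.++⁻ˡ xs x≢ ∷ uxs , uys ,
  λ { (here refl) → All.All¬⇒¬Any (All.++⁻ʳ xs x≢) ; (there x∈) → apart x∈ }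

Colour : Set
Colour = Fin 3

-- A nonzero linear functional on 𝔽₂² vanishes at exactly one nonzero vector; this is the functional
-- vanishing at i, applied to the colour of v. Its parity over a list is therefore its value at the
-- sum of the colours.
others : (Fin n → Colour) → Colour → Fin n → Bool
others κ i v = not (δ i (κ v))

count : (Fin n → Colour) → Colour → List (Fin n) → ℕ
count κ i = total (λ v → if δ i (κ v) then 1 else 0)

-- The colours 0F, 1F, 2F stand for the nonzero elements of 𝔽₂², and the sum of the colours of xs
-- is c.
HasColour : (Fin n → Colour) → Colour → List (Fin n) → Set
HasColour κ c xs = ∀ i → parity (others κ i) xs ≡ not (δ i c)

IsProper : (Fin n → Colour) → Tree n → Set
IsProper κ t = All (λ (_ , s) → ∃ λ c → HasColour κ c (leaves s)) (edges t)

record Colouring (t : Tree n) (c : Colour) (N : Colour → ℕ) : Set where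
  constructor colouring
  field
    κ      : Fin n → Colour
    root   : HasColour κ c (leaves t)
    proper : IsProper κ t
    counts : ∀ i → count κ i (leaves t) ≡ N i

Permutes : (σ τ : Colour → Colour) → Set
Permutes σ τ = ∀ c i → δ i (σ c) ≡ δ (τ i) c

permutes? : ∀ σ τ → Dec (Permutes σ τ)
permutes? σ τ = Fin.all? λ c → Fin.all? λ i → δ i (σ c) Bool.≟ δ (τ i) c

-- Every permutation of the three nonzero vectors of 𝔽₂² is linear, so it respects sums of colours.
-- The map `τ` is the inverse of `σ`, through which the counts are read off.
recolour : ∀ {t : Tree n} {c N} σ τ → {True (permutes? σ τ)} →
           Colouring t c N → Colouring t (σ c) (N ∘ τ)
recolour {t = t} {c} σ τ {ok} (colouring κ root proper counts) = colouring (σ ∘ κ)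
  (hasColour c (leaves t) root)
  (All.map (λ {(_ , s)} (c , hc) → σ c , hasColour c (leaves s) hc) proper)
  (λ i → ≡-trans (total-cong (λ v → cong (λ b → if b then 1 else 0) (perm (κ v) i)) (leaves t)) (counts (τ i)))
  where
  perm = toWitness ok
  hasColour : ∀ c xs → HasColour κ c xs → HasColour (σ ∘ κ) (σ c) xs
  hasColour c xs hc i = ≡-trans (parity-cong (λ v → cong not (perm (κ v) i)) xs)
    (≡-trans (hc (τ i)) (cong not (sym (perm c i))))
  total-cong : ∀ {f g : Fin _ → ℕ} → f ≗ g → total f ≗ total g
  total-cong eq []       = refl
  total-cong eq (x ∷ xs) = cong₂ ℕ._+_ (eq x) (total-cong eq xs)

recount : ∀ {t : Tree n} {c M N} → M ≗ N → Colouring t c M → Colouring t c N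
recount M≗N (colouring κ root proper counts) =
  colouring κ root proper (λ i → ≡-trans (counts i) (M≗N i))

module Glue {n} {s t : Tree n} (u w : ℚ) (unique : Unique (leaves s ++ leaves t ++ [])) where

  glued : Tree n
  glued = node ((u , s) ∷ (w , t) ∷ [])

  glueMaps : (κ₁ κ₂ : Fin n → Colour) → Fin n → Colour
  glueMaps κ₁ κ₂ v = if does (DecMembership._∈?_ _≟_ v (leaves s)) then κ₁ v else κ₂ v

  glue-left : ∀ κ₁ κ₂ {v} → v ∈ₗ leaves s → glueMaps κ₁ κ₂ v ≡ κ₁ v
  glue-left κ₁ κ₂ {v} v∈ =
    cong (if_then κ₁ v else κ₂ v) (dec-true (DecMembership._∈?_ _≟_ v (leaves s)) v∈)

  glue-right : ∀ κ₁ κ₂ {v} → v ∈ₗ leaves t → glueMaps κ₁ κ₂ v ≡ κ₂ v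
  glue-right κ₁ κ₂ {v} v∈ =
    cong (if_then κ₁ v else κ₂ v) (dec-false (DecMembership._∈?_ _≟_ v (leaves s))
      λ v∈s → proj₂ (proj₂ (unique-++⁻ (leaves s) unique)) v∈s (∈-++⁺ˡ v∈))

  hasColour-cong : ∀ {κ κ′ : Fin n → Colour} c xs → (∀ {v} → v ∈ₗ xs → κ′ v ≡ κ v) →
                   HasColour κ c xs → HasColour κ′ c xs
  hasColour-cong c xs eq hc i =
    ≡-trans (parity-cong-∈ xs λ v∈ → cong (λ c → not (δ i c)) (eq v∈)) (hc i)

  count-cong : ∀ {κ κ′ : Fin n → Colour} {xs} → (∀ {v} → v ∈ₗ xs → κ′ v ≡ κ v) →
               ∀ i → count κ′ i xs ≡ count κ i xs
  count-cong {xs = []}     eq i = refl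
  count-cong {xs = x ∷ xs} eq i =
    cong₂ ℕ._+_ (cong (λ c → if δ i c then 1 else 0) (eq (here refl))) (count-cong (eq ∘ there) i)

  proper-cong : ∀ {κ κ′ : Fin n → Colour} (es : List (ℚ × Tree n)) {xs} →
                (∀ {e} → e ∈ₗ es → ∀ {v} → v ∈ₗ leaves (proj₂ e) → v ∈ₗ xs) →
                (∀ {v} → v ∈ₗ xs → κ′ v ≡ κ v) →
                All (λ (_ , s) → ∃ λ c → HasColour κ c (leaves s)) es →
                All (λ (_ , s) → ∃ λ c → HasColour κ′ c (leaves s)) es
  proper-cong []             lvs eq []                = []
  proper-cong ((_ , s) ∷ es) lvs eq ((c , hc) ∷ rest) =
    (c , hasColour-cong c (leaves s) (λ v∈ → eq (lvs (here refl) v∈)) hc) ∷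
    proper-cong es (lvs ∘ there) eq rest

mutual

  leaves-below : ∀ (t : Tree n) {e} → e ∈ₗ edges t → ∀ {v} → v ∈ₗ leaves (proj₂ e) → v ∈ₗ leaves t
  leaves-below (node cs) = leaves-below* cs

  leaves-below* : ∀ (cs : List (ℚ × Tree n)) {e} → e ∈ₗ edges* cs →
                  ∀ {v} → v ∈ₗ leaves (proj₂ e) → v ∈ₗ leaves* cs
  leaves-below* ((w , t) ∷ cs) (here refl) v∈ = ∈-++⁺ˡ v∈
  leaves-below* ((w , t) ∷ cs) (there e∈)  v∈ with ∈-++⁻ (edges t) e∈
  ... | inj₁ e∈t  = ∈-++⁺ˡ (leaves-below t e∈t v∈)
  ... | inj₂ e∈cs = ∈-++⁺ʳ (leaves t) (leaves-below* cs e∈cs v∈)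

module _ {n} {s t : Tree n} (u w : ℚ) (unique : Unique (leaves s ++ leaves t ++ [])) where
  open Glue {s = s} {t} u w unique

  record Glued (a b : Colour) (M N : Colour → ℕ) : Set where
    field
      κ      : Fin n → Colour
      left   : HasColour κ a (leaves s)
      right  : HasColour κ b (leaves t)
      proper : IsProper κ glued
      counts : ∀ i → count κ i (leaves glued) ≡ M i ℕ.+ N i

  glue : ∀ {a b M N} → Colouring s a M → Colouring t b N → Glued a b M N
  glue {a} {b} (colouring κ₁ root₁ proper₁ counts₁) (colouring κ₂ root₂ proper₂ counts₂) = record
    { κ = κ
    ; left = left
    ; right = right
    ; proper = (a , left) ∷ All.++⁺ (proper-cong (edges s) (leaves-below s) (glue-left κ₁ κ₂) proper₁)
        ((b , right) ∷ All.++⁺ (proper-cong (edges t) (leaves-below t) (glue-right κ₁ κ₂) proper₂) [])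
    ; counts = λ i → ≡-trans (total-++ _ (leaves s) (leaves t ++ [])) (cong₂ ℕ._+_
        (≡-trans (count-cong (glue-left κ₁ κ₂) i) (counts₁ i))
        (≡-trans (total-++ _ (leaves t) []) (≡-trans (ℕ.+-identityʳ _)
          (≡-trans (count-cong (glue-right κ₁ κ₂) i) (counts₂ i)))))
    }
    where
    κ = glueMaps κ₁ κ₂
    left : HasColour κ a (leaves s)
    left = hasColour-cong a (leaves s) (glue-left κ₁ κ₂) root₁
    right : HasColour κ b (leaves t)
    right = hasColour-cong b (leaves t) (glue-right κ₁ κ₂) root₂

  -- The vectors 1F and 2F sum to the third nonzero vector 0F, so children with these sums give the
  -- new node the normalised sum 0F.
  join : ∀ {M N K} → Colouring s 1F M → Colouring t 2F N → M 0F ℕ.+ N 0F ≡ K 0F →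
         M 1F ℕ.+ N 1F ≡ K 1F → M 2F ℕ.+ N 2F ≡ K 2F → Colouring glued 0F K
  join c₁ c₂ K₀ K₁ K₂ = colouring κ root proper
    λ { 0F → ≡-trans (counts 0F) K₀ ; 1F → ≡-trans (counts 1F) K₁ ; 2F → ≡-trans (counts 2F) K₂ }
    where
    open Glued (glue c₁ c₂)
    third : ∀ i → not (δ i 1F) xor (not (δ i 2F) xor false) ≡ not (δ i 0F)
    third 0F = refl
    third 1F = refl
    third 2F = refl
    root : HasColour κ 0F (leaves glued)
    root i = ≡-trans (parity-++ _ (leaves s) (leaves t ++ []))
      (≡-trans (cong₂ _xor_ (left i) (≡-trans (parity-++ _ (leaves t) []) (cong (_xor false) (right i))))
               (third i))

data Kind : Set where
  one two three : Kind

-- A subtree with 3q + 1, 3q + 2 or 3q + 3 leaves; its colour sum is 0F.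
profile : Kind → ℕ → Colour → ℕ
profile one   q 0F = 1 ℕ.+ q
profile one   q _  = q
profile two   q 0F = q
profile two   q _  = 1 ℕ.+ q
profile three q 0F = 1 ℕ.+ q
profile three q 1F = 2 ℕ.+ q
profile three q 2F = q

swap01 swap02 swap12 cycle cycle⁻¹ : Colour → Colour
swap01 0F = 1F
swap01 1F = 0F
swap01 2F = 2F
swap02 0F = 2F
swap02 1F = 1F
swap02 2F = 0F
swap12 0F = 0F
swap12 1F = 2F
swap12 2F = 1F
cycle 0F = 1F
cycle 1F = 2F
cycle 2F = 0F
cycle⁻¹ 0F = 2F
cycle⁻¹ 1F = 0F
cycle⁻¹ 2F = 1F

+-suc₂ : ∀ p q → p ℕ.+ suc (suc q) ≡ suc (suc (p ℕ.+ q))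
+-suc₂ p q = ≡-trans (ℕ.+-suc p (suc q)) (cong suc (ℕ.+-suc p q))

-- The imbalance is forced: equal counts have colour sum zero, which is not allowed on an edge. A
-- nonzero sum 0F makes the count of 0F differ in parity from the other two, and the profiles are as
-- even as this permits.
Balanced : Tree n → Set
Balanced t = ∃₂ λ kind q → Colouring t 0F (profile kind q)

-- Kinds add modulo 3 as the numbers of leaves do. The children must get sums 1F and 2F, which
-- leaves two permutations for each of them; the choice matters only for `three`, whose counts are
-- not symmetric in 1F and 2F, and it is made so that the excesses even out.
balanced : ∀ {t : Tree n} → Binary t → Unique (leaves t) → Balanced t
balanced (leaf v) _ = one , 0 , colouring (λ _ → 0F) root [] counts
  where
  root : HasColour (λ _ → 0F) 0F (v ∷ [])
  root 0F = refl
  root 1F = refl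
  root 2F = refl
  counts : ∀ i → count (λ _ → 0F) i (v ∷ []) ≡ profile one 0 i
  counts 0F = refl
  counts 1F = refl
  counts 2F = refl
balanced (node {u} {w} {s} {t} bs bt) unique
  with us , ut , _ ← unique-++⁻ (leaves s) unique
  with balanced bs us | balanced bt (proj₁ (unique-++⁻ (leaves t) ut))
... | one , p , c | one , q , c′ = two , p ℕ.+ q , join u w unique
  (recolour swap01 swap01 c) (recolour swap02 swap02 c′)
  refl refl (ℕ.+-suc p q)
... | one , p , c | two , q , c′ = three , p ℕ.+ q , join u w unique
  (recolour swap01 swap01 c) (recolour swap02 swap02 c′)
  (ℕ.+-suc p q) (cong suc (ℕ.+-suc p q)) refl
... | one , p , c | three , q , c′ = one , suc (p ℕ.+ q) , join u w unique
  (recolour swap01 swap01 c) (recolour cycle⁻¹ cycle c′)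
  (+-suc₂ p q) refl (ℕ.+-suc p q)
-- The joined colouring has its excess at 2F and its deficit at 1F; the outer `swap12` turns this
-- into the profile `three`.
... | two , p , c | one , q , c′ = three , p ℕ.+ q ,
  recount (λ { 0F → refl ; 1F → refl ; 2F → refl }) (recolour swap12 swap12 (join u w unique {K = profile three (p ℕ.+ q) ∘ swap12}
    (recolour swap01 swap01 c) (recolour swap02 swap02 c′)
    refl refl (cong suc (ℕ.+-suc p q))))
... | two , p , c | two , q , c′ = one , suc (p ℕ.+ q) , join u w unique
  (recolour swap01 swap01 c) (recolour swap02 swap02 c′)
  (cong suc (ℕ.+-suc p q)) (ℕ.+-suc p q) refl
... | two , p , c | three , q , c′ = two , suc (p ℕ.+ q) , join u w unique
  (recolour swap01 swap01 c) (recolour swap02 swap02 c′)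
  refl (+-suc₂ p q) (cong suc (ℕ.+-suc p q))
... | three , p , c | one , q , c′ = one , suc (p ℕ.+ q) , join u w unique
  (recolour swap01 swap01 c) (recolour swap02 swap02 c′)
  refl refl (ℕ.+-suc p q)
... | three , p , c | two , q , c′ = two , suc (p ℕ.+ q) , join u w unique
  (recolour cycle cycle⁻¹ c) (recolour swap02 swap02 c′)
  (ℕ.+-suc p q) (cong suc (ℕ.+-suc p q)) refl
... | three , p , c | three , q , c′ = three , suc (p ℕ.+ q) , join u w unique
  (recolour swap01 swap01 c) (recolour swap02 swap02 c′)
  refl (cong suc (+-suc₂ p q)) (ℕ.+-suc p q)

count-sum : ∀ (κ : Fin n → Colour) xs →
            count κ 0F xs ℕ.+ (count κ 1F xs ℕ.+ count κ 2F xs) ≡ length xs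
count-sum κ []       = refl
count-sum κ (x ∷ xs) with κ x | count-sum κ xs
... | 0F | eq = cong suc eq
... | 1F | eq = ≡-trans (ℕ.+-suc (count κ 0F xs) _) (cong suc eq)
... | 2F | eq = ≡-trans (cong (count κ 0F xs ℕ.+_) (ℕ.+-suc (count κ 1F xs) (count κ 2F xs)))
                        (≡-trans (ℕ.+-suc (count κ 0F xs) _) (cong suc eq))

not-divisible : ∀ r {s j} → r % 3 ≢ 0 → r ℕ.+ s ℕ.* 3 ≢ j ℕ.* 3
not-divisible r {s} {j} r≢0 eq =
  r≢0 (≡-trans (sym ([m+kn]%n≡m%n r s 3)) (≡-trans (cong (_% 3) eq) (m*n%n≡0 j 3)))

record Equitable (t : Tree n) (j : ℕ) : Set where
  constructor equitable
  field
    κ      : Fin n → Colour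
    proper : IsProper κ t
    counts : ∀ i → count κ i (leaves t) ≡ j

module _ {n} {s t : Tree n} {u w : ℚ} {unique : Unique (leaves s ++ leaves t ++ [])} {j}
  (size : length (leaves s ++ leaves t ++ []) ≡ j ℕ.* 3)
  {M N} (g : Glued {s = s} {t} u w unique 0F 0F M N) where
  open Glued g

  glued-size : (M 0F ℕ.+ N 0F) ℕ.+ ((M 1F ℕ.+ N 1F) ℕ.+ (M 2F ℕ.+ N 2F)) ≡ j ℕ.* 3
  glued-size = ≡-trans
    (sym (cong₂ ℕ._+_ (counts 0F) (cong₂ ℕ._+_ (counts 1F) (counts 2F))))
    (≡-trans (count-sum κ (leaves s ++ leaves t ++ [])) size)

  accept : ∀ {c} → (∀ i → M i ℕ.+ N i ≡ c) → Equitable (node ((u , s) ∷ (w , t) ∷ [])) j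
  accept {c} const = equitable κ proper λ i → ≡-trans (counts i) (≡-trans (const i)
    (ℕ.*-cancelʳ-≡ c j 3 (≡-trans (triple c) (≡-trans
      (sym (cong₂ ℕ._+_ (const 0F) (cong₂ ℕ._+_ (const 1F) (const 2F)))) glued-size))))
    where
    triple : ∀ c → c ℕ.* 3 ≡ c ℕ.+ (c ℕ.+ c)
    triple = solve-∀

  reject : ∀ r q → {_ : True (¬? (r % 3 ℕ.≟ 0))} →
           (M 0F ℕ.+ N 0F) ℕ.+ ((M 1F ℕ.+ N 1F) ℕ.+ (M 2F ℕ.+ N 2F)) ≡ r ℕ.+ q ℕ.* 3 →
           Equitable (node ((u , s) ∷ (w , t) ∷ [])) j
  reject r q {r≢0} eq = ⊥-elim (not-divisible r {q} {j} (toWitness r≢0) (≡-trans (sym eq) glued-size))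

-- No edge lies above the root, so there the colour sum may vanish: both children keep the sum 0F,
-- and their imbalances cancel. The remaining pairs of kinds have a number of leaves not divisible
-- by 3.
equitableColouring : ∀ {t : Tree n} {j} → Binary t → Unique (leaves t) → length (leaves t) ≡ j ℕ.* 3 →
                     Equitable t j
equitableColouring {j = j} (leaf v) _ size = ⊥-elim (not-divisible 1 {0} {j} (λ ()) size)
equitableColouring {j = j} (node {u} {w} {s} {t} bs bt) unique size
  with us , ut , _ ← unique-++⁻ (leaves s) unique
  with balanced bs us | balanced bt (proj₁ (unique-++⁻ (leaves t) ut))
... | one , p , c | two , q , c′ = accept size (glue u w unique c c′) λ
  { 0F → refl ; 1F → ℕ.+-suc p q ; 2F → ℕ.+-suc p q }
... | two , p , c | one , q , c′ = accept size (glue u w unique c c′) λ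
  { 0F → ℕ.+-suc p q ; 1F → refl ; 2F → refl }
-- `swap12` fixes the sum 0F and exchanges the excess at 1F with the deficit at 2F.
... | three , p , c | three , q , c′ =
  accept size (glue u w unique c (recolour swap12 swap12 c′)) λ
  { 0F → cong suc (ℕ.+-suc p q) ; 1F → refl ; 2F → +-suc₂ p q }
... | one , p , c | one , q , c′ = reject size (glue u w unique c c′) 2 (p ℕ.+ q) (lemma p q)
  where
  lemma : ∀ p q → (1 ℕ.+ p ℕ.+ (1 ℕ.+ q)) ℕ.+ ((p ℕ.+ q) ℕ.+ (p ℕ.+ q)) ≡ 2 ℕ.+ (p ℕ.+ q) ℕ.* 3
  lemma = solve-∀
... | one , p , c | three , q , c′ = reject size (glue u w unique c c′) 1 (1 ℕ.+ (p ℕ.+ q)) (lemma p q)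
  where
  lemma : ∀ p q → (1 ℕ.+ p ℕ.+ (1 ℕ.+ q)) ℕ.+ ((p ℕ.+ (2 ℕ.+ q)) ℕ.+ (p ℕ.+ q)) ≡
                  1 ℕ.+ (1 ℕ.+ (p ℕ.+ q)) ℕ.* 3
  lemma = solve-∀
... | two , p , c | two , q , c′ = reject size (glue u w unique c c′) 1 (1 ℕ.+ (p ℕ.+ q)) (lemma p q)
  where
  lemma : ∀ p q → (p ℕ.+ q) ℕ.+ ((1 ℕ.+ p ℕ.+ (1 ℕ.+ q)) ℕ.+ (1 ℕ.+ p ℕ.+ (1 ℕ.+ q))) ≡
                  1 ℕ.+ (1 ℕ.+ (p ℕ.+ q)) ℕ.* 3
  lemma = solve-∀
... | two , p , c | three , q , c′ = reject size (glue u w unique c c′) 2 (1 ℕ.+ (p ℕ.+ q)) (lemma p q)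
  where
  lemma : ∀ p q → (p ℕ.+ (1 ℕ.+ q)) ℕ.+ ((1 ℕ.+ p ℕ.+ (2 ℕ.+ q)) ℕ.+ (1 ℕ.+ p ℕ.+ q)) ≡
                  2 ℕ.+ (1 ℕ.+ (p ℕ.+ q)) ℕ.* 3
  lemma = solve-∀
... | three , p , c | one , q , c′ = reject size (glue u w unique c c′) 1 (1 ℕ.+ (p ℕ.+ q)) (lemma p q)
  where
  lemma : ∀ p q → (1 ℕ.+ p ℕ.+ (1 ℕ.+ q)) ℕ.+ ((2 ℕ.+ p ℕ.+ q) ℕ.+ (p ℕ.+ q)) ≡
                  1 ℕ.+ (1 ℕ.+ (p ℕ.+ q)) ℕ.* 3
  lemma = solve-∀
... | three , p , c | two , q , c′ = reject size (glue u w unique c c′) 2 (1 ℕ.+ (p ℕ.+ q)) (lemma p q)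
  where
  lemma : ∀ p q → (1 ℕ.+ p ℕ.+ q) ℕ.+ ((2 ℕ.+ p ℕ.+ (1 ℕ.+ q)) ℕ.+ (p ℕ.+ (1 ℕ.+ q))) ≡
                  2 ℕ.+ (1 ℕ.+ (p ℕ.+ q)) ℕ.* 3
  lemma = solve-∀

-- Each edge has one colour, so it is odd for exactly two of the three sets of leaves avoiding a colour.
edgeSum-colours : ∀ {κ} (t : Tree n) → IsProper κ t →
                  edgeSum (parity (others κ 0F)) t +
                    (edgeSum (parity (others κ 1F)) t + edgeSum (parity (others κ 2F)) t) ≡
                  edgeSum (λ _ → true) t + edgeSum (λ _ → true) t
edgeSum-colours {n} {κ} t proper = begin
  S 0F + (S 1F + S 2F)
    ≡⟨ cong (S 0F +_) (sum-+ (f 1F) (f 2F) (edges t)) ⟨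
  S 0F + sum (λ e → f 1F e + f 2F e) (edges t)
    ≡⟨ sum-+ (f 0F) (λ e → f 1F e + f 2F e) (edges t) ⟨
  sum (λ e → f 0F e + (f 1F e + f 2F e)) (edges t)
    ≡⟨ sum-cong-∈ (edges t) (λ {e} e∈ → twice e (All.lookup proper e∈)) ⟩
  sum (λ e → proj₁ e + proj₁ e) (edges t)
    ≡⟨ sum-+ proj₁ proj₁ (edges t) ⟩
  edgeSum (λ _ → true) t + edgeSum (λ _ → true) t ∎
  where
  open ≡-Reasoning
  f : Colour → ℚ × Tree n → ℚ
  f i = term (parity (others κ i))
  S : Colour → ℚ
  S i = sum (f i) (edges t)
  twice : ∀ e → (∃ λ c → HasColour κ c (leaves (proj₂ e))) →
          f 0F e + (f 1F e + f 2F e) ≡ proj₁ e + proj₁ e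
  twice (w , s) (c , hc) rewrite hc 0F | hc 1F | hc 2F with c
  ... | 0F = ℚ.+-identityˡ (w + w)
  ... | 1F = cong (w +_) (ℚ.+-identityˡ w)
  ... | 2F = cong (w +_) (ℚ.+-identityʳ w)

-- Joins and matchings of a set of even size

∂ᵥ-elements : ∀ (T : Subset n) v → ∂ᵥ (elements T) v ≡ lookup T v
∂ᵥ-elements T v with v ∈? T
... | yes v∈ = ≡-trans (∂ᵥ-∈ (elements-unique T) (∈-elements⁺ v∈)) (sym (∈⇒lookup v∈))
... | no  v∉ = ≡-trans (∂ᵥ-∉ (v∉ ∘ ∈-elements⁻)) (sym (∉⇒lookup v∉))

-- A T-join to start from: for even `∣ T ∣` the copies of the centre x cancel in the boundary.
star : Fin n → Subset n → List (Edge n)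
star x T = map (x ,_) (elements T)

∂-star : ∀ x (T : Subset n) → odd ∣ T ∣ ≡ false → ∀ v → ∂ (star x T) v ≡ lookup T v
∂-star x T even v = begin
  ∂ (star x T) v
    ≡⟨ parity-map _ (x ,_) (elements T) ⟩
  parity (λ t → δ x v xor δ t v) (elements T)
    ≡⟨ parity-xor _ _ (elements T) ⟩
  parity (λ _ → δ x v) (elements T) xor ∂ᵥ (elements T) v
    ≡⟨ cong₂ _xor_ (constant (δ x v)) (∂ᵥ-elements T v) ⟩
  lookup T v ∎
  where
  open ≡-Reasoning
  constant : ∀ b → parity (λ _ → b) (elements T) ≡ false
  constant false = parity-false _ (elements T) (λ _ → refl)
  constant true  = ≡-trans (parity-const-true (elements T)) (≡-trans (cong odd (length-elements T)) even)

record MinimumMatching (D : EvenMetric n) (T : Subset n) : Set where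
  constructor minimum-matching
  field
    M       : List (Edge n)
    perfect : M ∈ₗ perfectMatchings T
    size    : 2 ℕ.* length M ≡ ∣ T ∣
    minimal : EvenMetric.IsMinimal D M

minimumPerfectMatching : ∀ (D : EvenMetric n) → Fin n → ∀ T → odd ∣ T ∣ ≡ false → MinimumMatching D T
minimumPerfectMatching D x T even = go (minimumMatching D (star x T))
  where
  T≡ : tabulate (∂ (star x T)) ≡ T
  T≡ = ≡-trans (tabulate-cong (∂-star x T even)) (tabulate∘lookup T)
  go : (let T′ = tabulate (∂ (star x T)) in
    ∃ λ M → M ∈ₗ perfectMatchings T′ × 2 ℕ.* length M ≡ ∣ T′ ∣ × ∂ M ≗ ∂ (star x T) ×
            EvenMetric.IsMinimal D M) → MinimumMatching D T
  go (M , M∈ , size , _ , minimal) rewrite T≡ = minimum-matching M M∈ size minimal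

parity-true : ∀ (f : A → Bool) xs → parity f xs ≡ true → ∃ λ x → x ∈ₗ xs × f x ≡ true
parity-true f (x ∷ xs) eq with f x in fx
... | true  = x , here refl , fx
... | false with z , z∈ , fz ← parity-true f xs eq = z , there z∈ , fz

parity-elements : ∀ (f : Fin n → Bool) S → parity f (elements S) ≡ parity (λ v → lookup S v ∧ f v) (allFin n)
parity-elements f S = filtered (allFin _)
  where
  filtered : ∀ xs → parity f (filter (_∈? S) xs) ≡ parity (λ v → lookup S v ∧ f v) xs
  filtered []       = refl
  filtered (x ∷ xs) with x ∈? S
  ... | yes x∈ rewrite ∈⇒lookup x∈ = cong (f x xor_) (filtered xs)
  ... | no  x∉ rewrite ∉⇒lookup x∉ = filtered xs

perfectMatching-E : ∀ {T : Subset n} {M} → M ∈ₗ perfectMatchings T → ∀ {e} → e ∈ₗ M → e ∈ₗ E T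
perfectMatching-E {T = T} M∈ =
  sublists-⊆ (proj₁ (∈-filter⁻ (isPerfectMatching? T) {xs = sublists (E T)} M∈))

abstract

  odd-cut-crossed : ∀ {T : Subset n} {M} → M ∈ₗ perfectMatchings T → ∀ S →
                    parity (lookup T) (elements S) ≡ true → ∃ λ e → e ∈ₗ M × Crosses S e
  odd-cut-crossed {n} {T} {M} M∈ S odd-S = crossed (parity-true _ M (≡-trans (sym odd-M) odd-S))
    where
    crossed : (∃ λ e → e ∈ₗ M × lookup S (proj₁ e) xor lookup S (proj₂ e) ≡ true) →
              ∃ λ e → e ∈ₗ M × Crosses S e
    crossed (e , e∈ , jump) with _ , _ , a<b ← ∈-E⁻ {X = T} (perfectMatching-E {T = T} M∈ e∈) =
      e , e∈ , proj₂ (crosses-xor {X = S} (<⇒≢ a<b)) jump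
    odd-M : parity (lookup T) (elements S) ≡ parity (λ (a , b) → lookup S a xor lookup S b) M
    odd-M = begin
      parity (lookup T) (elements S)
        ≡⟨ parity-elements (lookup T) S ⟩
      parity (λ v → lookup S v ∧ lookup T v) (allFin n)
        ≡⟨ parity-cong (λ v → cong (lookup S v ∧_) (sym (∂-perfectMatching M∈ v))) (allFin n) ⟩
      parity (λ v → lookup S v ∧ ∂ M v) (allFin n)
        ≡⟨ parity-∂ (lookup S) (Unique.allFin⁺ n) M (λ {e} _ → ∈-allFin (proj₁ e) , ∈-allFin (proj₂ e)) ⟩
      parity (λ (a , b) → lookup S a xor lookup S b) M ∎
      where open ≡-Reasoning

-- The tree of an optimal laminar packing

module LaminarTree {n} (d : DistanceFunction (Fin n)) (C : Subset n) (r : Fin n) (r∈C : r ∈ C)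
  (y : Weights n) (packing : IsPacking d C r y) (laminar : IsLaminar C r y)
  (t : Tree n) (isTree : IsLaminarTree C r y t)
  where
  open IsPacking packing
  open Inclusion C r r∈C y laminar

  module D = Described (describe (proj₁ (proj₂ (proj₂ isTree))) (inj₂ (inj₁ refl)))
  module R = Equivalent (refined-equivalent (proj₂ (proj₂ (proj₂ isTree))))

  leaves-t : leaves t ↭ elements C
  leaves-t = ↭-trans (↭-sym R.leaves↭) D.leaves↭

  sums : ∀ {f} → Symmetric f → edgeSum f t ≡ sum (value f) D.sets
  sums f-sym = ≡-trans (sym (R.edgeSum≡ f-sym)) (D.sums f-sym)

  data EdgeWeight (S : Subset n) : Set where
    supported   : InSupport C r y S → edgeWeight C r y S ≡ y S → EdgeWeight S
    unsupported : ¬ InSupport C r y S → edgeWeight C r y S ≡ 0ℚ → EdgeWeight S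

  edgeWeight-view : ∀ S → EdgeWeight S
  edgeWeight-view S with inSupport? C r y S
  ... | yes supp  = supported supp (cong (if_then y S else 0ℚ) (dec-true (inSupport? C r y S) supp))
  ... | no  ¬supp = unsupported ¬supp (cong (if_then y S else 0ℚ) (dec-false (inSupport? C r y S) ¬supp))

  edgeWeight-≥0 : ∀ S → 0ℚ ≤ edgeWeight C r y S
  edgeWeight-≥0 S with edgeWeight-view S
  ... | supported (_ , 0<y) eq rewrite eq = ℚ.<⇒≤ 0<y
  ... | unsupported _ eq       rewrite eq = ℚ.≤-refl

  value-0 : ∀ f {S} → edgeWeight C r y S ≡ 0ℚ → value f S ≤ 0ℚ
  value-0 f {S} eq rewrite eq with f (elements S)
  ... | true  = ℚ.≤-refl
  ... | false = ℚ.≤-refl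

  total-weight : sum y (𝒜 C r) ≤ edgeSum (λ _ → true) t
  total-weight = begin
    sum y (𝒜 C r)                     ≤⟨ sum-mono-∈ (𝒜 C r) (λ {S} S∈ → y-≤ S (∈-𝒜⁻ S∈)) ⟩
    sum (value (λ _ → true)) (𝒜 C r)  ≤⟨ sum-⊆-≤ (𝒜-unique C r) (λ {S} _ → edgeWeight-≥0 S) (λ {S} _ → in-sets S) ⟩
    sum (value (λ _ → true)) D.sets   ≡⟨ sums (λ _ → refl) ⟨
    edgeSum (λ _ → true) t            ∎
    where
    open ℚ.≤-Reasoning
    y-≤ : ∀ S → S ∈𝒜⟨ C , r ⟩ → y S ≤ edgeWeight C r y S
    y-≤ S S∈ with edgeWeight-view S
    ... | supported _ eq      = ℚ.≤-reflexive (sym eq)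
    ... | unsupported ¬supp eq rewrite eq = ℚ.≮⇒≥ λ 0<y → ¬supp (S∈ , 0<y)
    in-sets : ∀ S → value (λ _ → true) S ≤ 0ℚ ⊎ S ∈ₗ D.sets
    in-sets S with edgeWeight-view S
    ... | unsupported _ eq = inj₁ (value-0 (λ _ → true) eq)
    -- A set of the support omits the root, so it is a proper subset of C and has an edge in the
    -- tree.
    ... | supported supp@((_ , S⊆) , _) _ = inj₂ (D.complete (inj₁ supp)
            ((λ v∈ → p─q⊆p C ⁅ r ⁆ (S⊆ v∈)) , r , r∈C , λ r∈ → x∈p─q⇒x∉q C ⁅ r ⁆ (S⊆ r∈) (x∈⁅x⁆ r)))

  -- Weak duality: each odd set is charged to a matching edge that crosses it. After the sums are
  -- exchanged, feasibility bounds the charge of an edge by its length; `T ⊆ C` is what places the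
  -- edge in `E C`.
  weight-J-≤ : ∀ {T M} → T ⊆ C → M ∈ₗ perfectMatchings T → weight (J t T) ≤ cost d M
  weight-J-≤ {T} {M} T⊆C M∈ = begin
    weight (J t T)
      ≡⟨ weight-J t T ⟩
    edgeSum odd-T t
      ≡⟨ sums (parity-↭ (lookup T)) ⟩
    sum (value odd-T) D.sets
      ≤⟨ sum-⊆-≤ D.unique (λ {S} _ → when-≥0 (odd-T (elements S)) (edgeWeight-≥0 S)) (λ {S} _ → in-𝒜 S) ⟩
    sum (value odd-T) (𝒜 C r)
      ≤⟨ sum-mono-∈ (𝒜 C r) (λ {S} S∈ → crossed S (∈-𝒜⁻ S∈)) ⟩
    sum (λ S → sum (crossing S) M) (𝒜 C r)
      ≡⟨ sum-swap crossing (𝒜 C r) M ⟩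
    sum (λ e → sum (λ S → crossing S e) (𝒜 C r)) M
      ≡⟨ sum-cong-∈ M (λ {e} _ → sum-filter (λ S → crosses? S e) y (𝒜 C r)) ⟨
    sum (λ e → sum y (filter (λ S → crosses? S e) (𝒜 C r))) M
      ≤⟨ sum-mono-∈ M (λ {e} e∈ → feasible e (in-C e∈)) ⟩
    cost d M ∎
    where
    open ℚ.≤-Reasoning
    odd-T : List (Fin n) → Bool
    odd-T = parity (lookup T)
    crossing : Subset n → Edge n → ℚ
    crossing S e = y S when does (crosses? S e)
    in-C : ∀ {e} → e ∈ₗ M → e ∈ₗ E C
    in-C e∈ with a∈ , b∈ , a<b ← ∈-E⁻ {X = T} (perfectMatching-E {T = T} M∈ e∈) = ∈-E⁺ (T⊆C a∈) (T⊆C b∈) a<b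
    in-𝒜 : ∀ S → value odd-T S ≤ 0ℚ ⊎ S ∈ₗ 𝒜 C r
    in-𝒜 S with edgeWeight-view S
    ... | unsupported _ eq    = inj₁ (value-0 odd-T eq)
    ... | supported (S∈ , _) _ = inj₂ (∈-𝒜⁺ S∈)
    edgeWeight-≤ : ∀ S → S ∈𝒜⟨ C , r ⟩ → edgeWeight C r y S ≤ y S
    edgeWeight-≤ S S∈ with edgeWeight-view S
    ... | supported _ eq   = ℚ.≤-reflexive eq
    ... | unsupported _ eq rewrite eq = nonNegative S S∈
    crossed : ∀ S → S ∈𝒜⟨ C , r ⟩ → value odd-T S ≤ sum (crossing S) M
    crossed S S∈ with odd-T (elements S) in odd-S
    ... | false = sum-≥0 M λ {e} _ → when-≥0 (does (crosses? S e)) (nonNegative S S∈)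
    ... | true with e , e∈ , crosses ← odd-cut-crossed {T = T} M∈ S odd-S = begin
      edgeWeight C r y S            ≤⟨ edgeWeight-≤ S S∈ ⟩
      y S                           ≡⟨ cong (y S when_) (dec-true (crosses? S e) crosses) ⟨
      crossing S e                  ≡⟨ ℚ.+-identityʳ _ ⟨
      sum (crossing S) (e ∷ [])     ≤⟨ sum-⊆-≤ {xs = e ∷ []} ([] ∷ [])
                                         (λ {e} _ → when-≥0 (does (crosses? S e)) (nonNegative S S∈))
                                         (λ { (here refl) → inj₂ e∈ }) ⟩
      sum (crossing S) M            ∎

  equitable-t : ∀ j → ∣ C ∣ ≡ j ℕ.* 3 → Equitable t j
  equitable-t j size = equitableColouring (proj₁ isTree)
    (Unique-resp-↭ (setoid _) (↭⇒↭ₛ (↭-sym leaves-t)) (elements-unique C))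
    (≡-trans (↭-length leaves-t) (≡-trans (length-elements C) size))

  module Colours {j} (size : ∣ C ∣ ≡ j ℕ.* 3) (equitable-colouring : Equitable t j) where

    open Equitable equitable-colouring

    chosen : Colour → Subset n
    chosen i = tabulate λ v → lookup C v ∧ others κ i v

    lookup-chosen : ∀ i {v} → v ∈ C → lookup (chosen i) v ≡ others κ i v
    lookup-chosen i {v} v∈ = ≡-trans (lookup∘tabulate _ v) (cong (_∧ others κ i v) (∈⇒lookup v∈))

    chosen⊆C : ∀ i → chosen i ⊆ C
    chosen⊆C i {v} v∈ with lookup C v in eq | ∈-tabulate⁻ {f = λ v → lookup C v ∧ others κ i v} v∈
    ... | true  | _  = lookup⇒∈ eq
    ... | false | ()

    weight-chosen : ∀ i → weight (J t (chosen i)) ≡ edgeSum (parity (others κ i)) t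
    weight-chosen i = ≡-trans (weight-J t (chosen i)) (sum-cong-∈ (edges t) λ {(w , s)} e∈ →
      cong (w when_) (parity-cong-∈ (leaves s) λ v∈ →
        lookup-chosen i (∈-elements⁻ (∈-resp-↭ leaves-t (leaves-below t e∈ v∈)))))

    size-chosen : ∀ i → ∣ chosen i ∣ ≡ j ℕ.* 2
    size-chosen i = ℕ.+-cancelʳ-≡ j _ _ (begin
      ∣ chosen i ∣ ℕ.+ j
        ≡⟨ cong₂ ℕ._+_ (sym (length-unique (Unique.filter⁺ avoids? (elements-unique C)) to from))
                       (≡-trans (sym (counts i)) (total-↭ _ leaves-t)) ⟩
      length (filter avoids? (elements C)) ℕ.+ count κ i (elements C)
        ≡⟨ split (elements C) ⟩
      length (elements C)
        ≡⟨ ≡-trans (length-elements C) size ⟩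
      j ℕ.* 3
        ≡⟨ lemma j ⟩
      j ℕ.* 2 ℕ.+ j ∎)
      where
      open ≡-Reasoning
      lemma : ∀ j → j ℕ.* 3 ≡ j ℕ.* 2 ℕ.+ j
      lemma = solve-∀
      avoids? : ∀ v → Dec (others κ i v ≡ true)
      avoids? v = others κ i v Bool.≟ true
      to : ∀ {v} → v ∈ₗ filter avoids? (elements C) → v ∈ chosen i
      to v∈ with v∈C , avoids ← ∈-filter⁻ avoids? {xs = elements C} v∈ =
        lookup⇒∈ (≡-trans (lookup-chosen i (∈-elements⁻ v∈C)) avoids)
      from : ∀ {v} → v ∈ chosen i → v ∈ₗ filter avoids? (elements C)
      from v∈ = let v∈C = chosen⊆C i v∈ in ∈-filter⁺ avoids? (∈-elements⁺ v∈C)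
        (≡-trans (sym (lookup-chosen i v∈C)) (∈⇒lookup v∈))
      split : ∀ xs → length (filter avoids? xs) ℕ.+ count κ i xs ≡ length xs
      split []       = refl
      split (x ∷ xs) with δ i (κ x)
      ... | true  = ≡-trans (ℕ.+-suc _ _) (cong suc (split xs))
      ... | false = cong suc (split xs)

    two-thirds : ∀ {Tₘ} → (∀ T → T ⊆ C → ∣ T ∣ ≡ j ℕ.* 2 → weight (J t T) ≤ weight (J t Tₘ)) →
                 let W = weight (J t Tₘ) ; Y = sum y (𝒜 C r) in Y + Y ≤ W + (W + W)
    two-thirds {Tₘ} best = begin
      sum y (𝒜 C r) + sum y (𝒜 C r)
        ≤⟨ ℚ.+-mono-≤ total-weight total-weight ⟩
      edgeSum (λ _ → true) t + edgeSum (λ _ → true) t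
        ≡⟨ edgeSum-colours {κ = κ} t proper ⟨
      S 0F + (S 1F + S 2F)
        ≤⟨ ℚ.+-mono-≤ (bound 0F) (ℚ.+-mono-≤ (bound 1F) (bound 2F)) ⟩
      weight (J t Tₘ) + (weight (J t Tₘ) + weight (J t Tₘ)) ∎
      where
      open ℚ.≤-Reasoning
      S : Colour → ℚ
      S i = edgeSum (parity (others κ i)) t
      bound : ∀ i → S i ≤ weight (J t Tₘ)
      bound i = subst (_≤ weight (J t Tₘ)) (weight-chosen i)
                      (best (chosen i) (chosen⊆C i) (size-chosen i))

-- Two lower bounds on an optimal packing

half+half : ∀ q → ½ * q + ½ * q ≡ q
half+half q = ≡-trans (sym (ℚ.*-distribʳ-+ q ½ ½)) (ℚ.*-identityˡ q)

2⋆half : ∀ q → 2 ⋆ (½ * q) ≡ q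
2⋆half q = ≡-trans (cong (λ z → ½ * q + z) (ℚ.+-identityʳ (½ * q))) (half+half q)

½*-≥0 : ∀ {q} → 0ℚ ≤ q → 0ℚ ≤ ½ * q
½*-≥0 0≤q = ℚ.≤-trans (ℚ.≤-reflexive (sym (ℚ.*-zeroʳ ½))) (ℚ.*-monoˡ-≤-nonNeg ½ 0≤q)

indicator : Bool → ℕ
indicator b = if b then 1 else 0

total-indicator : ∀ {P : A → Set} (P? : ∀ x → Dec (P x)) xs →
                  total (λ x → indicator (does (P? x))) xs ≡ length (filter P? xs)
total-indicator P? []       = refl
total-indicator P? (x ∷ xs) with does (P? x)
... | true  = cong suc (total-indicator P? xs)
... | false = total-indicator P? xs

singleton-crossings : ∀ {xs : List (Fin n)} → Unique xs → ∀ a b → crossings (map δ xs) a b ℕ.≤ 2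
singleton-crossings {xs = xs} u a b = ℕ.≤-trans (split xs) (ℕ.+-mono-≤ (once a) (once b))
  where
  once : ∀ v → total (λ c → indicator (δ c v)) xs ℕ.≤ 1
  once v = subst (ℕ._≤ 1) (sym (total-indicator (v ≟_) xs))
    (unique-length-≤ {ys = v ∷ []} (Unique.filter⁺ (v ≟_) u)
      λ {x} x∈ → here (sym (proj₂ (∈-filter⁻ (v ≟_) {xs = xs} x∈))))
  xor-≤ : ∀ x y → indicator (x xor y) ℕ.≤ indicator x ℕ.+ indicator y
  xor-≤ true  true  = ℕ.z≤n
  xor-≤ true  false = ℕ.≤-refl
  xor-≤ false y     = ℕ.≤-refl
  interleave : ∀ p q r s → (p ℕ.+ q) ℕ.+ (r ℕ.+ s) ≡ (p ℕ.+ r) ℕ.+ (q ℕ.+ s)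
  interleave = solve-∀
  split : ∀ xs → crossings (map δ xs) a b ℕ.≤
          total (λ c → indicator (δ c a)) xs ℕ.+ total (λ c → indicator (δ c b)) xs
  split []       = ℕ.z≤n
  split (c ∷ xs) = ℕ.≤-trans (ℕ.+-mono-≤ (xor-≤ (δ c a) (δ c b)) (split xs))
    (ℕ.≤-reflexive (interleave (indicator (δ c a)) (indicator (δ c b)) _ _))

crossings-0 : ∀ {Z} {a b : Fin n} → crossings Z a b ≡ 0 → ∀ {S} → S ∈ₗ Z → S a xor S b ≡ false
crossings-0 {a = a} {b} eq {S} (here refl) with S a xor S b | eq
... | false | _ = refl
crossings-0 {Z = S′ ∷ _} {a} {b} eq (there S∈) = crossings-0 (ℕ.m+n≡0⇒n≡0 (indicator (S′ a xor S′ b)) eq) S∈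

other-element : ∀ {C : Subset n} → 1 ℕ.< ∣ C ∣ → ∀ c → ∃ λ c′ → c′ ∈ C × c′ ≢ c
other-element {C = C} 1<C c with any? (λ c′ → (c′ ∈? C) ×-dec ¬? (c′ ≟ c))
... | yes other = other
... | no  none  = ⊥-elim (ℕ.<⇒≱ 1<C (subst (∣ C ∣ ℕ.≤_) (∣⁅x⁆∣≡1 c) (p⊆q⇒∣p∣≤∣q∣ (λ {v} → only v))))
  where
  only : ∀ v → v ∈ C → v ∈ ⁅ c ⁆
  only v v∈ with v ≟ c
  ... | yes refl = x∈⁅x⁆ c
  ... | no  v≢c  = ⊥-elim (none (v , v∈ , v≢c))

module Bounds {n} (d : DistanceFunction (Fin n)) (metric : IsMetric _≡_ d)
  (C : Subset n) (net : Traversal.Net d metric C) (r : Fin n) (r∈C : r ∈ C)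
  {y : Weights n} (optimal : IsOptimalPacking d C r y)
  where
  open IsMetric metric using (nonNegative; ≈⇒0; triangle) renaming (sym to d-sym)
  open Traversal.Net net

  Y : ℚ
  Y = sum y (𝒜 C r)

  -- Moats of width ρ / 2 around the points of C are disjoint.
  moats-≤ : 1 ℕ.< ∣ C ∣ → ∣ C ∣ ⋆ (½ * ρ) ≤ Y
  moats-≤ 1<C = subst (λ m → m ⋆ (½ * ρ) ≤ Y)
    (≡-trans (length-map δ (elements C)) (length-elements C))
    (FromCuts.cuts-≤ d C r (½*-≥0 ρ≥0) (map δ (elements C)) proper packs r∈C optimal)
    where
    proper : All (Proper C) (map δ (elements C))
    proper = All.map⁺ (All.tabulate λ {c} c∈ → let c′ , c′∈ , c′≢c = other-element 1<C c in
      c , c′ , ∈-elements⁻ c∈ , c′∈ , cong₂ _xor_ (δ-refl c) (δ-≢ {a = c} c′≢c))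
    packs : ∀ {a b} → a ∈ C → b ∈ C → a ≢ b → crossings (map δ (elements C)) a b ⋆ (½ * ρ) ≤ d a b
    packs {a} {b} a∈ b∈ a≢b = begin
      crossings (map δ (elements C)) a b ⋆ (½ * ρ)
        ≤⟨ ⋆-monoˡ-≤ (½*-≥0 ρ≥0) (singleton-crossings (elements-unique C) a b) ⟩
      2 ⋆ (½ * ρ)
        ≡⟨ 2⋆half ρ ⟩
      ρ
        ≤⟨ dispersed a∈ b∈ a≢b ⟩
      d a b ∎
      where open ℚ.≤-Reasoning

  -- Half a common unit makes every distance an even multiple of `w`, so all vertices can be put on
  -- the same side of an `EvenMetric`. The half-integrality of cut packings is absorbed in `w`.
  record Scaled : Set where
    field
      w    : ℚ
      w>0  : 0ℚ ℚ.< w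
      h    : Fin n → Fin n → ℕ
      d≡   : ∀ a b → d a b ≡ h a b ⋆ w
      even : ∀ a b → odd (h a b) ≡ false

  scaled : Scaled
  scaled with w , unit , multiples ← commonUnit {map (uncurry d) (cartesianProduct (allFin n) (allFin n))}
                                       (All.map⁺ (All.tabulate λ _ → nonNegative)) = record
    { w    = ½ * w
    ; w>0  = subst (ℚ._< ½ * w) (ℚ.*-zeroʳ ½) (ℚ.*-monoʳ-<-pos ½ (unit-pos unit))
    ; h    = λ a b → m a b ℕ.+ m a b
    ; d≡   = λ a b → begin
        d a b                                          ≡⟨ proj₂ (multiple a b) ⟩
        m a b ⋆ w                                      ≡⟨ cong (m a b ⋆_) (half+half w) ⟨
        m a b ⋆ (½ * w + ½ * w)                        ≡⟨ ×-distrib-+ (½ * w) (½ * w) (m a b) ⟩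
        m a b ⋆ (½ * w) + m a b ⋆ (½ * w)              ≡⟨ ×-homo-+ (½ * w) (m a b) (m a b) ⟨
        (m a b ℕ.+ m a b) ⋆ (½ * w)                    ∎
    ; even = λ a b → ≡-trans (odd-+ (m a b) (m a b)) (xor-same (odd (m a b)))
    }
    where
    open ≡-Reasoning
    multiple : ∀ a b → d a b MultipleOf w
    multiple a b = All.lookup multiples (∈-map⁺ (uncurry d) (∈-cartesianProduct⁺ (∈-allFin a) (∈-allFin b)))
    m : Fin n → Fin n → ℕ
    m a b = proj₁ (multiple a b)

  module Projected (S : Scaled) where
    open Scaled S

    h-0 : ∀ a → h a a ≡ 0
    h-0 a = ⋆-cancel-≡ w>0 (≡-trans (sym (d≡ a a)) (≈⇒0 refl))

    h-sym : ∀ a b → h a b ≡ h b a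
    h-sym a b = ⋆-cancel-≡ w>0 (≡-trans (sym (d≡ a b)) (≡-trans (d-sym a b) (d≡ b a)))

    h-triangle : ∀ a b c → h a c ℕ.≤ h a b ℕ.+ h b c
    h-triangle a b c = ⋆-cancel-≤ w>0 (begin
      h a c ⋆ w                ≡⟨ d≡ a c ⟨
      d a c                    ≤⟨ triangle a b c ⟩
      d a b + d b c            ≡⟨ cong₂ _+_ (d≡ a b) (d≡ b c) ⟩
      h a b ⋆ w + h b c ⋆ w    ≡⟨ ×-homo-+ w (h a b) (h b c) ⟨
      (h a b ℕ.+ h b c) ⋆ w    ∎)
      where open ℚ.≤-Reasoning

    -- The metric of the centres pulled back along `π`. Points with the same centre stay distinct at
    -- gap 0, so T remains a set and its perfect matchings are also matchings for `d`.
    projected : EvenMetric n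
    projected = record
      { gap      = λ a b → h (π a) (π b)
      ; side     = λ _ → false
      ; diagonal = λ a → h-0 (π a)
      ; gap-sym  = λ a b → h-sym (π a) (π b)
      ; triangle = λ a b c → h-triangle (π a) (π b) (π c)
      ; odd-gap  = λ a b → even (π a) (π b)
      }
    open EvenMetric projected using (len)

    -- A point and its centre have gap 0, so no cut of the packing separates them. Each cut is thus
    -- a union of fibres of `π` and induces a proper cut of C.
    packed-≤ : ∀ {c} → CutPacking projected c → c ⋆ w ≤ Y
    packed-≤ (cutPacking cuts refl proper packs) =
      FromCuts.cuts-≤ d C r (ℚ.<⇒≤ w>0) cuts (All.tabulate λ S∈ → proper-C S∈ (All.lookup proper S∈))
        packs-C r∈C optimal
      where
      unseparated : ∀ {S} → S ∈ₗ cuts → ∀ a → S a ≡ S (π a)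
      unseparated {S} S∈ a = xor-false (S a) (S (π a)) (crossings-0 {Z = cuts} {a} {π a}
        (ℕ.n≤0⇒n≡0 (ℕ.≤-trans (packs a (π a))
          (ℕ.≤-reflexive (≡-trans (cong (h (π a)) (fixed (π∈C a))) (h-0 (π a)))))) S∈)
        where
        xor-false : ∀ x y → x xor y ≡ false → x ≡ y
        xor-false true  true  _ = refl
        xor-false false false _ = refl
      proper-C : ∀ {S} → S ∈ₗ cuts → (∃₂ λ a b → S a xor S b ≡ true) → Proper C S
      proper-C S∈ (a , b , Sab) = π a , π b , π∈C a , π∈C b ,
        ≡-trans (sym (cong₂ _xor_ (unseparated S∈ a) (unseparated S∈ b))) Sab
      packs-C : ∀ {a b} → a ∈ C → b ∈ C → a ≢ b → crossings cuts a b ⋆ w ≤ d a b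
      packs-C {a} {b} a∈ b∈ _ = begin
        crossings cuts a b ⋆ w    ≤⟨ ⋆-monoˡ-≤ (ℚ.<⇒≤ w>0) (packs a b) ⟩
        h (π a) (π b) ⋆ w         ≡⟨ cong₂ (λ a b → h a b ⋆ w) (fixed a∈) (fixed b∈) ⟩
        h a b ⋆ w                 ≡⟨ d≡ a b ⟨
        d a b                     ∎
        where open ℚ.≤-Reasoning

    via-net : ∀ a b → d a b ≤ h (π a) (π b) ⋆ w + 2 ⋆ ρ
    via-net a b = begin
      d a b                                         ≤⟨ triangle a (π a) b ⟩
      d a (π a) + d (π a) b                         ≤⟨ ℚ.+-mono-≤ (close a) (triangle (π a) (π b) b) ⟩
      ρ + (d (π a) (π b) + d (π b) b)               ≡⟨ cong (λ z → ρ + (d (π a) (π b) + z)) (d-sym (π b) b) ⟩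
      ρ + (d (π a) (π b) + d b (π b))               ≤⟨ ℚ.+-monoʳ-≤ ρ (ℚ.+-mono-≤ (ℚ.≤-reflexive (d≡ (π a) (π b))) (close b)) ⟩
      ρ + (h (π a) (π b) ⋆ w + ρ)                   ≡⟨ solveℚ 2 (λ x y → x ⊕ (y ⊕ x) ⊜ y ⊕ (x ⊕ (x ⊕ conℚ 0ℚ))) refl ρ (h (π a) (π b) ⋆ w) ⟩
      h (π a) (π b) ⋆ w + 2 ⋆ ρ                     ∎
      where
      open ℚ.≤-Reasoning
      open +-*-Solver using () renaming (solve to solveℚ; con to conℚ; _:+_ to _⊕_; _:=_ to _⊜_)

    matching-≤ : ∀ {T} → MinimumMatching projected T → μ d T ≤ Y + ∣ T ∣ ⋆ ρ
    matching-≤ {T} (minimum-matching M perfect size minimal) = begin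
      μ d T
        ≤⟨ minimum-≤ (∈-map⁺ (cost d) perfect) ⟩
      cost d M
        ≤⟨ sum-mono-∈ M (λ {(a , b)} _ → via-net a b) ⟩
      sum (λ (a , b) → h (π a) (π b) ⋆ w + 2 ⋆ ρ) M
        ≡⟨ sum-+ (λ (a , b) → h (π a) (π b) ⋆ w) (λ _ → 2 ⋆ ρ) M ⟩
      sum (λ (a , b) → h (π a) (π b) ⋆ w) M + sum (λ _ → 2 ⋆ ρ) M
        ≡⟨ cong₂ _+_ (sum-total _ w M) (sum-const (2 ⋆ ρ) M) ⟩
      len M ⋆ w + length M ⋆ (2 ⋆ ρ)
        ≡⟨ cong (λ z → len M ⋆ w + z) (≡-trans (×-assocˡ ρ (length M) 2)
             (cong (_⋆ ρ) (≡-trans (ℕ.*-comm (length M) 2) size))) ⟩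
      len M ⋆ w + ∣ T ∣ ⋆ ρ
        ≤⟨ ℚ.+-monoˡ-≤ (∣ T ∣ ⋆ ρ) (packed-≤ (packCuts (len M) projected r M minimal)) ⟩
      Y + ∣ T ∣ ⋆ ρ ∎
      where open ℚ.≤-Reasoning

    even-≤ : ∀ T → odd ∣ T ∣ ≡ false → μ d T ≤ Y + ∣ T ∣ ⋆ ρ
    even-≤ T even = matching-≤ (minimumPerfectMatching projected r T even)

  μ-≤ : ∀ T → odd ∣ T ∣ ≡ false → μ d T ≤ Y + ∣ T ∣ ⋆ ρ
  μ-≤ = Projected.even-≤ scaled

  -- The minimum over an empty list is a dummy 0, so a perfect matching has to be exhibited;
  -- evenness of `∣ T ∣` provides one.
  ≤-μ : ∀ {q} T → odd ∣ T ∣ ≡ false → (∀ {M} → M ∈ₗ perfectMatchings T → q ≤ cost d M) → q ≤ μ d T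
  ≤-μ {q} T even bound
    with M , M∈ , eq ← ∈-map⁻ (cost d) (minimum-∈ (∈-map⁺ (cost d)
      (MinimumMatching.perfect (minimumPerfectMatching (Projected.projected scaled) r T even)))) =
    subst (q ≤_) (sym eq) (bound M∈)

  OPT-≤ : ∀ k → odd k ≡ false → OPT d k ≤ Y + k ⋆ ρ
  OPT-≤ k even = maximum-≤ (ℚ.+-mono-≤ Y≥0 (⋆-≥0 k ρ≥0)) (All.map⁺ (All.tabulate λ {T} T∈ →
    let ∣T∣≡k = proj₂ (∈-filter⁻ (λ T → ∣ T ∣ ℕ.≟ k) {xs = allSubsets n} T∈)
    in subst (λ k → μ d T ≤ Y + k ⋆ ρ) ∣T∣≡k (μ-≤ T (≡-trans (cong odd ∣T∣≡k) even))))
    where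
    Y≥0 : 0ℚ ≤ Y
    Y≥0 = sum-≥0 (𝒜 C r) λ {S} S∈ → IsPacking.nonNegative (IsOptimalPacking.isPacking optimal) S (∈-𝒜⁻ S∈)
    -- The assumption `0ℚ ≤ q` covers the dummy value of `maximum []`.
    maximum-≤ : ∀ {q xs} → 0ℚ ≤ q → All (_≤ q) xs → maximum xs ≤ q
    maximum-≤ 0≤q []          = 0≤q
    maximum-≤ 0≤q (x≤q ∷ xs≤q) = ℚ-Extrema.max≤v⁺ x≤q xs≤q

-- The approximation factor

open import Data.Integer.Base using (+_)

-- Here a is jρ/2 with k = 2j, so `3 ⋆ a` is the total moat width mρ/2 and `4 ⋆ a` is kρ. The
-- constant 8/21 is 4/3 of 2/7, and 2/7 + 8/21 = 2/3 is the share of Y guaranteed by the three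
-- colour classes.
factor : ∀ {a Y W} → 3 ⋆ a ≤ Y → Y + Y ≤ W + (W + W) → (+ 2 / 7) * (Y + 4 ⋆ a) ≤ W
factor {a} {Y} {W} 3a≤Y 2Y≤3W = begin
  (+ 2 / 7) * (Y + 4 ⋆ a)
    ≡⟨ solveℚ 2 (λ a Y → conℚ (+ 2 / 7) ⊗ (Y ⊕ (a ⊕ (a ⊕ (a ⊕ (a ⊕ conℚ 0ℚ))))) ⊜
                        conℚ (+ 2 / 7) ⊗ Y ⊕ conℚ (+ 8 / 21) ⊗ (a ⊕ (a ⊕ (a ⊕ conℚ 0ℚ)))) refl a Y ⟩
  (+ 2 / 7) * Y + (+ 8 / 21) * (3 ⋆ a)
    ≤⟨ ℚ.+-monoʳ-≤ ((+ 2 / 7) * Y) (ℚ.*-monoˡ-≤-nonNeg (+ 8 / 21) 3a≤Y) ⟩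
  (+ 2 / 7) * Y + (+ 8 / 21) * Y
    ≡⟨ solveℚ 1 (λ Y → conℚ (+ 2 / 7) ⊗ Y ⊕ conℚ (+ 8 / 21) ⊗ Y ⊜ conℚ (+ 1 / 3) ⊗ (Y ⊕ Y)) refl Y ⟩
  (+ 1 / 3) * (Y + Y)
    ≤⟨ ℚ.*-monoˡ-≤-nonNeg (+ 1 / 3) 2Y≤3W ⟩
  (+ 1 / 3) * (W + (W + W))
    ≡⟨ solveℚ 1 (λ W → conℚ (+ 1 / 3) ⊗ (W ⊕ (W ⊕ W)) ⊜ W) refl W ⟩
  W ∎
  where
  open ℚ.≤-Reasoning
  open +-*-Solver using () renaming (solve to solveℚ; con to conℚ; _:+_ to _⊕_; _:*_ to _⊗_; _:=_ to _⊜_)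

corollary3 : (n : ℕ) (d : DistanceFunction (Fin n)) → IsMetric _≡_ d → 2 ℕ.≤ n →
    (k : ℕ) → 2 ∣ k → 2 ℕ.≤ k → 3 ℕ.* k ℕ.≤ 2 ℕ.* n →
    (Tₘ : Subset n) → IsCenteredAllCutOutput d k ((3 ℕ.* k) ℕ./ 2) Tₘ →
    ∣ Tₘ ∣ ≡ k × (+ 2 / 7) * OPT d k ≤ μ d Tₘ
corollary3 n d metric _ _ (divides j refl) 2≤k 3k≤2n Tₘ output = ∣Tₘ∣≡k , (begin
  (+ 2 / 7) * OPT d (j ℕ.* 2)
    ≤⟨ ℚ.*-monoˡ-≤-nonNeg (+ 2 / 7) (OPT-≤ (j ℕ.* 2) (odd-double j)) ⟩
  (+ 2 / 7) * (Y + (j ℕ.* 2) ⋆ ρ)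
    ≡⟨ cong (λ q → (+ 2 / 7) * (Y + q)) kρ≡ ⟩
  (+ 2 / 7) * (Y + 4 ⋆ (j ⋆ (½ * ρ)))
    ≤⟨ factor {j ⋆ (½ * ρ)} 3a≤Y (two-thirds maximal) ⟩
  weight (J tree Tₘ)
    ≤⟨ ≤-μ Tₘ (≡-trans (cong odd ∣Tₘ∣≡k) (odd-double j)) (weight-J-≤ Tₘ⊆C) ⟩
  μ d Tₘ ∎)
  where
  open ℚ.≤-Reasoning
  open IsCenteredAllCutOutput output
  open Traversal d metric using (traversal; isNet⇒Net; Net; module Net)

  m≡ : (3 ℕ.* (j ℕ.* 2)) ℕ./ 2 ≡ j ℕ.* 3
  m≡ = ≡-trans (cong (ℕ._/ 2) (lemma j)) (ℕ.m*n/n≡m (j ℕ.* 3) 2)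
    where
    lemma : ∀ j → 3 ℕ.* (j ℕ.* 2) ≡ j ℕ.* 3 ℕ.* 2
    lemma = solve-∀

  m≤n : (3 ℕ.* (j ℕ.* 2)) ℕ./ 2 ℕ.≤ n
  m≤n = subst ((3 ℕ.* (j ℕ.* 2)) ℕ./ 2 ℕ.≤_) (≡-trans (cong (ℕ._/ 2) (ℕ.*-comm 2 n)) (ℕ.m*n/n≡m n 2))
          (ℕ./-monoˡ-≤ 2 3k≤2n)

  size : ∣ C ∣ ≡ j ℕ.* 3
  size = ≡-trans (proj₁ (traversal _ m≤n)) m≡

  net : Net C
  net = isNet⇒Net (root , root∈C) (proj₂ (traversal _ m≤n))
  open Net net using (ρ)

  open Bounds d metric C net root root∈C y-optimal
  module Laminar = LaminarTree d C root root∈C y (IsOptimalPacking.isPacking y-optimal) y-laminar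
                               tree isLaminarTree
  open Laminar using (weight-J-≤)
  open Laminar.Colours size (Laminar.equitable-t j size) using (two-thirds)

  1<∣C∣ : 1 ℕ.< ∣ C ∣
  1<∣C∣ = subst (1 ℕ.<_) (sym size) (ℕ.≤-trans 2≤k (ℕ.*-monoʳ-≤ j (ℕ.n≤1+n 2)))

  3a≤Y : 3 ⋆ (j ⋆ (½ * ρ)) ≤ Y
  3a≤Y = subst (_≤ Y)
    (≡-trans (cong (_⋆ (½ * ρ)) (≡-trans size (ℕ.*-comm j 3))) (sym (×-assocˡ (½ * ρ) 3 j)))
    (moats-≤ 1<∣C∣)

  kρ≡ : (j ℕ.* 2) ⋆ ρ ≡ 4 ⋆ (j ⋆ (½ * ρ))
  kρ≡ = ≡-trans (cong ((j ℕ.* 2) ⋆_) (sym (2⋆half ρ))) (≡-trans (×-assocˡ (½ * ρ) (j ℕ.* 2) 2)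
    (≡-trans (cong (_⋆ (½ * ρ)) (lemma j)) (sym (×-assocˡ (½ * ρ) 4 j))))
    where
    lemma : ∀ j → j ℕ.* 2 ℕ.* 2 ≡ 4 ℕ.* j
    lemma = solve-∀
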